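{- Let $G$ be a generalized Bethe tree. Then $G$ induces a periodic Grover walk if and only if $G$ is isomorphic (as a graph) to one of the following: (a) the path $P_{n+1}$ on $n+1$ vertices, for some $n \in \mathbb{N}$; (b) $S_k(ST_l)$ for some $k \in \mathbb{N}$ and $l \geq 3$; (c) $S_k(B(1,2,3))$ for some $k \in \mathbb{N}$; (d) $S_k(B(s,3))$ for some $k \in \mathbb{N}$ and $s \in \mathbb{N}$ with $s \geq 2$. Moreover, the periods of the Grover walks induced by these graphs are $2n$, $4k$, $12k$ and $12k$, respectively.
   Context: All graphs are finite, simple and connected. For a graph $G=(V,E)$, let $D(G)=\{(u,v),(v,u) : uv \in E\}$ be the set of arcs; for an arc $e=(u,v)$ write $o(e)=u$, $t(e)=v$, $e^{ -1}=(v,u)$. The Grover transfer matrix $U=U(G)$ is the matrix indexed by $D(G)$ with $U_{e,f}=2/\deg(t(f))$ if $t(f)=o(e)$ and $e \neq f^{ -1}$; $U_{e,f}=2/\deg(t(f))-1$ if $e=f^{ -1}$; and $U_{e,f}=0$ otherwise. $G$ induces a periodic Grover walk if $U^k=I$ for some $k\in\mathbb{N}$; the period is the least such $k$ (then $G$ induces a $k$-periodic Grover walk). A generalized Bethe tree $B(d(0),d(1),\dots,d(n-1))$ (with $n\ge 1$ and all $d(i)\ge 1$) is a rooted tree whose vertex set is partitioned into levels $C_0=\{\text{root}\},C_1,\dots,C_n$ such that every vertex of $C_i$ ($0\le i\le n-1$) has exactly $d(i)$ neighbours in $C_{i+1}$ (its children) and exactly one neighbour in $C_{i-1}$ if $i\ge1$,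 and vertices of $C_n$ are leaves. Thus $B(s,3)$ is the rooted tree whose root has $s$ children each having $3$ children, and $B(1,2,3)$ is the rooted tree whose root has one child, which has $2$ children, each of which has $3$ children. $P_m$ denotes the path on $m$ vertices and $ST_m$ the star on $m$ vertices. For $k\in\mathbb{N}$, the $k$-subdivision $S_k(H)$ of a graph $H$ is obtained by replacing each edge of $H$ by a path with $k$ edges (i.e., inserting $k-1$ new vertices on each edge). -}

module Defs where

open import Data.Bool using (Bool; true; false; if_then_else_; _∧_; _∨_)
open import Data.Bool.Properties using (∨-comm)
open import Data.Nat as ℕ using (ℕ; zero; suc; _+_; _*_; _∸_; _<ᵇ_; _≡ᵇ_; _≤_; _<_)
open import Data.Nat.DivMod using (_/_; _%_)
open import Data.Fin using (Fin; toℕ) renaming (zero to fzero; suc to fsuc)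
open import Data.Fin.Properties using () renaming (_≟_ to _≟ᶠ_)
open import Data.Integer using (+_)
open import Data.Rational as ℚ using (ℚ; 0ℚ; 1ℚ) renaming (_+_ to _+ℚ_; _*_ to _*ℚ_; _-_ to _-ℚ_)
open import Data.List using (List; []; _∷_)
open import Data.Product using (Σ; _×_; _,_)
open import Relation.Nullary using (¬_; does)
open import Relation.Binary.PropositionalEquality using (_≡_; refl)
open import Function.Bundles using (_↔_; Inverse)

record Graph : Set where
  field
    size   : ℕ
    adj    : Fin size → Fin size → Bool
    sym    : ∀ u v → adj u v ≡ adj v u
    irrefl : ∀ u → adj u u ≡ false
open Graph public

_≅_ : Graph → Graph → Set
G ≅ H = Σ (Fin (size G) ↔ Fin (size H)) λ σ →
          ∀ u v → adj G u v ≡ adj H (Inverse.to σ u) (Inverse.to σ v)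

Σℚ : (n : ℕ) → (Fin n → ℚ) → ℚ
Σℚ zero    f = 0ℚ
Σℚ (suc n) f = f fzero +ℚ Σℚ n (λ i → f (fsuc i))

count : (n : ℕ) → (Fin n → Bool) → ℕ
count zero    p = 0
count (suc n) p = (if p fzero then 1 else 0) + count n (λ i → p (fsuc i))

module _ (G : Graph) where
  private
    N = size G

  -- arcs are ordered pairs (u , v) with u ~ v; o (u , v) = u, t (u , v) = v
  Arc : Fin N × Fin N → Set
  Arc (u , v) = adj G u v ≡ true

  deg : Fin N → ℕ
  deg v = count N (adj G v)

  -- matrices indexed by arcs (entries at non-arc indices are never used)
  Mat : Set
  Mat = Fin N × Fin N → Fin N × Fin N → ℚ

  idM : Mat
  idM (a , b) (c , d) =
    if does (a ≟ᶠ c) ∧ does (b ≟ᶠ d) then 1ℚ else 0ℚ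

  _·_ : Mat → Mat → Mat
  (A · B) e f = Σℚ N λ u → Σℚ N λ v →
    if adj G u v then A e (u , v) *ℚ B (u , v) f else 0ℚ

  twoOver : ℕ → ℚ
  twoOver zero    = 0ℚ
  twoOver (suc n) = (+ 2) ℚ./ suc n

  -- U_{e,f} with e = (a , b), f = (c , d): t(f) = d, o(e) = a, f⁻¹ = (d , c)
  Grover : Mat
  Grover (a , b) (c , d) =
    if does (d ≟ᶠ a)
      then (if does (b ≟ᶠ c) then twoOver (deg d) -ℚ 1ℚ else twoOver (deg d))
      else 0ℚ

  Upow : ℕ → Mat
  Upow zero    = idM
  Upow (suc k) = Grover · Upow k

  UpowIsId : ℕ → Set
  UpowIsId k = ∀ e f → Arc e → Arc f → Upow k e f ≡ idM e f

  Periodic : Set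
  Periodic = Σ ℕ λ k → (1 ≤ k) × UpowIsId k

  HasPeriod : ℕ → Set
  HasPeriod p = (1 ≤ p) × UpowIsId p × (∀ j → 1 ≤ j → j < p → ¬ UpowIsId j)

-- Rooted trees given by a parent array: vertices 0 .. size-1, root 0,
-- each vertex v ≥ 1 adjacent to par v (which is < v in all constructions
-- below; the adjacency only uses parent links with par v < v).

record PTree : Set where
  field
    tsize : ℕ
    par   : ℕ → ℕ
open PTree public

ltRefl : ∀ n → (n <ᵇ n) ≡ false
ltRefl zero    = refl
ltRefl (suc n) = ltRefl n

treeAdj : (p : ℕ → ℕ) → ℕ → ℕ → Bool
treeAdj p a b = ((a <ᵇ b) ∧ (p b ≡ᵇ a)) ∨ ((b <ᵇ a) ∧ (p a ≡ᵇ b))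

treeAdj-sym : ∀ p a b → treeAdj p a b ≡ treeAdj p b a
treeAdj-sym p a b = ∨-comm ((a <ᵇ b) ∧ (p b ≡ᵇ a)) ((b <ᵇ a) ∧ (p a ≡ᵇ b))

treeAdj-irrefl : ∀ p a → treeAdj p a a ≡ false
treeAdj-irrefl p a rewrite ltRefl a = refl

graph : PTree → Graph
graph T = record
  { size   = tsize T
  ; adj    = λ u v → treeAdj (par T) (toℕ u) (toℕ v)
  ; sym    = λ u v → treeAdj-sym (par T) (toℕ u) (toℕ v)
  ; irrefl = λ u → treeAdj-irrefl (par T) (toℕ u)
  }

pathT : ℕ → PTree
pathT m = record { tsize = m ; par = λ v → v ∸ 1 }

starT : ℕ → PTree
starT m = record { tsize = m ; par = λ v → 0 }

-- generalized Bethe tree B(d(0), ..., d(n-1)), vertices numbered level by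
-- level (BFS order); a vertex at offset x of level i+1 has as parent the
-- vertex at offset x / d(i) of level i.
betheSizeGo : ℕ → List ℕ → ℕ
betheSizeGo len []       = len
betheSizeGo len (d ∷ ds) = len + betheSizeGo (len * d) ds

-- current level starts at index `start` and has `len` vertices
betheParGo : ℕ → ℕ → List ℕ → ℕ → ℕ
betheParGo start len []             v = 0
betheParGo start len (zero ∷ ds)    v = 0
betheParGo start len (suc d ∷ ds)   v =
  if v <ᵇ (start + len + len * suc d)
    then start + ((v ∸ (start + len)) / suc d)
    else betheParGo (start + len) (len * suc d) ds v

betheT : List ℕ → PTree
betheT ds = record { tsize = betheSizeGo 1 ds ; par = betheParGo 0 1 ds }

-- k-subdivision S_k of a tree: original non-root vertex j ↦ j*k, and the
-- k-1 new vertices on the edge {par j , j} are 1+(j-1)k, ..., j*k - 1.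
subdivT : ℕ → PTree → PTree
subdivT zero    T = record { tsize = 1 ; par = λ v → 0 }
subdivT (suc k) T = record
  { tsize = suc ((tsize T ∸ 1) * suc k)
  ; par   = λ w → pw w
  }
  where
    pw : ℕ → ℕ
    pw zero    = 0
    pw (suc w) =
      if (w % suc k) ≡ᵇ 0
        then par T (suc (w / suc k)) * suc k
        else w

B : List ℕ → Graph
B ds = graph (betheT ds)

P : ℕ → Graph
P m = graph (pathT m)

S[_]ST : ℕ → ℕ → Graph
S[ k ]ST l = graph (subdivT k (starT l))

S[_]B123 : ℕ → Graph
S[ k ]B123 = graph (subdivT k (betheT (1 ∷ 2 ∷ 3 ∷ [])))

S[_]Bs3 : ℕ → ℕ → Graph
S[ k ]Bs3 s = graph (subdivT k (betheT (s ∷ 3 ∷ [])))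

{-# OPTIONS --safe #-}
-- A vertex of degree 2 transmits the waves arriving at it, so cutting every edge into k pieces
-- multiplies the period by k.  This leaves the trees B(1), B(m), B(1,2,3) and B(s,3), whose
-- walks satisfy explicit linear recurrences.
--
-- Conversely, the entries of the powers of a periodic U have bounded denominators.  The states
-- that depend on the level only, and those that are opposite on two children of a vertex with
-- several children, follow a walk on a line whose top reflects waves with sign s = 1 and s = -1
-- respectively.  On the line waves are scattered only at the branching levels, with reflection
-- coefficient (d - 1) / (d + 1) for d children.  With one such level, a suitable impulse produces
-- a signal X that begins with A + B - 1 zeros and satisfies
--   (d + 1) (X(A+B+t) - s X(t)) = (d - 1) (X(A+t) - s X(B+t)),
-- where A and B are the times of a return trip above and below the level.  If X is a multiple of
-- an integer sequence, the denominator m of (d - 1) / (d + 1) divides X(A+t) - s X(B+t); for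
-- A ≠ B this propagates the divisibility by m from the initial zeros to all of X, and dividing
-- by m again and again gives X = 0, which is absurd.  So A = B, and for s = -1 likewise m = 2,
-- that is d = 3.  In the same way a branching level above this pair forces s = 1, A = B, d = 2,
-- so that at most two branching levels below the root (one if the root branches) are possible.
module Submission where

open import Defs hiding (sym)
open import Data.Bool using (Bool; true; false; if_then_else_; _∧_)
open import Data.Bool.Properties using (T-≡)
open import Data.Empty using (⊥; ⊥-elim)
open import Data.Nat
  using (ℕ; zero; suc; _+_; _*_; _∸_; _≤_; _<_; z≤n; s≤s; z<s; _≡ᵇ_; _<ᵇ_; NonZero; _≟_; _<?_; _≤?_)
import Data.Nat.Properties as ℕ
open import Data.Nat.DivMod using (_/_; _%_)
import Data.Nat.DivMod as ℕ
import Data.Nat.Divisibility as ℕ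
open import Data.Fin using (Fin; toℕ; fromℕ<) renaming (zero to fzero; suc to fsuc)
import Data.Fin.Properties as Fin
open import Data.Integer using (ℤ; 0ℤ; 1ℤ; -1ℤ)
import Data.Integer as ℤ
import Data.Integer.Properties as ℤ
import Data.Integer.Divisibility.Signed as Signed
import Data.Integer.Solver as ℤSolver
import Data.Nat.Solver as ℕSolver
open import Data.Nat.Induction using (<-rec)
open import Relation.Binary.Definitions using (tri<; tri≈; tri>)
open import Data.Rational using (ℚ; 0ℚ; 1ℚ; ½) renaming (_+_ to _+ℚ_; _*_ to _*ℚ_; _-_ to _-ℚ_; -_ to ⊖_)
import Data.Rational as ℚ
import Data.Rational.Properties as ℚ
import Data.Rational.Unnormalised as ℚᵘ
import Data.Rational.Unnormalised.Properties as ℚᵘ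
open import Data.Rational.Solver using (module +-*-Solver)
open import Data.List using (List; []; _∷_; length; _++_; replicate)
import Data.List.Properties as List
open import Data.List.Relation.Unary.All using (All; []; _∷_)
open import Data.Product using (Σ; _×_; _,_; proj₁; proj₂)
open import Data.Sum using (_⊎_; inj₁; inj₂)
open import Function using (_∘_; case_of_)
open import Function.Construct.Composition using (_↔-∘_)
open import Function.Bundles using (_⇔_; _↔_; mk⇔; mk↔ₛ′; Inverse; Equivalence)
open import Relation.Nullary using (¬_; yes; no; does; contradiction; Dec)
open import Relation.Nullary.Decidable using (dec-true; dec-false)
open import Relation.Binary.PropositionalEquality
  using (_≡_; _≢_; refl; sym; trans; cong; cong₂; subst; subst₂; module ≡-Reasoning)
open import Algebra.Properties.CommutativeMonoid.Sum ℚ.+-0-commutativeMonoid using (sum; sum-permute)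
import Algebra.Properties.CommutativeMonoid.Sum ℕ.+-0-commutativeMonoid as Sumℕ

-- The walk on a graph

-- The recurrence for X has order A + B, and the impulse makes all but the last of the initial A + B
-- values vanish. Hence dividing by an integer, which keeps zeros and recurrence, stays within one
-- class of sequences, and X is nonzero at index A + B - 1. The exceptional values are those at
-- which the congruence yields no divisor ≥ 2. For A = B it is void if s = 1, so a star seen from a
-- leaf may have any number of legs. For s = -1 it reads m | 2X: an odd m loses the 2, an even m is
-- halved, and only m = 2 survives. With a level of three children below, every signal is a
-- combination of the one returning from the leaves; odd d fails modulo 2, and for even d and A = B
-- the congruence is m | X(A+t) + X(2A+t) if s = -1, which is fatal, and m | 3(X(A+t) - X(2A+t)) if
-- s = 1, from which only m = 3, d = 2 escapes. The number 12 comes from three leaves under one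
-- vertex: without a drive their total satisfies T(t+4) - T(t+2) + T(t) = 0, whose characteristic
-- polynomial is the twelfth cyclotomic one. The same line states that exclude other trees also show
-- that the periods are minimal.

iter : ∀ {A : Set} → ℕ → (A → A) → A → A
iter zero    f x = x
iter (suc k) f x = f (iter k f x)

module RS = +-*-Solver
module NS = ℕSolver.+-*-Solver

Σℚ-cong : ∀ n {f g : Fin n → ℚ} → (∀ i → f i ≡ g i) → Σℚ n f ≡ Σℚ n g
Σℚ-cong zero    h = refl
Σℚ-cong (suc n) h = cong₂ _+ℚ_ (h fzero) (Σℚ-cong n (h ∘ fsuc))

Σℚ-zero : ∀ n → Σℚ n (λ _ → 0ℚ) ≡ 0ℚ
Σℚ-zero zero    = refl
Σℚ-zero (suc n) = trans (ℚ.+-identityˡ _) (Σℚ-zero n)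

Σℚ-+ : ∀ n (f g : Fin n → ℚ) → Σℚ n (λ i → f i +ℚ g i) ≡ Σℚ n f +ℚ Σℚ n g
Σℚ-+ zero    f g = refl
Σℚ-+ (suc n) f g = trans (cong (f fzero +ℚ g fzero +ℚ_) (Σℚ-+ n (f ∘ fsuc) (g ∘ fsuc)))
  (solve 4 (λ a b c d → (a :+ b) :+ (c :+ d) := (a :+ c) :+ (b :+ d)) refl
    (f fzero) (g fzero) (Σℚ n (f ∘ fsuc)) (Σℚ n (g ∘ fsuc)))
  where open RS

Σℚ-* : ∀ n c (f : Fin n → ℚ) → Σℚ n (λ i → c *ℚ f i) ≡ c *ℚ Σℚ n f
Σℚ-* zero    c f = sym (ℚ.*-zeroʳ c)
Σℚ-* (suc n) c f = trans (cong (c *ℚ f fzero +ℚ_) (Σℚ-* n c (f ∘ fsuc)))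
                                (sym (ℚ.*-distribˡ-+ c (f fzero) (Σℚ n (f ∘ fsuc))))

Σℚ-single : ∀ n (a : Fin n) (f : Fin n → ℚ) → (∀ v → v ≢ a → f v ≡ 0ℚ) → Σℚ n f ≡ f a
Σℚ-single (suc n) fzero f h =
  trans (cong (f fzero +ℚ_) (trans (Σℚ-cong n (λ i → h (fsuc i) λ ())) (Σℚ-zero n)))
        (ℚ.+-identityʳ _)
Σℚ-single (suc n) (fsuc a) f h =
  trans (cong (_+ℚ Σℚ n (f ∘ fsuc)) (h fzero λ ()))
        (trans (ℚ.+-identityˡ _)
               (Σℚ-single n a (f ∘ fsuc) λ v v≢a → h (fsuc v) (v≢a ∘ Fin.suc-injective)))

Σℚ≡sum : ∀ n (f : Fin n → ℚ) → Σℚ n f ≡ sum f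
Σℚ≡sum zero    f = refl
Σℚ≡sum (suc n) f = cong (f fzero +ℚ_) (Σℚ≡sum n (f ∘ fsuc))

Σℚ-comm : ∀ m n (f : Fin m → Fin n → ℚ) →
          Σℚ m (λ i → Σℚ n (f i)) ≡ Σℚ n (λ j → Σℚ m (λ i → f i j))
Σℚ-comm zero    n f = sym (Σℚ-zero n)
Σℚ-comm (suc m) n f =
  trans (cong (Σℚ n (f fzero) +ℚ_) (Σℚ-comm m n (f ∘ fsuc))) (sym (Σℚ-+ n _ _))

Σℚ-permute : ∀ {m n} (σ : Fin m ↔ Fin n) (f : Fin n → ℚ) →
             Σℚ m (f ∘ Inverse.to σ) ≡ Σℚ n f
Σℚ-permute {m} {n} σ f =
  trans (Σℚ≡sum m _) (trans (sym (sum-permute f σ)) (sym (Σℚ≡sum n f)))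

count≡sum : ∀ n p → count n p ≡ Sumℕ.sum (λ i → if p i then 1 else 0)
count≡sum zero    p = refl
count≡sum (suc n) p = cong ((if p fzero then 1 else 0) +_) (count≡sum n (p ∘ fsuc))

count-cong : ∀ n {p q : Fin n → Bool} → (∀ i → p i ≡ q i) → count n p ≡ count n q
count-cong zero    h = refl
count-cong (suc n) h =
  cong₂ _+_ (cong (λ b → if b then 1 else 0) (h fzero)) (count-cong n (h ∘ fsuc))

count-permute : ∀ {m n} (σ : Fin m ↔ Fin n) p → count m (p ∘ Inverse.to σ) ≡ count n p
count-permute {m} {n} σ p =
  trans (count≡sum m _) (trans (sym (Sumℕ.sum-permute (λ i → if p i then 1 else 0) σ)) (sym (count≡sum n p)))

-- `twoOver` lives in a module over a graph; this copy depends on the degree alone and so can be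
-- transported along an isomorphism.
2/ : ℕ → ℚ
2/ zero    = 0ℚ
2/ (suc n) = (ℤ.+ 2) ℚ./ suc n

module _ (G : Graph) where
  private
    N = size G

  twoOver≡2/ : ∀ n → twoOver G n ≡ 2/ n
  twoOver≡2/ zero    = refl
  twoOver≡2/ (suc n) = refl

  State : Set
  State = Fin N × Fin N → ℚ

  inflow : State → Fin N → ℚ
  inflow ψ a = Σℚ N λ c → if adj G c a then ψ (c , a) else 0ℚ

  -- Row (a , b) of U has 2/deg a at each arc ending in a and an additional -1 at the reversed arc,
  -- so U acts on a state by this local rule. Powers of U are studied as iterates of it.
  step : State → State
  step ψ (a , b) = 2/ (deg G a) *ℚ inflow ψ a -ℚ ψ (b , a)

  -- Values at pairs that are not arcs are arbitrary, so states are compared on arcs.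
  _≐_ : State → State → Set
  ψ ≐ φ = ∀ a b → Arc G (a , b) → ψ (a , b) ≡ φ (a , b)

  ≐-trans : ∀ {ψ φ χ} → ψ ≐ φ → φ ≐ χ → ψ ≐ χ
  ≐-trans p q a b h = trans (p a b h) (q a b h)

  ≐-sym : ∀ {ψ φ} → ψ ≐ φ → φ ≐ ψ
  ≐-sym p a b h = sym (p a b h)

  flip-arc : ∀ {a b} → Arc G (a , b) → Arc G (b , a)
  flip-arc {a} {b} h = trans (Graph.sym G b a) h

  inflow-cong : ∀ {ψ φ} → ψ ≐ φ → ∀ a → inflow ψ a ≡ inflow φ a
  inflow-cong {ψ} {φ} h a = Σℚ-cong N pt
    where
    pt : ∀ c → (if adj G c a then ψ (c , a) else 0ℚ) ≡ (if adj G c a then φ (c , a) else 0ℚ)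
    pt c with adj G c a in eq
    ... | true  = h c a eq
    ... | false = refl

  step-cong : ∀ {ψ φ} → ψ ≐ φ → step ψ ≐ step φ
  step-cong h a b ab =
    cong₂ (λ x y → 2/ (deg G a) *ℚ x -ℚ y) (inflow-cong h a) (h b a (flip-arc ab))

  iter-cong : ∀ k {ψ φ} → ψ ≐ φ → iter k step ψ ≐ iter k step φ
  iter-cong zero    h = h
  iter-cong (suc k) h = step-cong (iter-cong k h)

  Grover-step : ∀ (M : Mat G) f → (λ e → _·_ G (Grover G) M e f) ≐ step (λ e → M e f)
  Grover-step M f a b ab = begin
    Σℚ N (λ u → Σℚ N λ v → if adj G u v then Grover G (a , b) (u , v) *ℚ M (u , v) f else 0ℚ)
      ≡⟨ Σℚ-cong N (λ u → Σℚ-single N a _ (off-diagonal u)) ⟩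
    Σℚ N (λ u → if adj G u a then Grover G (a , b) (u , a) *ℚ M (u , a) f else 0ℚ)
      ≡⟨ Σℚ-cong N diagonal ⟩
    Σℚ N (λ u → κ *ℚ (if adj G u a then M (u , a) f else 0ℚ)
                +ℚ ⊖ 1ℚ *ℚ (if does (b Fin.≟ u) then M (u , a) f else 0ℚ))
      ≡⟨ Σℚ-+ N _ _ ⟩
    Σℚ N (λ u → κ *ℚ (if adj G u a then M (u , a) f else 0ℚ))
      +ℚ Σℚ N (λ u → ⊖ 1ℚ *ℚ (if does (b Fin.≟ u) then M (u , a) f else 0ℚ))
      ≡⟨ cong₂ _+ℚ_ (Σℚ-* N κ _) (trans (Σℚ-* N (⊖ 1ℚ) _) (cong (⊖ 1ℚ *ℚ_) back)) ⟩
    κ *ℚ inflow (λ e → M e f) a +ℚ ⊖ 1ℚ *ℚ M (b , a) f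
      ≡⟨ solve 3 (λ x y z → x :* y :+ (:- con 1ℚ) :* z := x :* y :- z) refl
          κ (inflow (λ e → M e f) a) (M (b , a) f) ⟩
    step (λ e → M e f) (a , b) ∎
    where
    open ≡-Reasoning
    open RS
    κ = 2/ (deg G a)
    off-diagonal : ∀ u v → v ≢ a →
      (if adj G u v then Grover G (a , b) (u , v) *ℚ M (u , v) f else 0ℚ) ≡ 0ℚ
    off-diagonal u v v≢a rewrite dec-false (v Fin.≟ a) v≢a with adj G u v
    ... | true  = ℚ.*-zeroˡ (M (u , v) f)
    ... | false = refl
    diagonal : ∀ u →
      (if adj G u a then Grover G (a , b) (u , a) *ℚ M (u , a) f else 0ℚ) ≡
      κ *ℚ (if adj G u a then M (u , a) f else 0ℚ)
        +ℚ ⊖ 1ℚ *ℚ (if does (b Fin.≟ u) then M (u , a) f else 0ℚ)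
    diagonal u rewrite dec-true (a Fin.≟ a) refl | twoOver≡2/ (deg G a) with b Fin.≟ u
    ... | yes refl rewrite flip-arc ab =
      solve 2 (λ x y → (x :- con 1ℚ) :* y := x :* y :+ (:- con 1ℚ) :* y) refl κ (M (b , a) f)
    ... | no _ with adj G u a
    ...   | true  = solve 2 (λ x y → x :* y := x :* y :+ (:- con 1ℚ) :* con 0ℚ) refl κ (M (u , a) f)
    ...   | false = solve 1 (λ x → con 0ℚ := x :* con 0ℚ :+ (:- con 1ℚ) :* con 0ℚ) refl κ
    back : Σℚ N (λ u → if does (b Fin.≟ u) then M (u , a) f else 0ℚ) ≡ M (b , a) f
    back = trans (Σℚ-single N b _ elsewhere)
      (cong (λ x → if x then M (b , a) f else 0ℚ) (dec-true (b Fin.≟ b) refl))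
      where
      elsewhere : ∀ u → u ≢ b → (if does (b Fin.≟ u) then M (u , a) f else 0ℚ) ≡ 0ℚ
      elsewhere u u≢b rewrite dec-false (b Fin.≟ u) (u≢b ∘ sym) = refl

  Upow-iter : ∀ k f → (λ e → Upow G k e f) ≐ iter k step (λ e → idM G e f)
  Upow-iter zero    f a b ab = refl
  Upow-iter (suc k) f = ≐-trans (Grover-step (Upow G k) f) (step-cong (Upow-iter k f))

  combine : (Fin N → Fin N → ℚ) → (Fin N → Fin N → State) → State
  combine w φ e = Σℚ N λ c → Σℚ N λ d → w c d *ℚ φ c d e

  step-combine : ∀ w φ e → step (combine w φ) e ≡ combine w (λ c d → step (φ c d)) e
  step-combine w φ (a , b) = begin
    κ *ℚ inflow (combine w φ) a -ℚ combine w φ (b , a)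
      ≡⟨ cong (λ x → κ *ℚ x -ℚ combine w φ (b , a)) flow ⟩
    κ *ℚ Σℚ N (λ c → Σℚ N (λ d → w c d *ℚ inflow (φ c d) a)) -ℚ combine w φ (b , a)
      ≡⟨ solve 3 (λ x y z → x :* y :- z := x :* y :+ (:- con 1ℚ) :* z) refl κ
           (Σℚ N (λ c → Σℚ N (λ d → w c d *ℚ inflow (φ c d) a))) (combine w φ (b , a)) ⟩
    κ *ℚ Σℚ N (λ c → Σℚ N (λ d → w c d *ℚ inflow (φ c d) a)) +ℚ (⊖ 1ℚ) *ℚ combine w φ (b , a)
      ≡⟨ cong₂ _+ℚ_ (sym (Σℚ-* N κ _)) (sym (Σℚ-* N (⊖ 1ℚ) _)) ⟩
    Σℚ N (λ c → κ *ℚ Σℚ N (λ d → w c d *ℚ inflow (φ c d) a))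
      +ℚ Σℚ N (λ c → (⊖ 1ℚ) *ℚ Σℚ N (λ d → w c d *ℚ φ c d (b , a)))
      ≡⟨ sym (Σℚ-+ N _ _) ⟩
    Σℚ N (λ c → κ *ℚ Σℚ N (λ d → w c d *ℚ inflow (φ c d) a)
      +ℚ (⊖ 1ℚ) *ℚ Σℚ N (λ d → w c d *ℚ φ c d (b , a)))
      ≡⟨ Σℚ-cong N (λ c → trans (cong₂ _+ℚ_ (sym (Σℚ-* N κ _)) (sym (Σℚ-* N (⊖ 1ℚ) _)))
           (trans (sym (Σℚ-+ N _ _)) (Σℚ-cong N λ d →
             solve 4 (λ x y z t → x :* (y :* z) :+ (:- con 1ℚ) :* (y :* t) := y :* (x :* z :- t))
               refl κ (w c d) (inflow (φ c d) a) (φ c d (b , a))))) ⟩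
    combine w (λ c d → step (φ c d)) (a , b) ∎
    where
    open ≡-Reasoning
    open RS
    κ = 2/ (deg G a)
    flow : inflow (combine w φ) a ≡ Σℚ N (λ c → Σℚ N (λ d → w c d *ℚ inflow (φ c d) a))
    flow = begin
      Σℚ N (λ u → if adj G u a then combine w φ (u , a) else 0ℚ)
        ≡⟨ Σℚ-cong N pull ⟩
      Σℚ N (λ u → Σℚ N λ c → Σℚ N λ d → w c d *ℚ (if adj G u a then φ c d (u , a) else 0ℚ))
        ≡⟨ Σℚ-comm N N _ ⟩
      Σℚ N (λ c → Σℚ N λ u → Σℚ N λ d → w c d *ℚ (if adj G u a then φ c d (u , a) else 0ℚ))
        ≡⟨ Σℚ-cong N (λ c → trans (Σℚ-comm N N _) (Σℚ-cong N λ d → Σℚ-* N (w c d) _)) ⟩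
      Σℚ N (λ c → Σℚ N (λ d → w c d *ℚ inflow (φ c d) a)) ∎
      where
      pull : ∀ u → (if adj G u a then combine w φ (u , a) else 0ℚ) ≡
        Σℚ N (λ c → Σℚ N λ d → w c d *ℚ (if adj G u a then φ c d (u , a) else 0ℚ))
      pull u with adj G u a
      ... | true  = refl
      ... | false = sym (trans (Σℚ-cong N (λ c → trans (Σℚ-cong N λ d → ℚ.*-zeroʳ (w c d)) (Σℚ-zero N)))
        (Σℚ-zero N))

  iter-combine : ∀ k w φ → iter k step (combine w φ) ≐ combine w (λ c d → iter k step (φ c d))
  iter-combine zero    w φ a b ab = refl
  iter-combine (suc k) w φ a b ab =
    trans (step-cong (iter-combine k w φ) a b ab) (step-combine w (λ c d → iter k step (φ c d)) (a , b))

  -- Allowing any family that agrees with the unit states on arcs lets the same decomposition serve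
  -- before and after k steps: for the unit states themselves and for their images under the k-th
  -- power. Linearity then carries the identity from unit states to all states.
  decompose : ∀ (ψ : State) (φ : Fin N → Fin N → State) →
    (∀ c d → Arc G (c , d) → φ c d ≐ λ e → idM G e (c , d)) →
    ψ ≐ combine (λ c d → if adj G c d then ψ (c , d) else 0ℚ) φ
  decompose ψ φ h a b ab = sym (trans (Σℚ-cong N inner) (trans (Σℚ-single N a _ outer) final))
    where
    w : Fin N → Fin N → ℚ
    w c d = if adj G c d then ψ (c , d) else 0ℚ
    term : Fin N → Fin N → ℚ
    term c d = w c d *ℚ idM G (a , b) (c , d)
    term≡ : ∀ c d → w c d *ℚ φ c d (a , b) ≡ term c d
    term≡ c d with adj G c d in eq
    ... | true  = cong (ψ (c , d) *ℚ_) (h c d eq a b ab)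
    ... | false = trans (ℚ.*-zeroˡ (φ c d (a , b))) (sym (ℚ.*-zeroˡ (idM G (a , b) (c , d))))
    b-off : ∀ c d → d ≢ b → term c d ≡ 0ℚ
    b-off c d d≢b rewrite dec-false (b Fin.≟ d) (d≢b ∘ sym) with does (a Fin.≟ c)
    ... | true  = ℚ.*-zeroʳ (w c d)
    ... | false = ℚ.*-zeroʳ (w c d)
    inner : ∀ c → Σℚ N (λ d → w c d *ℚ φ c d (a , b)) ≡ term c b
    inner c = trans (Σℚ-cong N (term≡ c)) (Σℚ-single N b (term c) (b-off c))
    outer : ∀ c → c ≢ a → term c b ≡ 0ℚ
    outer c c≢a rewrite dec-false (a Fin.≟ c) (c≢a ∘ sym) = ℚ.*-zeroʳ (w c b)
    final : term a b ≡ ψ (a , b)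
    final rewrite ab | dec-true (a Fin.≟ a) refl | dec-true (b Fin.≟ b) refl = ℚ.*-identityʳ (ψ (a , b))

  PeriodicAt : ℕ → Set
  PeriodicAt k = ∀ ψ → iter k step ψ ≐ ψ

  UpowIsId⇒ : ∀ k → UpowIsId G k → PeriodicAt k
  UpowIsId⇒ k h ψ =
    ≐-trans (iter-cong k start) (≐-trans (iter-combine k w δ) (≐-sym (decompose ψ _ evolved)))
    where
    w : Fin N → Fin N → ℚ
    w c d = if adj G c d then ψ (c , d) else 0ℚ
    δ : Fin N → Fin N → State
    δ c d e = idM G e (c , d)
    start : ψ ≐ combine w δ
    start = decompose ψ δ λ c d _ a b _ → refl
    evolved : ∀ c d → Arc G (c , d) → iter k step (δ c d) ≐ δ c d
    evolved c d cd a b ab = trans (sym (Upow-iter k (c , d) a b ab)) (h (a , b) (c , d) ab cd)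

  UpowIsId⇐ : ∀ k → (∀ c d → iter k step (λ e → idM G e (c , d)) ≐ (λ e → idM G e (c , d))) → UpowIsId G k
  UpowIsId⇐ k h (a , b) (c , d) ab cd = trans (Upow-iter k (c , d) a b ab) (h c d a b ab)

≅-sym : ∀ {G H} → G ≅ H → H ≅ G
≅-sym {G} {H} (σ , h) =
  mk↔ₛ′ (Inverse.from σ) (Inverse.to σ) (Inverse.strictlyInverseʳ σ) (Inverse.strictlyInverseˡ σ) ,
  λ u v → sym (trans (h _ _) (cong₂ (adj H) (Inverse.strictlyInverseˡ σ u) (Inverse.strictlyInverseˡ σ v)))

module _ {G H : Graph} (i : G ≅ H) where
  private
    σ     = proj₁ i
    σ-adj = proj₂ i
    s     = Inverse.to σ

  pullback : State H → State G
  pullback ψ (a , b) = ψ (s a , s b)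

  deg-≅ : ∀ a → deg G a ≡ deg H (s a)
  deg-≅ a = trans (count-cong (size G) (σ-adj a)) (count-permute σ (adj H (s a)))

  step-≅ : ∀ ψ e → step G (pullback ψ) e ≡ pullback (step H ψ) e
  step-≅ ψ (a , b) = cong₂ (λ x y → x *ℚ y -ℚ ψ (s b , s a)) (cong 2/ (deg-≅ a))
    (trans (Σℚ-cong (size G) (λ c → cong (λ t → if t then ψ (s c , s a) else 0ℚ) (σ-adj c a)))
           (Σℚ-permute σ (λ c → if adj H c (s a) then ψ (c , s a) else 0ℚ)))

  iter-≅ : ∀ k ψ → _≐_ G (iter k (step G) (pullback ψ)) (pullback (iter k (step H) ψ))
  iter-≅ zero    ψ a b ab = refl
  iter-≅ (suc k) ψ a b ab = trans (step-cong G (iter-≅ k ψ) a b ab) (step-≅ (iter k (step H) ψ) (a , b))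

  UpowIsId-≅ : ∀ k → UpowIsId G k → UpowIsId H k
  UpowIsId-≅ k h = UpowIsId⇐ H k λ c d a b ab →
    subst (λ e → iter k (step H) (ψ c d) e ≡ ψ c d e)
      (cong₂ _,_ (Inverse.strictlyInverseˡ σ a) (Inverse.strictlyInverseˡ σ b))
      (trans (sym (iter-≅ k (ψ c d) (r a) (r b) (arc a b ab)))
             (UpowIsId⇒ G k h (pullback (ψ c d)) (r a) (r b) (arc a b ab)))
    where
    r = Inverse.from σ
    ψ : Fin (size H) → Fin (size H) → State H
    ψ c d e = idM H e (c , d)
    arc : ∀ a b → Arc H (a , b) → Arc G (r a , r b)
    arc a b ab = trans (σ-adj _ _)
      (trans (cong₂ (adj H) (Inverse.strictlyInverseˡ σ a) (Inverse.strictlyInverseˡ σ b)) ab)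

Periodic-≅ : ∀ {G H} → G ≅ H → Periodic H → Periodic G
Periodic-≅ {G} {H} i (k , 1≤k , h) = k , 1≤k , UpowIsId-≅ {H} {G} (≅-sym {G} {H} i) k h

HasPeriod-≅ : ∀ {G H} p → G ≅ H → HasPeriod G p → HasPeriod H p
HasPeriod-≅ {G} {H} p i (1≤p , h , l) =
  1≤p , UpowIsId-≅ {G} {H} i p h ,
  λ j 1≤j j<p u → l j 1≤j j<p (UpowIsId-≅ {H} {G} (≅-sym {G} {H} i) j u)

-- Vertices of a generalized Bethe tree, level by level

-- Stated for any commutative monoid because the same sums over neighbours give the inflow of a
-- vertex (in ℚ) and its degree (in ℕ).
module RangeSum {A : Set} (_⊕_ : A → A → A) (ε : A)
  (⊕-assoc : ∀ a b c → (a ⊕ b) ⊕ c ≡ a ⊕ (b ⊕ c))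
  (⊕-comm : ∀ a b → a ⊕ b ≡ b ⊕ a)
  (⊕-identityˡ : ∀ a → ε ⊕ a ≡ a) where

  ∑ : ℕ → (ℕ → A) → A
  ∑ zero    f = ε
  ∑ (suc n) f = f 0 ⊕ ∑ n (f ∘ suc)

  ⊕-identityʳ : ∀ a → a ⊕ ε ≡ a
  ⊕-identityʳ a = trans (⊕-comm a ε) (⊕-identityˡ a)

  ⊕-interchange : ∀ a b c d → (a ⊕ b) ⊕ (c ⊕ d) ≡ (a ⊕ c) ⊕ (b ⊕ d)
  ⊕-interchange a b c d = begin
    (a ⊕ b) ⊕ (c ⊕ d) ≡⟨ ⊕-assoc a b (c ⊕ d) ⟩
    a ⊕ (b ⊕ (c ⊕ d)) ≡⟨ cong (a ⊕_) (sym (⊕-assoc b c d)) ⟩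
    a ⊕ ((b ⊕ c) ⊕ d) ≡⟨ cong (λ z → a ⊕ (z ⊕ d)) (⊕-comm b c) ⟩
    a ⊕ ((c ⊕ b) ⊕ d) ≡⟨ cong (a ⊕_) (⊕-assoc c b d) ⟩
    a ⊕ (c ⊕ (b ⊕ d)) ≡⟨ sym (⊕-assoc a c (b ⊕ d)) ⟩
    (a ⊕ c) ⊕ (b ⊕ d) ∎
    where open ≡-Reasoning

  ∑-cong : ∀ n {f g} → (∀ i → i < n → f i ≡ g i) → ∑ n f ≡ ∑ n g
  ∑-cong zero    h = refl
  ∑-cong (suc n) h = cong₂ _⊕_ (h 0 z<s) (∑-cong n λ i i<n → h (suc i) (s≤s i<n))

  ∑-ε : ∀ n {f} → (∀ i → i < n → f i ≡ ε) → ∑ n f ≡ ε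
  ∑-ε zero    h = refl
  ∑-ε (suc n) h = trans (cong₂ _⊕_ (h 0 z<s) (∑-ε n λ i i<n → h (suc i) (s≤s i<n))) (⊕-identityˡ ε)

  ∑-⊕ : ∀ n f g → ∑ n (λ i → f i ⊕ g i) ≡ ∑ n f ⊕ ∑ n g
  ∑-⊕ zero    f g = sym (⊕-identityˡ ε)
  ∑-⊕ (suc n) f g = trans (cong ((f 0 ⊕ g 0) ⊕_) (∑-⊕ n (f ∘ suc) (g ∘ suc)))
                          (⊕-interchange (f 0) (g 0) (∑ n (f ∘ suc)) (∑ n (g ∘ suc)))

  ∑-split : ∀ m n f → ∑ (m + n) f ≡ ∑ m f ⊕ ∑ n (λ i → f (m + i))
  ∑-split zero    n f = sym (⊕-identityˡ (∑ n f))
  ∑-split (suc m) n f = trans (cong (f 0 ⊕_) (∑-split m n (f ∘ suc)))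
                              (sym (⊕-assoc (f 0) (∑ m (f ∘ suc)) (∑ n (λ i → f (suc m + i)))))

  ∑-single : ∀ n a f → a < n → (∀ i → i < n → i ≢ a → f i ≡ ε) → ∑ n f ≡ f a
  ∑-single (suc n) zero    f a<n h =
    trans (cong (f 0 ⊕_) (∑-ε n λ i i<n → h (suc i) (s≤s i<n) λ ())) (⊕-identityʳ (f 0))
  ∑-single (suc n) (suc a) f (s≤s a<n) h =
    trans (cong (_⊕ ∑ n (f ∘ suc)) (h 0 z<s λ ()))
      (trans (⊕-identityˡ (∑ n (f ∘ suc)))
        (∑-single n a (f ∘ suc) a<n λ i i<n i≢a → h (suc i) (s≤s i<n) (i≢a ∘ ℕ.suc-injective)))

  -- The children of a level form consecutive blocks of d indices, one block for each parent; this
  -- extracts the block of the parent x.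
  ∑-block : ∀ l d x f → x < l →
    (∀ y j → y < l → j < d → y ≢ x → f (y * d + j) ≡ ε) → ∑ (l * d) f ≡ ∑ d (λ j → f (x * d + j))
  ∑-block (suc l) d zero f x<l h =
    trans (∑-split d (l * d) f)
      (trans (cong (∑ d f ⊕_) (outside l (λ i → f (d + i))
               λ y j y<l j<d → trans (cong f (sym (ℕ.+-assoc d (y * d) j))) (h (suc y) j (s≤s y<l) j<d λ ())))
        (⊕-identityʳ (∑ d f)))
    where
    outside : ∀ l f → (∀ y j → y < l → j < d → f (y * d + j) ≡ ε) → ∑ (l * d) f ≡ ε
    outside zero    f h = refl
    outside (suc l) f h =
      trans (∑-split d (l * d) f)
        (trans (cong₂ _⊕_ (∑-ε d λ j j<d → h 0 j z<s j<d)
                 (outside l (λ i → f (d + i)) λ y j y<l j<d →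
                   trans (cong f (sym (ℕ.+-assoc d (y * d) j))) (h (suc y) j (s≤s y<l) j<d)))
          (⊕-identityˡ ε))
  ∑-block (suc l) d (suc x) f (s≤s x<l) h =
    trans (∑-split d (l * d) f)
      (trans (cong₂ _⊕_ (∑-ε d λ j j<d → h 0 j z<s j<d λ ())
               (trans (∑-block l d x (λ i → f (d + i)) x<l λ y j y<l j<d y≢x →
                        trans (cong f (sym (ℕ.+-assoc d (y * d) j)))
                              (h (suc y) j (s≤s y<l) j<d (y≢x ∘ ℕ.suc-injective)))
                      (∑-cong d λ j _ → cong f (sym (ℕ.+-assoc d (x * d) j)))))
        (⊕-identityˡ _))

≡ᵇ-true : ∀ {m n} → m ≡ n → (m ≡ᵇ n) ≡ true
≡ᵇ-true {m} {n} eq = Equivalence.to T-≡ (ℕ.≡⇒≡ᵇ m n eq)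

≡ᵇ-false : ∀ {m n} → m ≢ n → (m ≡ᵇ n) ≡ false
≡ᵇ-false {m} {n} m≢n with m ≡ᵇ n in eq
... | true  = contradiction (ℕ.≡ᵇ⇒≡ m n (Equivalence.from T-≡ eq)) m≢n
... | false = refl

<ᵇ-true : ∀ {m n} → m < n → (m <ᵇ n) ≡ true
<ᵇ-true {m} {n} lt = Equivalence.to T-≡ (ℕ.<⇒<ᵇ lt)

<ᵇ-false : ∀ {m n} → n ≤ m → (m <ᵇ n) ≡ false
<ᵇ-false {m} {n} n≤m with m <ᵇ n in eq
... | true  = contradiction (ℕ.<ᵇ⇒< m n (Equivalence.from T-≡ eq)) (ℕ.≤⇒≯ n≤m)
... | false = refl

treeAdj-parent : ∀ p v → p v < v → treeAdj p (p v) v ≡ true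
treeAdj-parent p v lt rewrite <ᵇ-true lt | ≡ᵇ-true {p v} refl = refl

treeAdj-child : ∀ p v → p v < v → treeAdj p v (p v) ≡ true
treeAdj-child p v lt = trans (treeAdj-sym p v (p v)) (treeAdj-parent p v lt)

treeAdj⇒ : ∀ p a b → treeAdj p a b ≡ true → (a < b × a ≡ p b) ⊎ (b < a × b ≡ p a)
treeAdj⇒ p a b h with a <ᵇ b in lt | p b ≡ᵇ a in eq
... | true  | true  = inj₁ (ℕ.<ᵇ⇒< a b (Equivalence.from T-≡ lt) , sym
  (ℕ.≡ᵇ⇒≡ (p b) a (Equivalence.from T-≡ eq)))
treeAdj⇒ p a b h | true | false with b <ᵇ a in lt' | p a ≡ᵇ b in eq'
... | true | true = inj₂ (ℕ.<ᵇ⇒< b a (Equivalence.from T-≡ lt') , sym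
  (ℕ.≡ᵇ⇒≡ (p a) b (Equivalence.from T-≡ eq')))
treeAdj⇒ p a b h | false | _ with b <ᵇ a in lt' | p a ≡ᵇ b in eq'
... | true | true = inj₂ (ℕ.<ᵇ⇒< b a (Equivalence.from T-≡ lt') , sym
  (ℕ.≡ᵇ⇒≡ (p a) b (Equivalence.from T-≡ eq')))

nth : List ℕ → ℕ → ℕ
nth []       m       = 0
nth (d ∷ ds) zero    = d
nth (d ∷ ds) (suc m) = nth ds m

-- Unlike `betheSizeGo` this omits the current level: it counts the vertices that can be
-- descendants, over which the sums over children run.
rest : ℕ → List ℕ → ℕ
rest len []       = 0
rest len (d ∷ ds) = len * d + rest (len * d) ds

width : ℕ → List ℕ → ℕ → ℕ
width len ds       zero    = len
width len []       (suc m) = 0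
width len (d ∷ ds) (suc m) = width (len * d) ds m

-- The index of the vertex at offset x of the m-th level, when the levels of ds
-- are laid out from index `start` on and the top one has `len` vertices.
pos : ℕ → ℕ → List ℕ → ℕ → ℕ → ℕ
pos start len ds       zero    x = start + x
pos start len []       (suc m) x = 0
pos start len (d ∷ ds) (suc m) x = pos (start + len) (len * d) ds m x

betheSizeGo≡ : ∀ len ds → betheSizeGo len ds ≡ len + rest len ds
betheSizeGo≡ len []       = sym (ℕ.+-identityʳ len)
betheSizeGo≡ len (d ∷ ds) = cong (len +_) (betheSizeGo≡ (len * d) ds)

width-suc : ∀ len ds m → width len ds (suc m) ≡ width len ds m * nth ds m
width-suc len []       zero    = sym (ℕ.*-zeroʳ len)
width-suc len []       (suc m) = refl
width-suc len (d ∷ ds) zero    = refl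
width-suc len (d ∷ ds) (suc m) = width-suc (len * d) ds m

next-bound : ∀ {l x} d {j} → x < l → j < d → x * d + j < l * d
next-bound {l} {x} d {j} x<l j<d = begin-strict
  x * d + j <⟨ ℕ.+-monoʳ-< (x * d) j<d ⟩
  x * d + d ≡⟨ ℕ.+-comm (x * d) d ⟩
  suc x * d ≤⟨ ℕ.*-monoˡ-≤ d x<l ⟩
  l * d ∎
  where open ℕ.≤-Reasoning

divMod-unique : ∀ x d j .{{_ : NonZero d}} → j < d → (x * d + j) / d ≡ x × (x * d + j) % d ≡ j
divMod-unique x d j j<d = quotient , remainder
  where
  open ≡-Reasoning
  quotient : (x * d + j) / d ≡ x
  quotient = begin
    (x * d + j) / d   ≡⟨ ℕ.+-distrib-/-∣ˡ j (ℕ.n∣m*n x) ⟩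
    x * d / d + j / d ≡⟨ cong₂ _+_ (ℕ.m*n/n≡m x d) (ℕ.m<n⇒m/n≡0 j<d) ⟩
    x + 0             ≡⟨ ℕ.+-identityʳ x ⟩
    x                 ∎
  remainder : (x * d + j) % d ≡ j
  remainder = begin
    (x * d + j) % d ≡⟨ cong (_% d) (ℕ.+-comm (x * d) j) ⟩
    (j + x * d) % d ≡⟨ ℕ.[m+kn]%n≡m%n j x d ⟩
    j % d           ≡⟨ ℕ.m<n⇒m%n≡m j<d ⟩
    j               ∎

pos-≥ : ∀ start len ds m x → x < width len ds m → start ≤ pos start len ds m x
pos-≥ start len ds       zero    x x<w = ℕ.m≤m+n start x
pos-≥ start len (d ∷ ds) (suc m) x x<w =
  ℕ.≤-trans (ℕ.m≤m+n start len) (pos-≥ (start + len) (len * d) ds m x x<w)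

pos-< : ∀ start len ds m x → x < width len ds m → pos start len ds m x < start + len + rest len ds
pos-< start len ds zero x x<w = ℕ.≤-trans (ℕ.+-monoʳ-< start x<w) (ℕ.m≤m+n (start + len) (rest len ds))
pos-< start len (d ∷ ds) (suc m) x x<w =
  ℕ.≤-trans (pos-< (start + len) (len * d) ds m x x<w)
            (ℕ.≤-reflexive (ℕ.+-assoc (start + len) (len * d) (rest (len * d) ds)))

module _ (start len d : ℕ) (ds : List ℕ) where
  par-near : ∀ i → i < len * suc d → betheParGo start len (suc d ∷ ds) (start + len + i) ≡ start + i / suc d
  par-near i i<n rewrite <ᵇ-true (ℕ.+-monoʳ-< (start + len) i<n) | ℕ.m+n∸m≡n (start + len) i = refl

  par-far : ∀ v → start + len + len * suc d ≤ v →
    betheParGo start len (suc d ∷ ds) v ≡ betheParGo (start + len) (len * suc d) ds v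
  par-far v le rewrite <ᵇ-false le = refl

div-bound : ∀ i len d → i < len * suc d → i / suc d < len
div-bound i len d i<n = ℕ.m<n*o⇒m/o<n {i} {len} {suc d} i<n

-- The lower bound separates children from deeper descendants, whose parents lie beyond the current
-- level; the upper bound is what makes `treeAdj` recognise the link to the parent.
par-range : ∀ start len ds → All (1 ≤_) ds → ∀ v → start + len ≤ v → v < start + len + rest len ds →
            start ≤ betheParGo start len ds v × betheParGo start len ds v < v
par-range start len [] _ v lo hi =
  contradiction (ℕ.≤-trans hi (ℕ.≤-reflexive (ℕ.+-identityʳ (start + len)))) (ℕ.≤⇒≯ lo)
par-range start len (suc d ∷ ds) (_ ∷ pos) v lo hi with v <? start + len + len * suc d
... | yes near = subst (λ v → start ≤ betheParGo start len (suc d ∷ ds) v × betheParGo start len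
  (suc d ∷ ds) v < v)
    (ℕ.m+[n∸m]≡n lo)
    (subst (λ p → start ≤ p × p < start + len + (v ∸ (start + len))) (sym (par-near start len d ds i i<n))
      (ℕ.m≤m+n start (i / suc d) ,
       ℕ.≤-trans (ℕ.+-monoʳ-< start (div-bound i len d i<n)) (ℕ.m≤m+n (start + len) i)))
  where
  i = v ∸ (start + len)
  i<n : i < len * suc d
  i<n = ℕ.+-cancelˡ-< (start + len) i (len * suc d)
    (subst (_< start + len + len * suc d) (sym (ℕ.m+[n∸m]≡n lo)) near)
... | no far rewrite par-far start len d ds v (ℕ.≮⇒≥ far) =
  let (lo' , hi') = par-range (start + len) (len * suc d) ds pos v (ℕ.≮⇒≥ far)
                      (ℕ.≤-trans hi (ℕ.≤-reflexive (sym (ℕ.+-assoc (start + len) (len * suc d)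
                        (rest (len * suc d) ds)))))
  in ℕ.≤-trans (ℕ.m≤m+n start len) lo' , hi'

par-pos : ∀ start len ds → All (1 ≤_) ds → ∀ m x j → x < width len ds m → j < nth ds m →
  betheParGo start len ds (pos start len ds (suc m) (x * nth ds m + j)) ≡ pos start len ds m x
par-pos start len (suc d ∷ ds) _ zero x j x<w j<d =
  trans (par-near start len d ds (x * suc d + j) (next-bound (suc d) x<w j<d))
        (cong (start +_) (proj₁ (divMod-unique x (suc d) j j<d)))
par-pos start len (suc d ∷ ds) (_ ∷ ps) (suc m) x j x<w j<d =
  trans (par-far start len d ds _ (below ds x<w j<d))
        (par-pos (start + len) (len * suc d) ds ps m x j x<w j<d)
  where
  below : ∀ ds {m} → x < width (len * suc d) ds m → j < nth ds m →
          start + len + len * suc d ≤ pos (start + len) (len * suc d) ds (suc m) (x * nth ds m + j)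
  below (e ∷ es) {m} x<w j<d =
    pos-≥ (start + len + len * suc d) (len * suc d * e) es m _
      (subst (x * nth (e ∷ es) m + j <_) (sym (width-suc (len * suc d) (e ∷ es) m))
        (next-bound (nth (e ∷ es) m) x<w j<d))

locate : ∀ start len ds v → start ≤ v → v < start + len + rest len ds →
         Σ ℕ λ m → Σ ℕ λ x → x < width len ds m × v ≡ pos start len ds m x
locate start len ds v lo hi with v <? start + len
... | yes v<  = 0 , v ∸ start , ℕ.+-cancelˡ-< start (v ∸ start) len
  (subst (_< start + len) (sym (ℕ.m+[n∸m]≡n lo)) v<) ,
                sym (ℕ.m+[n∸m]≡n lo)
locate start len [] v lo hi | no v≮ =
  contradiction (ℕ.≤-trans hi (ℕ.≤-reflexive (ℕ.+-identityʳ (start + len)))) v≮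
locate start len (d ∷ ds) v lo hi | no v≮ =
  let (m , x , x<w , eq) = locate (start + len) (len * d) ds v (ℕ.≮⇒≥ v≮)
        (ℕ.≤-trans hi (ℕ.≤-reflexive (sym (ℕ.+-assoc (start + len) (len * d) (rest (len * d) ds)))))
  in suc m , x , x<w , eq

-- Inverse to `pos` on the vertices of the tree. It serves to prescribe a state by level and offset
-- and to define maps between differently numbered trees.
coords : ℕ → ℕ → List ℕ → ℕ → ℕ × ℕ
coords start len []       v = 0 , v ∸ start
coords start len (d ∷ ds) v =
  if v <ᵇ start + len then (0 , v ∸ start)
  else (let (m , x) = coords (start + len) (len * d) ds v in suc m , x)

coords-pos : ∀ start len ds m x → x < width len ds m → coords start len ds (pos start len ds m x) ≡ (m , x)
coords-pos start len []       zero    x x<w = cong (0 ,_) (ℕ.m+n∸m≡n start x)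
coords-pos start len (d ∷ ds) zero    x x<w
  rewrite <ᵇ-true (ℕ.+-monoʳ-< start x<w) | ℕ.m+n∸m≡n start x = refl
coords-pos start len (d ∷ ds) (suc m) x x<w
  rewrite <ᵇ-false (pos-≥ (start + len) (len * d) ds m x x<w)
        | coords-pos (start + len) (len * d) ds m x x<w = refl

module NeighbourSum {A : Set} (_⊕_ : A → A → A) (ε : A)
  (⊕-assoc : ∀ a b c → (a ⊕ b) ⊕ c ≡ a ⊕ (b ⊕ c))
  (⊕-comm : ∀ a b → a ⊕ b ≡ b ⊕ a)
  (⊕-identityˡ : ∀ a → ε ⊕ a ≡ a) where
  private module R = RangeSum _⊕_ ε ⊕-assoc ⊕-comm ⊕-identityˡ
  open R using (∑-cong; ∑-ε; ∑-⊕; ∑-split; ∑-single; ∑-block; ⊕-identityʳ)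

  -- Induction along the levels. If the vertex lies in the current level, its children are one block
  -- of the next level and all deeper vertices have parents beyond the current level. Otherwise the
  -- next level contributes nothing, since its parents come before the vertex, and the sum passes to
  -- the remaining list.
  children : ∀ start len ds → All (1 ≤_) ds → ∀ m x → x < width len ds m → (g : ℕ → A) →
    R.∑ (rest len ds) (λ i → if betheParGo start len ds (start + len + i) ≡ᵇ pos start len ds m x
                             then g (start + len + i) else ε)
    ≡ R.∑ (nth ds m) (λ j → g (pos start len ds (suc m) (x * nth ds m + j)))
  children start len [] _ m x x<w g = refl
  children start len (suc d ∷ ds) (_ ∷ ps) zero x x<w g = begin
    R.∑ (len * suc d + r) h
      ≡⟨ ∑-split (len * suc d) r h ⟩
    R.∑ (len * suc d) h ⊕ R.∑ r (λ i → h (len * suc d + i))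
      ≡⟨ cong₂ _⊕_ (∑-block len (suc d) x h x<w elsewhere) (∑-ε r deeper) ⟩
    R.∑ (suc d) (λ j → h (x * suc d + j)) ⊕ ε
      ≡⟨ ⊕-identityʳ _ ⟩
    R.∑ (suc d) (λ j → h (x * suc d + j))
      ≡⟨ ∑-cong (suc d) own ⟩
    R.∑ (suc d) (λ j → g (start + len + (x * suc d + j))) ∎
    where
    open ≡-Reasoning
    r = rest (len * suc d) ds
    h : ℕ → A
    h i = if betheParGo start len (suc d ∷ ds) (start + len + i) ≡ᵇ start + x then g (start + len + i) else ε
    near : ∀ y j → y < len → j < suc d →
      betheParGo start len (suc d ∷ ds) (start + len + (y * suc d + j)) ≡ start + y
    near y j y<l j<d = trans (par-near start len d ds (y * suc d + j) (next-bound (suc d) y<l j<d))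
                             (cong (start +_) (proj₁ (divMod-unique y (suc d) j j<d)))
    elsewhere : ∀ y j → y < len → j < suc d → y ≢ x → h (y * suc d + j) ≡ ε
    elsewhere y j y<l j<d y≢x
      rewrite near y j y<l j<d | ≡ᵇ-false {start + y} {start + x} (y≢x ∘ ℕ.+-cancelˡ-≡ start y x) = refl
    own : ∀ j → j < suc d → h (x * suc d + j) ≡ g (start + len + (x * suc d + j))
    own j j<d rewrite near x j x<w j<d | ≡ᵇ-true {start + x} refl = refl
    deeper : ∀ i → i < r → h (len * suc d + i) ≡ ε
    deeper i i<r = cong (λ b → if b then g (start + len + (len * suc d + i)) else ε)
      (≡ᵇ-false (ℕ.<⇒≢ (ℕ.<-≤-trans (ℕ.+-monoʳ-< start x<w) above) ∘ sym))
      where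
      v = start + len + (len * suc d + i)
      v≡ : start + len + len * suc d + i ≡ v
      v≡ = ℕ.+-assoc (start + len) (len * suc d) i
      lo : start + len + len * suc d ≤ v
      lo = subst (start + len + len * suc d ≤_) v≡ (ℕ.m≤m+n _ i)
      above : start + len ≤ betheParGo start len (suc d ∷ ds) v
      above = subst (start + len ≤_) (sym (par-far start len d ds v lo))
        (proj₁ (par-range (start + len) (len * suc d) ds ps v lo
          (subst (_< start + len + len * suc d + r) v≡ (ℕ.+-monoʳ-< (start + len + len * suc d) i<r))))
  children start len (suc d ∷ ds) (_ ∷ ps) (suc m) x x<w g = begin
    R.∑ (len * suc d + r) h
      ≡⟨ ∑-split (len * suc d) r h ⟩
    R.∑ (len * suc d) h ⊕ R.∑ r (λ i → h (len * suc d + i))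
      ≡⟨ cong₂ _⊕_ (∑-ε (len * suc d) shallow) (∑-cong r deeper) ⟩
    ε ⊕ R.∑ r (λ i → if betheParGo (start + len) (len * suc d) ds (start + len + len * suc d + i) ≡ᵇ q
                     then g (start + len + len * suc d + i) else ε)
      ≡⟨ ⊕-identityˡ _ ⟩
    R.∑ r (λ i → if betheParGo (start + len) (len * suc d) ds (start + len + len * suc d + i) ≡ᵇ q
                 then g (start + len + len * suc d + i) else ε)
      ≡⟨ children (start + len) (len * suc d) ds ps m x x<w g ⟩
    R.∑ (nth ds m) (λ j → g (pos (start + len) (len * suc d) ds (suc m) (x * nth ds m + j))) ∎
    where
    open ≡-Reasoning
    r = rest (len * suc d) ds
    q = pos (start + len) (len * suc d) ds m x
    h : ℕ → A
    h i = if betheParGo start len (suc d ∷ ds) (start + len + i) ≡ᵇ q then g (start + len + i) else ε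
    shallow : ∀ i → i < len * suc d → h i ≡ ε
    shallow i i<n rewrite par-near start len d ds i i<n
      | ≡ᵇ-false {start + i / suc d} {q} (ℕ.<⇒≢ (ℕ.<-≤-trans (ℕ.+-monoʳ-< start (div-bound i len d i<n))
                                            (pos-≥ (start + len) (len * suc d) ds m x x<w))) = refl
    deeper : ∀ i → i < r → h (len * suc d + i) ≡
      (if betheParGo (start + len) (len * suc d) ds (start + len + len * suc d + i) ≡ᵇ q
       then g (start + len + len * suc d + i) else ε)
    deeper i i<r rewrite sym (ℕ.+-assoc (start + len) (len * suc d) i)
      | par-far start len d ds (start + len + len * suc d + i) (ℕ.m≤m+n _ i) = refl

  module _ (ds : List ℕ) (ps : All (1 ≤_) ds) (g : ℕ → A) where
    private
      p = betheParGo 0 1 ds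
      N = betheSizeGo 1 ds

    adjacentTerm : ℕ → ℕ → A
    adjacentTerm a c = if treeAdj p c a then g c else ε

    private
      up down : ℕ → ℕ → A
      up a c = if (c <ᵇ a) ∧ (p a ≡ᵇ c) then g c else ε
      down a c = if (a <ᵇ c) ∧ (p c ≡ᵇ a) then g c else ε

      split-term : ∀ a c → adjacentTerm a c ≡ up a c ⊕ down a c
      split-term a c with c <ᵇ a in c<a
      ... | false = sym (⊕-identityˡ _)
      ... | true rewrite <ᵇ-false {a} {c} (ℕ.<⇒≤ (ℕ.<ᵇ⇒< c a (Equivalence.from T-≡ c<a))) with p a ≡ᵇ c
      ...   | true  = sym (⊕-identityʳ _)
      ...   | false = sym (⊕-identityʳ _)

      par-lt : ∀ i → i < rest 1 ds → p (1 + i) < 1 + i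
      par-lt i i<r = proj₂ (par-range 0 1 ds ps (1 + i) z<s (s≤s i<r))

      down-sum : ∀ m x → x < width 1 ds m → R.∑ N (down (pos 0 1 ds m x)) ≡
                 R.∑ (nth ds m) (λ j → g (pos 0 1 ds (suc m) (x * nth ds m + j)))
      down-sum m x x<w rewrite betheSizeGo≡ 1 ds =
        trans (⊕-identityˡ _) (trans (∑-cong (rest 1 ds) simplify) (children 0 1 ds ps m x x<w g))
        where
        a = pos 0 1 ds m x
        simplify : ∀ i → i < rest 1 ds → down a (suc i) ≡ (if p (suc i) ≡ᵇ a then g (suc i) else ε)
        simplify i i<r with p (suc i) ≡ᵇ a in eq
        ... | true rewrite sym (ℕ.≡ᵇ⇒≡ (p (suc i)) a (Equivalence.from T-≡ eq)) | <ᵇ-true (par-lt i i<r) = refl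
        ... | false with a <ᵇ suc i
        ...   | true  = refl
        ...   | false = refl

    neighbours-root : R.∑ N (adjacentTerm 0) ≡ R.∑ (nth ds 0) (λ j → g (pos 0 1 ds 1 j))
    neighbours-root = trans (∑-cong N λ c _ → trans (split-term 0 c) (⊕-identityˡ (down 0 c)))
                            (down-sum 0 0 z<s)

    neighbours : ∀ m x → x < width 1 ds (suc m) → let a = pos 0 1 ds (suc m) x in
      R.∑ N (adjacentTerm a) ≡
      R.∑ (nth ds (suc m)) (λ j → g (pos 0 1 ds (suc (suc m)) (x * nth ds (suc m) + j))) ⊕ g (p a)
    neighbours m x x<w = begin
      R.∑ N (adjacentTerm a)                    ≡⟨ ∑-cong N (λ c _ → split-term a c) ⟩
      R.∑ N (λ c → up a c ⊕ down a c)           ≡⟨ ∑-⊕ N (up a) (down a) ⟩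
      R.∑ N (up a) ⊕ R.∑ N (down a)             ≡⟨ ⊕-comm _ _ ⟩
      R.∑ N (down a) ⊕ R.∑ N (up a)             ≡⟨ cong₂ _⊕_ (down-sum (suc m) x x<w) up-sum ⟩
      R.∑ (nth ds (suc m)) (λ j → g (pos 0 1 ds (suc (suc m)) (x * nth ds (suc m) + j))) ⊕ g (p a) ∎
      where
      open ≡-Reasoning
      a = pos 0 1 ds (suc m) x
      a≥1 : ∀ ds → x < width 1 ds (suc m) → 1 ≤ pos 0 1 ds (suc m) x
      a≥1 (d ∷ ds) x<w = pos-≥ 1 (1 * d) ds m x x<w
      a<N : a < N
      a<N = subst (a <_) (sym (betheSizeGo≡ 1 ds)) (pos-< 0 1 ds (suc m) x x<w)
      pa<a : p a < a
      pa<a = proj₂ (par-range 0 1 ds ps a (a≥1 ds x<w) (pos-< 0 1 ds (suc m) x x<w))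
      up-sum : R.∑ N (up a) ≡ g (p a)
      up-sum = trans (∑-single N (p a) (up a) (ℕ.<-trans pa<a a<N) other) own
        where
        own : up a (p a) ≡ g (p a)
        own rewrite <ᵇ-true pa<a | ≡ᵇ-true {p a} refl = refl
        other : ∀ c → c < N → c ≢ p a → up a c ≡ ε
        other c _ c≢ rewrite ≡ᵇ-false {p a} {c} (c≢ ∘ sym) with c <ᵇ a
        ... | true  = refl
        ... | false = refl

open RangeSum _+ℚ_ 0ℚ ℚ.+-assoc ℚ.+-comm ℚ.+-identityˡ public
module ℕΣ = RangeSum _+_ 0 ℕ.+-assoc ℕ.+-comm ℕ.+-identityˡ

Σℚ-toℕ : ∀ n (f : ℕ → ℚ) → Σℚ n (f ∘ toℕ) ≡ ∑ n f
Σℚ-toℕ zero    f = refl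
Σℚ-toℕ (suc n) f = cong (f 0 +ℚ_) (Σℚ-toℕ n (f ∘ suc))

count-toℕ : ∀ n (p : ℕ → Bool) → count n (p ∘ toℕ) ≡ ℕΣ.∑ n (λ i → if p i then 1 else 0)
count-toℕ zero    p = refl
count-toℕ (suc n) p = cong ((if p 0 then 1 else 0) +_) (count-toℕ n (p ∘ suc))

∑ℕ-one : ∀ n → ℕΣ.∑ n (λ _ → 1) ≡ n
∑ℕ-one zero    = refl
∑ℕ-one (suc n) = cong suc (∑ℕ-one n)

-- Trajectories in level coordinates

W : (ℕ → ℕ) → ℕ → ℕ
W d zero    = 1
W d (suc m) = W d m * d m

-- States of the walk on a generalized Bethe tree with d m children at level m:
-- D m x and U m x are the amplitudes of the arcs joining the vertex of offset x
-- in level m (m ≥ 1) to its parent, directed down to that vertex and up from it.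
LevelState : Set
LevelState = ℕ → ℕ → ℚ

-- The part common to all waves leaving a vertex: each of them is this value minus the wave that
-- arrived along the same edge.
outflow : (ℕ → ℕ) → LevelState → LevelState → ℕ → ℕ → ℚ
outflow d D U zero    x = 2/ (d 0) *ℚ ∑ (d 0) (λ j → U 1 (x * d 0 + j))
outflow d D U (suc m) x =
  2/ (suc (d (suc m))) *ℚ (∑ (d (suc m)) (λ j → U (suc (suc m)) (x * d (suc m) + j)) +ℚ D (suc m) x)

-- A solution of the equations of the walk, detached from any graph: the samples of a walk on a
-- subdivided tree are again such a solution, for the original tree. The equations are demanded only
-- at offsets that exist.
record Traj (d : ℕ → ℕ) : Set where
  field
    D U    : ℕ → LevelState
    D-step : ∀ t m x j → x < W d m → j < d m →
             D (suc t) (suc m) (x * d m + j) ≡ outflow d (D t) (U t) m x -ℚ U t (suc m) (x * d m + j)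
    U-step : ∀ t m x → x < W d (suc m) →
             U (suc t) (suc m) x ≡ outflow d (D t) (U t) (suc m) x -ℚ D t (suc m) x

-- The walk on vertex numbers instead of elements of `Fin`, since parents and levels are computed on
-- natural numbers.
module _ (T : PTree) where
  private
    N = tsize T
    p = par T

  degN : ℕ → ℕ
  degN a = ℕΣ.∑ N (λ c → if treeAdj p a c then 1 else 0)

  inflowN : (ℕ → ℕ → ℚ) → ℕ → ℚ
  inflowN ψ a = ∑ N (λ c → if treeAdj p c a then ψ c a else 0ℚ)

  stepN : (ℕ → ℕ → ℚ) → ℕ → ℕ → ℚ
  stepN ψ a b = 2/ (degN a) *ℚ inflowN ψ a -ℚ ψ b a

  restrict : (ℕ → ℕ → ℚ) → State (graph T)
  restrict ψ (u , v) = ψ (toℕ u) (toℕ v)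

  step-restrict : ∀ ψ e → step (graph T) (restrict ψ) e ≡ restrict (stepN ψ) e
  step-restrict ψ (u , v) = cong₂ (λ x y → x *ℚ y -ℚ ψ (toℕ v) (toℕ u))
    (cong 2/ (count-toℕ N (treeAdj p (toℕ u))))
    (Σℚ-toℕ N (λ c → if treeAdj p c (toℕ u) then ψ c (toℕ u) else 0ℚ))

  iter-restrict : ∀ k ψ → _≐_ (graph T) (iter k (step (graph T)) (restrict ψ)) (restrict (iter k stepN ψ))
  iter-restrict zero    ψ a b ab = refl
  iter-restrict (suc k) ψ a b ab =
    trans (step-cong (graph T) (iter-restrict k ψ) a b ab) (step-restrict (iter k stepN ψ) (a , b))

  PeriodicN⇒ : ∀ k → UpowIsId (graph T) k → ∀ ψ a b → a < N → b < N → treeAdj p a b ≡ true →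
               iter k stepN ψ a b ≡ ψ a b
  PeriodicN⇒ k h ψ a b a<N b<N ab =
    subst₂ (λ a b → iter k stepN ψ a b ≡ ψ a b) (Fin.toℕ-fromℕ< a<N) (Fin.toℕ-fromℕ< b<N)
      (trans (sym (iter-restrict k ψ u v uv)) (UpowIsId⇒ (graph T) k h (restrict ψ) u v uv))
    where
    u v : Fin N
    u = fromℕ< a<N
    v = fromℕ< b<N
    uv : treeAdj p (toℕ u) (toℕ v) ≡ true
    uv = trans (cong₂ (treeAdj p) (Fin.toℕ-fromℕ< a<N) (Fin.toℕ-fromℕ< b<N)) ab

  PeriodicN⇐ : ∀ k → (∀ ψ a b → a < N → b < N → treeAdj p a b ≡ true → iter k stepN ψ a b ≡ ψ a b) →
               UpowIsId (graph T) k
  PeriodicN⇐ k h = UpowIsId⇐ (graph T) k λ c d a b ab →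
    let ψ = δ c d in begin
    iter k (step (graph T)) (λ e → idM (graph T) e (c , d)) (a , b)
      ≡⟨ iter-cong (graph T) k (λ a b _ → idM-δ c d a b) a b ab ⟩
    iter k (step (graph T)) (restrict ψ) (a , b)
      ≡⟨ iter-restrict k ψ a b ab ⟩
    iter k stepN ψ (toℕ a) (toℕ b)
      ≡⟨ h ψ (toℕ a) (toℕ b) (Fin.toℕ<n a) (Fin.toℕ<n b) ab ⟩
    ψ (toℕ a) (toℕ b)
      ≡⟨ sym (idM-δ c d a b) ⟩
    idM (graph T) (a , b) (c , d) ∎
    where
    open ≡-Reasoning
    δ : Fin N → Fin N → ℕ → ℕ → ℚ
    δ c d a b = if does (a ≟ toℕ c) ∧ does (b ≟ toℕ d) then 1ℚ else 0ℚ
    does-toℕ : ∀ (a c : Fin N) → does (a Fin.≟ c) ≡ does (toℕ a ≟ toℕ c)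
    does-toℕ a c with a Fin.≟ c
    ... | yes a≡c = sym (dec-true (toℕ a ≟ toℕ c) (cong toℕ a≡c))
    ... | no  a≢c = sym (dec-false (toℕ a ≟ toℕ c) (a≢c ∘ Fin.toℕ-injective))
    idM-δ : ∀ c d a b → idM (graph T) (a , b) (c , d) ≡ δ c d (toℕ a) (toℕ b)
    idM-δ c d a b = cong (λ t → if t then 1ℚ else 0ℚ) (cong₂ _∧_ (does-toℕ a c) (does-toℕ b d))

iter-+ : ∀ {A : Set} k t (f : A → A) x → iter (k + t) f x ≡ iter k f (iter t f x)
iter-+ zero    t f x = refl
iter-+ (suc k) t f x = cong f (iter-+ k t f x)

width≡W : ∀ ds m → width 1 ds m ≡ W (nth ds) m
width≡W ds zero    = refl
width≡W ds (suc m) = trans (width-suc 1 ds m) (cong (_* nth ds m) (width≡W ds m))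

module BetheWalk (ds : List ℕ) (ps : All (1 ≤_) ds) where
  private
    T = betheT ds
    N = tsize T
    p = par T
    d = nth ds
    V = pos 0 1 ds

  V<N : ∀ m x → x < W d m → V m x < N
  V<N m x x<W = subst (V m x <_) (sym (betheSizeGo≡ 1 ds))
                  (pos-< 0 1 ds m x (subst (x <_) (sym (width≡W ds m)) x<W))

  V≥1 : ∀ m x → x < W d (suc m) → 1 ≤ V (suc m) x
  V≥1 m x x<W = go ds (subst (x <_) (sym (width≡W ds (suc m))) x<W)
    where
    go : ∀ ds → x < width 1 ds (suc m) → 1 ≤ pos 0 1 ds (suc m) x
    go (e ∷ es) x<w = pos-≥ 1 (1 * e) es m x x<w

  levels : ∀ v → 1 ≤ v → v < N → Σ ℕ λ m → Σ ℕ λ x → x < W d (suc m) × v ≡ V (suc m) x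
  levels v 1≤v v<N with locate 0 1 ds v z≤n (subst (v <_) (betheSizeGo≡ 1 ds) v<N)
  ... | zero , zero , x<w , refl = contradiction 1≤v λ ()
  ... | zero , suc x , s≤s () , _
  ... | suc m , x , x<w , eq = m , x , subst (x <_) (width≡W ds (suc m)) x<w , eq

  coords-V : ∀ m x → x < W d m → coords 0 1 ds (V m x) ≡ (m , x)
  coords-V m x x<W = coords-pos 0 1 ds m x (subst (x <_) (sym (width≡W ds m)) x<W)

  parent< : ∀ v → 1 ≤ v → v < N → p v < v
  parent< v 1≤v v<N = proj₂ (par-range 0 1 ds ps v 1≤v (subst (v <_) (betheSizeGo≡ 1 ds) v<N))

  parent-V : ∀ m x j → x < W d m → j < d m → p (V (suc m) (x * d m + j)) ≡ V m x
  parent-V m x j x<W j<d = par-pos 0 1 ds ps m x j (subst (x <_) (sym (width≡W ds m)) x<W) j<d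

  private
    module Nℚ = NeighbourSum _+ℚ_ 0ℚ ℚ.+-assoc ℚ.+-comm ℚ.+-identityˡ
    module Nℕ = NeighbourSum _+_ 0 ℕ.+-assoc ℕ.+-comm ℕ.+-identityˡ

  degN-root : degN T 0 ≡ d 0
  degN-root = trans
    (ℕΣ.∑-cong N λ c _ → cong (λ b → if b then 1 else 0) (treeAdj-sym p 0 c))
    (trans (Nℕ.neighbours-root ds ps (λ _ → 1)) (∑ℕ-one (d 0)))

  degN-V : ∀ m x → x < W d (suc m) → degN T (V (suc m) x) ≡ suc (d (suc m))
  degN-V m x x<W = trans
    (ℕΣ.∑-cong N λ c _ → cong (λ b → if b then 1 else 0) (treeAdj-sym p (V (suc m) x) c))
    (trans (Nℕ.neighbours ds ps (λ _ → 1) m x (subst (x <_) (sym (width≡W ds (suc m))) x<W))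
      (trans (cong (_+ 1) (∑ℕ-one (d (suc m)))) (ℕ.+-comm (d (suc m)) 1)))

  downState upState : (ℕ → ℕ → ℚ) → LevelState
  downState ψ m x = ψ (p (V m x)) (V m x)
  upState   ψ m x = ψ (V m x) (p (V m x))

  outflow-V : ∀ ψ m x → x < W d m →
    2/ (degN T (V m x)) *ℚ inflowN T ψ (V m x) ≡ outflow d (downState ψ) (upState ψ) m x
  outflow-V ψ zero zero x<W = cong₂ (λ a b → 2/ a *ℚ b) degN-root
    (trans (Nℚ.neighbours-root ds ps (λ c → ψ c 0))
      (∑-cong (d 0) λ j j<d → cong (ψ (V 1 j)) (sym (parent-V 0 0 j z<s j<d))))
  outflow-V ψ zero (suc x) (s≤s ())
  outflow-V ψ (suc m) x x<W = cong₂ (λ a b → 2/ a *ℚ b) (degN-V m x x<W)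
    (trans (Nℚ.neighbours ds ps (λ c → ψ c (V (suc m) x)) m x (subst (x <_) (sym (width≡W ds (suc m))) x<W))
      (cong (_+ℚ downState ψ (suc m) x) (∑-cong (d (suc m)) λ j j<d →
        cong (ψ (V (suc (suc m)) (x * d (suc m) + j))) (sym (parent-V (suc m) x j x<W j<d)))))

  trajectory : (ℕ → ℕ → ℚ) → Traj d
  trajectory ψ = record
    { D = λ t → downState (iter t (stepN T) ψ)
    ; U = λ t → upState (iter t (stepN T) ψ)
    ; D-step = λ t m x j x<W j<d →
        let φ = iter t (stepN T) ψ; v = V (suc m) (x * d m + j) in
        cong (_-ℚ φ v (p v))
          (trans (cong (λ a → 2/ (degN T a) *ℚ inflowN T φ a) (parent-V m x j x<W j<d))
                 (outflow-V φ m x x<W))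
    ; U-step = λ t m x x<W → let φ = iter t (stepN T) ψ; v = V (suc m) x in
        cong (_-ℚ φ (p v) v) (outflow-V φ (suc m) x x<W)
    }

  -- A parent has a smaller number than its children, so the order of the endpoints tells whether an
  -- arc points down or up.
  initial : LevelState → LevelState → ℕ → ℕ → ℚ
  initial D₀ U₀ a b =
    if a <ᵇ b then (let (m , x) = coords 0 1 ds b in D₀ m x)
              else (let (m , x) = coords 0 1 ds a in U₀ m x)

  module _ (D₀ U₀ : LevelState) where
    initial-D : ∀ m x → x < W d (suc m) → downState (initial D₀ U₀) (suc m) x ≡ D₀ (suc m) x
    initial-D m x x<W
      rewrite <ᵇ-true (parent< (V (suc m) x) (V≥1 m x x<W) (V<N (suc m) x x<W)) | coords-V (suc m) x x<W = refl

    initial-U : ∀ m x → x < W d (suc m) → upState (initial D₀ U₀) (suc m) x ≡ U₀ (suc m) x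
    initial-U m x x<W
      rewrite <ᵇ-false (ℕ.<⇒≤ (parent< (V (suc m) x) (V≥1 m x x<W) (V<N (suc m) x x<W))) | coords-V
        (suc m) x x<W = refl

  record PeriodicTrajectory (k : ℕ) (D₀ U₀ : LevelState) : Set where
    field
      traj : Traj d
    open Traj traj public
    field
      D-init   : ∀ m x → x < W d (suc m) → D 0 (suc m) x ≡ D₀ (suc m) x
      U-init   : ∀ m x → x < W d (suc m) → U 0 (suc m) x ≡ U₀ (suc m) x
      D-period : ∀ t m x → x < W d (suc m) → D (k + t) (suc m) x ≡ D t (suc m) x
      U-period : ∀ t m x → x < W d (suc m) → U (k + t) (suc m) x ≡ U t (suc m) x

  periodicTrajectory : ∀ k → UpowIsId (B ds) k → ∀ D₀ U₀ → PeriodicTrajectory k D₀ U₀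
  periodicTrajectory k h D₀ U₀ = record
    { traj = trajectory ψ
    ; D-init = initial-D D₀ U₀
    ; U-init = initial-U D₀ U₀
    ; D-period = λ t m x x<W → let v = V (suc m) x; v<N = V<N (suc m) x x<W; lt = parent< v (V≥1 m x x<W) v<N in
        trans (cong (λ φ → downState φ (suc m) x) (iter-+ k t (stepN T) ψ))
              (PeriodicN⇒ T k h (iter t (stepN T) ψ) (p v) v (ℕ.<-trans lt v<N) v<N (treeAdj-parent p v lt))
    ; U-period = λ t m x x<W → let v = V (suc m) x; v<N = V<N (suc m) x x<W; lt = parent< v (V≥1 m x x<W) v<N in
        trans (cong (λ φ → upState φ (suc m) x) (iter-+ k t (stepN T) ψ))
              (PeriodicN⇒ T k h (iter t (stepN T) ψ) v (p v) v<N (ℕ.<-trans lt v<N) (treeAdj-child p v lt))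
    }
    where ψ = initial D₀ U₀

  record ReturnsAt (k : ℕ) (τ : Traj d) : Set where
    open Traj τ
    field
      D-return : ∀ m x → x < W d (suc m) → D k (suc m) x ≡ D 0 (suc m) x
      U-return : ∀ m x → x < W d (suc m) → U k (suc m) x ≡ U 0 (suc m) x

  returns⇒UpowIsId : ∀ k → (∀ τ → ReturnsAt k τ) → UpowIsId (B ds) k
  returns⇒UpowIsId k h = PeriodicN⇐ T k λ ψ a b a<N b<N ab → arcs ψ a b a<N b<N (treeAdj⇒ p a b ab)
    where
    arcs : ∀ ψ a b → a < N → b < N → (a < b × a ≡ p b) ⊎ (b < a × b ≡ p a) → iter k (stepN T) ψ a b ≡ ψ a b
    arcs ψ a b a<N b<N (inj₁ (a<b , refl)) with levels b (ℕ.≤-trans z<s a<b) b<N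
    ... | m , x , x<W , refl = ReturnsAt.D-return (h (trajectory ψ)) m x x<W
    arcs ψ a b a<N b<N (inj₂ (b<a , refl)) with levels a (ℕ.≤-trans z<s b<a) a<N
    ... | m , x , x<W , refl = ReturnsAt.U-return (h (trajectory ψ)) m x x<W

-- Subdivision

-- Defined by repeated addition, so that sums of constants follow by induction; `ι≡/1` links it to
-- the library's fractions.
ι : ℕ → ℚ
ι zero    = 0ℚ
ι (suc n) = 1ℚ +ℚ ι n

ι≡/1 : ∀ n → ι n ≡ (ℤ.+ n) ℚ./ 1
ι≡/1 zero    = refl
ι≡/1 (suc n) = trans (cong (1ℚ +ℚ_) (ι≡/1 n)) (ℚ.toℚᵘ-injective (begin
  ℚ.toℚᵘ (1ℚ +ℚ (ℤ.+ n) ℚ./ 1)           ≈⟨ ℚ.toℚᵘ-homo-+ 1ℚ ((ℤ.+ n) ℚ./ 1) ⟩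
  ℚ.toℚᵘ 1ℚ ℚᵘ.+ ℚ.toℚᵘ ((ℤ.+ n) ℚ./ 1)  ≈⟨ ℚᵘ.+-congʳ (ℚ.toℚᵘ 1ℚ) (ℚ.toℚᵘ-fromℚᵘ (ℚᵘ.mkℚᵘ (ℤ.+ n) 0)) ⟩
  ℚᵘ.mkℚᵘ 1ℤ 0 ℚᵘ.+ ℚᵘ.mkℚᵘ (ℤ.+ n) 0  ≈⟨ ℚᵘ.*≡* (cong (λ z → (1ℤ ℤ.+ z) ℤ.* 1ℤ) (ℤ.*-identityʳ (ℤ.+ n))) ⟩
  ℚᵘ.mkℚᵘ (ℤ.+ suc n) 0                     ≈⟨ ℚᵘ.≃-sym (ℚ.toℚᵘ-fromℚᵘ (ℚᵘ.mkℚᵘ (ℤ.+ suc n) 0)) ⟩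
  ℚ.toℚᵘ ((ℤ.+ suc n) ℚ./ 1)             ∎))
  where open ℚᵘ.≃-Reasoning

2ℚ 3ℚ 1½ ⅓ ⅔ : ℚ
2ℚ = ℤ.+ 2 ℚ./ 1
3ℚ = ℤ.+ 3 ℚ./ 1
1½ = ℤ.+ 3 ℚ./ 2
⅓  = ℤ.+ 1 ℚ./ 3
⅔  = ℤ.+ 2 ℚ./ 3

2/-inverse : ∀ n → 2/ (suc n) *ℚ ι (suc n) ≡ 2ℚ
2/-inverse n = trans (cong (2/ (suc n) *ℚ_) (ι≡/1 (suc n))) (ℚ.toℚᵘ-injective (begin
  ℚ.toℚᵘ (2/ (suc n) *ℚ ((ℤ.+ suc n) ℚ./ 1))
    ≈⟨ ℚ.toℚᵘ-homo-* (2/ (suc n)) ((ℤ.+ suc n) ℚ./ 1) ⟩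
  ℚ.toℚᵘ (2/ (suc n)) ℚᵘ.* ℚ.toℚᵘ ((ℤ.+ suc n) ℚ./ 1)
    ≈⟨ ℚᵘ.*-cong (ℚ.toℚᵘ-fromℚᵘ (ℚᵘ.mkℚᵘ (ℤ.+ 2) n)) (ℚ.toℚᵘ-fromℚᵘ (ℚᵘ.mkℚᵘ (ℤ.+ suc n) 0)) ⟩
  ℚᵘ.mkℚᵘ (ℤ.+ 2) n ℚᵘ.* ℚᵘ.mkℚᵘ (ℤ.+ suc n) 0
    ≈⟨ ℚᵘ.*≡* (trans (ℤ.*-identityʳ _) (cong (λ z → ℤ.+ 2 ℤ.* ℤ.+ z) (sym (ℕ.*-identityʳ (suc n))))) ⟩
  ℚ.toℚᵘ 2ℚ ∎))
  where open ℚᵘ.≃-Reasoning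

∑-* : ∀ n c f → ∑ n (λ i → c *ℚ f i) ≡ c *ℚ ∑ n f
∑-* zero    c f = sym (ℚ.*-zeroʳ c)
∑-* (suc n) c f = trans (cong (c *ℚ f 0 +ℚ_) (∑-* n c (f ∘ suc)))
                        (sym (ℚ.*-distribˡ-+ c (f 0) (∑ n (f ∘ suc))))

∑-const : ∀ n c → ∑ n (λ _ → c) ≡ ι n *ℚ c
∑-const zero    c = sym (ℚ.*-zeroˡ c)
∑-const (suc n) c = trans (cong (c +ℚ_) (∑-const n c))
  (solve 2 (λ x y → y :+ x :* y := (con 1ℚ :+ x) :* y) refl (ι n) c)
  where open RS

-- Subdivision expressed in numbers of children. Each edge receives k new vertices, so this is the
-- `suc k`-subdivision.
expand : ℕ → List ℕ → List ℕ
expand k []       = []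
expand k (e ∷ es) = e ∷ replicate k 1 ++ expand k es

nth-replicate : ∀ k i xs → i < k → nth (replicate k 1 ++ xs) i ≡ 1
nth-replicate (suc k) zero    xs i<k       = refl
nth-replicate (suc k) (suc i) xs (s≤s i<k) = nth-replicate k i xs i<k

nth-replicate-++ : ∀ k i xs → nth (replicate k 1 ++ xs) (k + i) ≡ nth xs i
nth-replicate-++ zero    i xs = refl
nth-replicate-++ (suc k) i xs = nth-replicate-++ k i xs

nth-expand : ∀ k e m → nth (expand k e) (m * suc k) ≡ nth e m
nth-expand k []       m       = refl
nth-expand k (e ∷ es) zero    = refl
nth-expand k (e ∷ es) (suc m) = trans (nth-replicate-++ k (m * suc k) (expand k es)) (nth-expand k es m)

-- Past the end of the list `nth` returns 0 and no levels with a single child are inserted; the last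
-- hypothesis excludes this.
nth-expand-inner : ∀ k e m i → i < k → nth e m ≢ 0 → nth (expand k e) (suc i + m * suc k) ≡ 1
nth-expand-inner k []       m       i i<k ne = contradiction refl ne
nth-expand-inner k (e ∷ es) zero    i i<k ne =
  trans (cong (nth (replicate k 1 ++ expand k es)) (ℕ.+-identityʳ i)) (nth-replicate k i (expand k es) i<k)
nth-expand-inner k (e ∷ es) (suc m) i i<k ne = trans
  (cong (nth (expand k (e ∷ es))) (shift i (m * suc k)))
  (trans (nth-replicate-++ k (suc i + m * suc k) (expand k es)) (nth-expand-inner k es m i i<k ne))
  where
  shift : ∀ i n → suc i + (suc k + n) ≡ suc k + (suc i + n)
  shift i n = trans (sym (ℕ.+-assoc (suc i) (suc k) n))
                (trans (cong (_+ n) (ℕ.+-comm (suc i) (suc k))) (ℕ.+-assoc (suc k) (suc i) n))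

expand-positive : ∀ k e → All (1 ≤_) e → All (1 ≤_) (expand k e)
expand-positive k []       []       = []
expand-positive k (e ∷ es) (p ∷ ps) = p ∷ ones k
  where
  ones : ∀ i → All (1 ≤_) (replicate i 1 ++ expand k es)
  ones zero    = expand-positive k es ps
  ones (suc i) = z<s ∷ ones i

module Transit {d : ℕ → ℕ} (τ : Traj d) where
  open Traj τ

  pass : ∀ t l x → d (suc l) ≡ 1 →
    outflow d (D t) (U t) (suc l) x ≡ U t (suc (suc l)) x +ℚ D t (suc l) x
  pass t l x d≡1 rewrite d≡1 | ℕ.*-identityʳ x | ℕ.+-identityʳ x =
    solve 2 (λ u v → con (2/ 2) :* ((u :+ con 0ℚ) :+ v) := u :+ v) refl (U t (suc (suc l)) x) (D t (suc l) x)
    where open RS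

  pass-D : ∀ t l x → x < W d (suc l) → d (suc l) ≡ 1 → D (suc t) (suc (suc l)) x ≡ D t (suc l) x
  pass-D t l x x<W d≡1 = begin
    D (suc t) (suc (suc l)) x
      ≡⟨ cong (D (suc t) (suc (suc l))) (sym x≡) ⟩
    D (suc t) (suc (suc l)) (x * d (suc l) + 0)
      ≡⟨ D-step t (suc l) x 0 x<W (subst (0 <_) (sym d≡1) z<s) ⟩
    outflow d (D t) (U t) (suc l) x -ℚ U t (suc (suc l)) (x * d (suc l) + 0)
      ≡⟨ cong₂ _-ℚ_ (pass t l x d≡1) (cong (U t (suc (suc l))) x≡) ⟩
    U t (suc (suc l)) x +ℚ D t (suc l) x -ℚ U t (suc (suc l)) x
      ≡⟨ solve 2 (λ u v → u :+ v :- u := v) refl (U t (suc (suc l)) x) (D t (suc l) x) ⟩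
    D t (suc l) x ∎
    where
    open ≡-Reasoning
    open RS
    x≡ : x * d (suc l) + 0 ≡ x
    x≡ = trans (ℕ.+-identityʳ (x * d (suc l))) (trans (cong (x *_) d≡1) (ℕ.*-identityʳ x))

  pass-U : ∀ t l x → x < W d (suc l) → d (suc l) ≡ 1 → U (suc t) (suc l) x ≡ U t (suc (suc l)) x
  pass-U t l x x<W d≡1 = trans (U-step t l x x<W)
    (trans (cong (_-ℚ D t (suc l) x) (pass t l x d≡1))
      (solve 2 (λ u v → u :+ v :- v := u) refl (U t (suc (suc l)) x) (D t (suc l) x)))
    where open RS

module Expansion (k : ℕ) (e : List ℕ) where
  private
    K = suc k
    d = nth (expand k e)
    w = nth e

  W-expand : ∀ m → W d (m * K) ≡ W w m
  W-inner : ∀ m i → i ≤ k → W d (suc i + m * K) ≡ W w (suc m)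

  W-expand zero    = refl
  W-expand (suc m) = W-inner m k ℕ.≤-refl

  W-inner m zero    i≤k = cong₂ _*_ (W-expand m) (nth-expand k e m)
  W-inner m (suc i) i≤k with w m ≟ 0
  ... | yes w≡0 = trans (cong (_* d (suc i + m * K)) (trans (W-inner m i (ℕ.<⇒≤ i≤k)) zeros)) (sym zeros)
    where
    zeros : W w m * w m ≡ 0
    zeros = trans (cong (W w m *_) w≡0) (ℕ.*-zeroʳ (W w m))
  ... | no w≢0 = trans (cong₂ _*_ (W-inner m i (ℕ.<⇒≤ i≤k)) (nth-expand-inner k e m i i≤k w≢0))
                       (ℕ.*-identityʳ (W w m * w m))

  inner-one : ∀ m i {x} → suc i ≤ k → x < W w (suc m) → d (suc i + m * K) ≡ 1
  inner-one m i {x} i<k x<W = nth-expand-inner k e m i i<k λ w≡0 →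
    ℕ.n≮0 (subst (x <_) (trans (cong (W w m *_) w≡0) (ℕ.*-zeroʳ (W w m))) x<W)

  module _ (τ : Traj d) where
    open Traj τ
    open Transit τ

    transit-D : ∀ j t m i x → j + i ≤ k → x < W w (suc m) →
      D (j + t) (suc (j + i) + m * K) x ≡ D t (suc i + m * K) x
    transit-D zero    t m i x ji≤k x<W = refl
    transit-D (suc j) t m i x ji≤k x<W =
      trans (pass-D (j + t) (j + i + m * K) x
               (subst (x <_) (sym (W-inner m (j + i) (ℕ.<⇒≤ ji≤k))) x<W) (inner-one m (j + i) ji≤k x<W))
            (transit-D j t m i x (ℕ.<⇒≤ ji≤k) x<W)

    transit-U : ∀ i t m x → i ≤ k → x < W w (suc m) →
      U (i + t) (suc (m * K)) x ≡ U t (suc i + m * K) x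
    transit-U zero    t m x i≤k x<W = refl
    transit-U (suc i) t m x i≤k x<W =
      trans (cong (λ s → U s (suc (m * K)) x) (sym (ℕ.+-suc i t)))
        (trans (transit-U i (suc t) m x (ℕ.<⇒≤ i≤k) x<W)
          (pass-U t (i + m * K) x (subst (x <_) (sym (W-inner m i (ℕ.<⇒≤ i≤k))) x<W) (inner-one m i i≤k x<W)))

    -- The amplitudes about to be scattered, sampled every K steps: they evolve by the walk of e.
    arrivalD arrivalU : ℕ → ℕ → LevelState
    arrivalD r q zero    x = 0ℚ
    arrivalD r q (suc m) x = D (r + q * K) (suc m * K) x
    arrivalU r q zero    x = 0ℚ
    arrivalU r q (suc m) x = U (r + q * K) (suc (m * K)) x

    -- Inner vertices of a subdivided edge only delay waves, so scattering couples amplitudes whose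
    -- arrival times agree modulo K. The walk thus splits into K independent walks on the original
    -- tree, one for each phase r.
    arrival : ℕ → Traj w
    arrival r = record
      { D = arrivalD r ; U = arrivalU r
      ; D-step = λ q m x j x<W j<w → let t = r + q * K; y = x * w m + j; y<W = next-bound (w m) x<W j<w in
          begin
          D (r + (K + q * K)) (suc m * K) y
            ≡⟨ cong₂ (λ s l → D s (suc l + m * K) y) (later q) (sym (ℕ.+-identityʳ k)) ⟩
          D (k + suc t) (suc (k + 0) + m * K) y
            ≡⟨ transit-D k (suc t) m 0 y (ℕ.≤-reflexive (ℕ.+-identityʳ k)) y<W ⟩
          D (suc t) (suc (m * K)) y
            ≡⟨ cong (λ z → D (suc t) (suc (m * K)) (x * z + j)) (sym (nth-expand k e m)) ⟩
          D (suc t) (suc (m * K)) (x * d (m * K) + j)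
            ≡⟨ D-step t (m * K) x j (subst (x <_) (sym (W-expand m)) x<W)
              (subst (j <_) (sym (nth-expand k e m)) j<w) ⟩
          outflow d (D t) (U t) (m * K) x -ℚ U t (suc (m * K)) (x * d (m * K) + j)
            ≡⟨ cong₂ _-ℚ_ (outflow-arrival q m x) (cong (λ z → U t (suc (m * K)) (x * z + j))
              (nth-expand k e m)) ⟩
          outflow w (arrivalD r q) (arrivalU r q) m x -ℚ U t (suc (m * K)) y ∎
      ; U-step = λ q m x x<W → let t = r + q * K in
          begin
          U (r + (K + q * K)) (suc (m * K)) x
            ≡⟨ cong (λ s → U s (suc (m * K)) x) (later q) ⟩
          U (k + suc t) (suc (m * K)) x
            ≡⟨ transit-U k (suc t) m x ℕ.≤-refl x<W ⟩
          U (suc t) (suc m * K) x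
            ≡⟨ U-step t (k + m * K) x (subst (x <_) (sym (W-expand (suc m))) x<W) ⟩
          outflow d (D t) (U t) (suc m * K) x -ℚ D t (suc m * K) x
            ≡⟨ cong (_-ℚ D t (suc m * K) x) (outflow-arrival q (suc m) x) ⟩
          outflow w (arrivalD r q) (arrivalU r q) (suc m) x -ℚ D t (suc m * K) x ∎
      }
      where
      open ≡-Reasoning
      later : ∀ q → r + (K + q * K) ≡ k + suc (r + q * K)
      later q = begin
        r + suc (k + q * K)   ≡⟨ ℕ.+-suc r (k + q * K) ⟩
        suc (r + (k + q * K)) ≡⟨ cong suc (sym (ℕ.+-assoc r k (q * K))) ⟩
        suc (r + k + q * K)   ≡⟨ cong (λ z → suc (z + q * K)) (ℕ.+-comm r k) ⟩
        suc (k + r + q * K)   ≡⟨ cong suc (ℕ.+-assoc k r (q * K)) ⟩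
        suc (k + (r + q * K)) ≡⟨ sym (ℕ.+-suc k (r + q * K)) ⟩
        k + suc (r + q * K)   ∎
      outflow-arrival : ∀ q m x → let t = r + q * K in
        outflow d (D t) (U t) (m * K) x ≡ outflow w (arrivalD r q) (arrivalU r q) m x
      outflow-arrival q zero    x rewrite nth-expand k e 0 = refl
      outflow-arrival q (suc m) x rewrite nth-expand k e (suc m) = refl

  module _ (p : ℕ) (ps : All (1 ≤_) e) (return : ∀ τ → BetheWalk.ReturnsAt e ps p τ) (τ : Traj d) where
    open BetheWalk e ps using (module ReturnsAt)
    open Traj τ

    private
      level : ∀ l → Σ ℕ λ m → Σ ℕ λ i → i ≤ k × suc l ≡ suc i + m * K
      level l = l / K , l % K , ℕ.≤-pred (ℕ.m%n<n l K) , cong suc (ℕ.m≡m%n+[m/n]*n l K)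

      D-inner : ∀ m i x → i ≤ k → x < W w (suc m) → D (p * K) (suc i + m * K) x ≡ D 0 (suc i + m * K) x
      D-inner m i x i≤k x<W = begin
        D (p * K) (suc i + m * K) x
          ≡⟨ sym (transit-D τ j (p * K) m i x (ℕ.≤-reflexive j+i) x<W) ⟩
        D (j + p * K) (suc (j + i) + m * K) x
          ≡⟨ cong (λ l → D (j + p * K) (suc l + m * K) x) j+i ⟩
        D (j + p * K) (suc m * K) x
          ≡⟨ ReturnsAt.D-return (return (arrival τ j)) m x x<W ⟩
        D (j + 0) (suc m * K) x
          ≡⟨ cong (λ l → D (j + 0) (suc l + m * K) x) (sym j+i) ⟩
        D (j + 0) (suc (j + i) + m * K) x
          ≡⟨ transit-D τ j 0 m i x (ℕ.≤-reflexive j+i) x<W ⟩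
        D 0 (suc i + m * K) x ∎
        where
        open ≡-Reasoning
        j = k ∸ i
        j+i : j + i ≡ k
        j+i = ℕ.m∸n+n≡m i≤k

      U-inner : ∀ m i x → i ≤ k → x < W w (suc m) → U (p * K) (suc i + m * K) x ≡ U 0 (suc i + m * K) x
      U-inner m i x i≤k x<W = begin
        U (p * K) (suc i + m * K) x   ≡⟨ sym (transit-U τ i (p * K) m x i≤k x<W) ⟩
        U (i + p * K) (suc (m * K)) x ≡⟨ ReturnsAt.U-return (return (arrival τ i)) m x x<W ⟩
        U (i + 0) (suc (m * K)) x     ≡⟨ transit-U τ i 0 m x i≤k x<W ⟩
        U 0 (suc i + m * K) x         ∎
        where open ≡-Reasoning

    -- An amplitude at position i inside a subdivided edge reaches the end of the edge unchanged,
    -- after k - i steps if it goes down and i steps if it goes up. There it belongs to the sampled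
    -- walk of that phase, which returns after p samples.
    expand-returns : BetheWalk.ReturnsAt (expand k e) (expand-positive k e ps) (p * K) τ
    expand-returns = record
      { D-return = λ l x x<W → case level l of λ where
          (m , i , i≤k , eq) → subst (λ n → D (p * K) n x ≡ D 0 n x) (sym eq)
            (D-inner m i x i≤k (subst (x <_) (trans (cong (W d) eq) (W-inner m i i≤k)) x<W))
      ; U-return = λ l x x<W → case level l of λ where
          (m , i , i≤k , eq) → subst (λ n → U (p * K) n x ≡ U 0 n x) (sym eq)
            (U-inner m i x i≤k (subst (x <_) (trans (cong (W d) eq) (W-inner m i i≤k)) x<W))
      }

-- Periods of the unsubdivided trees

one-period : ∀ (ps : All (1 ≤_) (1 ∷ [])) τ → BetheWalk.ReturnsAt (1 ∷ []) ps 2 τ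
one-period ps τ = record { D-return = DR ; U-return = UR }
  where
  open Traj τ
  open RS
  D+1 : ∀ t → D (suc t) 1 0 ≡ U t 1 0
  D+1 t = trans (D-step t 0 0 0 z<s z<s)
    (solve 1 (λ u → con (2/ 1) :* (u :+ con 0ℚ) :- u := u) refl (U t 1 0))
  U+1 : ∀ t → U (suc t) 1 0 ≡ D t 1 0
  U+1 t = trans (U-step t 0 0 z<s)
    (solve 1 (λ v → con (2/ 1) :* (con 0ℚ :+ v) :- v := v) refl (D t 1 0))
  DR : ∀ m x → x < W (nth (1 ∷ [])) (suc m) → D 2 (suc m) x ≡ D 0 (suc m) x
  DR zero zero _ = trans (D+1 1) (U+1 0)
  DR zero (suc x) (s≤s ())
  DR (suc m) x lt = contradiction (subst (x <_) (ℕ.*-zeroʳ (W (nth (1 ∷ [])) (suc m))) lt) λ ()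
  UR : ∀ m x → x < W (nth (1 ∷ [])) (suc m) → U 2 (suc m) x ≡ U 0 (suc m) x
  UR zero zero _ = trans (U+1 1) (D+1 0)
  UR zero (suc x) (s≤s ())
  UR (suc m) x lt = contradiction (subst (x <_) (ℕ.*-zeroʳ (W (nth (1 ∷ [])) (suc m))) lt) λ ()

module _ {e : ℕ → ℕ} (τ : Traj e) where
  open Traj τ
  open RS

  leaf-U : ∀ t m x → e (suc m) ≡ 0 → x < W e (suc m) → U (suc t) (suc m) x ≡ D t (suc m) x
  leaf-U t m x e≡0 x<W = trans (U-step t m x x<W) body
    where
    body : outflow e (D t) (U t) (suc m) x -ℚ D t (suc m) x ≡ D t (suc m) x
    body rewrite e≡0 = solve 1 (λ v → con (2/ 1) :* (con 0ℚ :+ v) :- v := v) refl (D t (suc m) x)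

∑-outflow : ∀ n g f → ∑ n (λ i → g -ℚ f i) ≡ ι n *ℚ g -ℚ ∑ n f
∑-outflow n g f = begin
  ∑ n (λ i → g -ℚ f i)
    ≡⟨ ∑-cong n (λ i _ → solve 2 (λ x y → x :- y := x :+ con (⊖ 1ℚ) :* y) refl g (f i)) ⟩
  ∑ n (λ i → g +ℚ (⊖ 1ℚ) *ℚ f i)             ≡⟨ ∑-⊕ n (λ _ → g) (λ i → (⊖ 1ℚ) *ℚ f i) ⟩
  ∑ n (λ _ → g) +ℚ ∑ n (λ i → (⊖ 1ℚ) *ℚ f i) ≡⟨ cong₂ _+ℚ_ (∑-const n g) (∑-* n (⊖ 1ℚ) f) ⟩
  ι n *ℚ g +ℚ (⊖ 1ℚ) *ℚ ∑ n f
    ≡⟨ solve 2 (λ x y → x :+ con (⊖ 1ℚ) :* y := x :- y) refl (ι n *ℚ g) (∑ n f) ⟩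
  ι n *ℚ g -ℚ ∑ n f                           ∎
  where
  open ≡-Reasoning
  open RS

-- Two steps, one at the centre and one at the leaves, replace each amplitude x by twice the mean
-- minus x. This preserves the total and is therefore an involution.
star-period : ∀ m (ps : All (1 ≤_) (suc m ∷ [])) τ → BetheWalk.ReturnsAt (suc m ∷ []) ps 4 τ
star-period m ps τ = record { D-return = DR ; U-return = UR }
  where
  open Traj τ
  open RS
  s = suc m
  e = nth (s ∷ [])
  c = 2/ s
  W1 : ∀ {x} → x < s → x < W e 1
  W1 {x} = subst (x <_) (sym (ℕ.+-identityʳ s))
  U+1 : ∀ t x → x < s → U (suc t) 1 x ≡ D t 1 x
  U+1 t x x<s = leaf-U τ t 0 x refl (W1 x<s)
  D+1 : ∀ t x → x < s → D (suc t) 1 x ≡ c *ℚ ∑ s (U t 1) -ℚ U t 1 x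
  D+1 t x x<s = D-step t 0 0 x z<s x<s
  ∑D+1 : ∀ t → ∑ s (D (suc t) 1) ≡ ∑ s (U t 1)
  ∑D+1 t = begin
    ∑ s (D (suc t) 1)                              ≡⟨ ∑-cong s (D+1 t) ⟩
    ∑ s (λ x → c *ℚ ∑ s (U t 1) -ℚ U t 1 x)        ≡⟨ ∑-outflow s (c *ℚ ∑ s (U t 1)) (U t 1) ⟩
    ι s *ℚ (c *ℚ ∑ s (U t 1)) -ℚ ∑ s (U t 1)
      ≡⟨ solve 3 (λ i c u → i :* (c :* u) :- u := (c :* i) :* u :- u) refl (ι s) c (∑ s (U t 1)) ⟩
    (c *ℚ ι s) *ℚ ∑ s (U t 1) -ℚ ∑ s (U t 1)
      ≡⟨ cong (λ z → z *ℚ ∑ s (U t 1) -ℚ ∑ s (U t 1)) (2/-inverse m) ⟩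
    2ℚ *ℚ ∑ s (U t 1) -ℚ ∑ s (U t 1)               ≡⟨ solve 1 (λ u → con 2ℚ :* u :- u := u) refl (∑ s (U t 1)) ⟩
    ∑ s (U t 1)                                    ∎
    where open ≡-Reasoning
  D+2 : ∀ t x → x < s → D (suc (suc t)) 1 x ≡ c *ℚ ∑ s (D t 1) -ℚ D t 1 x
  D+2 t x x<s = trans (D+1 (suc t) x x<s)
    (cong₂ (λ a b → c *ℚ a -ℚ b) (∑-cong s (U+1 t)) (U+1 t x x<s))
  ∑D+2 : ∀ t → ∑ s (D (suc (suc t)) 1) ≡ ∑ s (D t 1)
  ∑D+2 t = trans (∑D+1 (suc t)) (∑-cong s (U+1 t))
  double : ∀ a b → a -ℚ (a -ℚ b) ≡ b
  double = solve 2 (λ a b → a :- (a :- b) := b) refl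
  D+4 : ∀ t x → x < s → D (suc (suc (suc (suc t)))) 1 x ≡ D t 1 x
  D+4 t x x<s = trans (D+2 (suc (suc t)) x x<s)
    (trans (cong₂ (λ a b → c *ℚ a -ℚ b) (∑D+2 t) (D+2 t x x<s)) (double (c *ℚ ∑ s (D t 1)) (D t 1 x)))
  U+4 : ∀ x → x < s → U 4 1 x ≡ U 0 1 x
  U+4 x x<s = trans (U+1 3 x x<s) (trans (D+2 1 x x<s)
    (trans (cong₂ (λ a b → c *ℚ a -ℚ b) (∑D+1 0) (D+1 0 x x<s)) (double (c *ℚ ∑ s (U 0 1)) (U 0 1 x))))
  beyond : ∀ m x → ¬ (x < W e (suc (suc m)))
  beyond m x lt = ℕ.n≮0 (subst (x <_) (ℕ.*-zeroʳ (W e (suc m))) lt)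
  DR : ∀ m x → x < W e (suc m) → D 4 (suc m) x ≡ D 0 (suc m) x
  DR zero    x x<W = D+4 0 x (subst (x <_) (ℕ.+-identityʳ s) x<W)
  DR (suc m) x x<W = contradiction x<W (beyond m x)
  UR : ∀ m x → x < W e (suc m) → U 4 (suc m) x ≡ U 0 (suc m) x
  UR zero    x x<W = U+4 x (subst (x <_) (ℕ.+-identityʳ s) x<W)
  UR (suc m) x x<W = contradiction x<W (beyond m x)

-- The bottom of the trees with d(n-1) = 3.  Here D t is the amplitude going down into a vertex
-- with three leaves, T t and u t are the amplitudes returning from its leaves (in total and from
-- one of them), f t is half the amplitude arriving at the vertex, and g t is what the vertex above scatters down.
module Claw (D T u g f : ℕ → ℚ)
  (f-def : ∀ t → f t ≡ ½ *ℚ (T t +ℚ D t))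
  (D+2 : ∀ t → D (2 + t) ≡ g (1 + t) +ℚ ½ *ℚ (D t -ℚ T t))
  (T+2 : ∀ t → T (2 + t) ≡ ½ *ℚ (T t +ℚ 3ℚ *ℚ D t))
  (u+2 : ∀ t → u (2 + t) ≡ f t -ℚ u t) where
  open RS

  T+4 : ∀ t → T (4 + t) ≡ T (2 + t) -ℚ T t +ℚ 1½ *ℚ g (1 + t)
  T+4 t = trans (T+2 (2 + t)) (trans (cong (λ z → ½ *ℚ (T (2 + t) +ℚ 3ℚ *ℚ z)) (D+2 t))
    (trans (cong (λ z → ½ *ℚ (z +ℚ 3ℚ *ℚ (g (1 + t) +ℚ ½ *ℚ (D t -ℚ T t)))) (T+2 t))
    (trans (solve 3 (λ T D g → con ½ :* (con ½ :* (T :+ con 3ℚ :* D) :+ con 3ℚ :* (g :+ con ½ :* (D :- T)))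
                           := con ½ :* (T :+ con 3ℚ :* D) :- T :+ con 1½ :* g) refl (T t) (D t) (g (1 + t)))
      (cong (λ z → z -ℚ T t +ℚ 1½ *ℚ g (1 + t)) (sym (T+2 t))))))

  -- In terms of the time shift z, `T+4` says that z⁴ - z² + 1 sends T to a multiple of g.
  -- Multiplication by z² + 1 turns the left side into z⁶ + 1, so that T changes sign after six
  -- steps, up to the drive.
  T+6 : ∀ t → T (6 + t) ≡ 1½ *ℚ (g (1 + t) +ℚ g (3 + t)) -ℚ T t
  T+6 t = trans (T+4 (2 + t))
    (trans (cong (λ z → z -ℚ T (2 + t) +ℚ 1½ *ℚ g (3 + t)) (T+4 t))
      (solve 4 (λ a b x y → (a :- b :+ con 1½ :* x) :- a :+ con 1½ :* y
                         := con 1½ :* (x :+ y) :- b) refl (T (2 + t)) (T t) (g (1 + t)) (g (3 + t))))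

  -- The drive enters `T+6` only through g(1+t) + g(3+t), so period 6 of this sum is the right
  -- condition: it holds in both families, although g itself need not have period 6.
  module _ (g-pair : ∀ t → g (7 + t) +ℚ g (9 + t) ≡ g (1 + t) +ℚ g (3 + t)) where

    T+12 : ∀ t → T (12 + t) ≡ T t
    T+12 t = trans (T+6 (6 + t)) (trans (cong₂ (λ a b → 1½ *ℚ a -ℚ b) (g-pair t) (T+6 t))
      (solve 2 (λ a b → a :- (a :- b) := b) refl (1½ *ℚ (g (1 + t) +ℚ g (3 + t))) (T t)))

    private
      D≡ : ∀ t → D t ≡ ⅓ *ℚ (2ℚ *ℚ T (2 + t) -ℚ T t)
      D≡ t = trans (solve 2 (λ T D → D := con ⅓ :* (con 2ℚ :* (con ½ :* (T :+ con 3ℚ :* D)) :- T)) refl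
          (T t) (D t))
               (cong (λ z → ⅓ *ℚ (2ℚ *ℚ z -ℚ T t)) (sym (T+2 t)))

      -- The deviation u - T/3 of one leaf from the mean of the three changes sign every two steps;
      -- it has period 4, which divides 12.
      u-T : ∀ t → u (2 + t) ≡ ⅓ *ℚ T (2 + t) -ℚ (u t -ℚ ⅓ *ℚ T t)
      u-T t = trans (u+2 t) (trans (cong (_-ℚ u t) (f-def t))
        (trans (solve 3 (λ T D u → con ½ :* (T :+ D) :- u
                 := con ⅓ :* (con ½ :* (T :+ con 3ℚ :* D)) :- (u :- con ⅓ :* T)) refl (T t) (D t) (u t))
          (cong (λ z → ⅓ *ℚ z -ℚ (u t -ℚ ⅓ *ℚ T t)) (sym (T+2 t)))))

      u+4 : ∀ t → u (4 + t) ≡ u t -ℚ ⅓ *ℚ T t +ℚ ⅓ *ℚ T (4 + t)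
      u+4 t = trans (u-T (2 + t)) (trans (cong (λ z → ⅓ *ℚ T (4 + t) -ℚ (z -ℚ ⅓ *ℚ T (2 + t))) (u-T t))
        (solve 4 (λ a b c d → c :- ((b :- (d :- a)) :- b) := d :- a :+ c) refl
          (⅓ *ℚ T t) (⅓ *ℚ T (2 + t)) (⅓ *ℚ T (4 + t)) (u t)))

    D+12 : ∀ t → D (12 + t) ≡ D t
    D+12 t = trans (D≡ (12 + t)) (trans (cong₂ (λ a b → ⅓ *ℚ (2ℚ *ℚ a -ℚ b)) (T+12 (2 + t)) (T+12 t))
      (sym (D≡ t)))

    u+12 : ∀ t → u (12 + t) ≡ u t
    u+12 t = trans (u+4 (8 + t)) (trans
      (cong₂ (λ a b → a -ℚ ⅓ *ℚ T (8 + t) +ℚ ⅓ *ℚ b)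
        (trans (u+4 (4 + t)) (cong (λ z → z -ℚ ⅓ *ℚ T (4 + t) +ℚ ⅓ *ℚ T (8 + t)) (u+4 t))) (T+12 t))
      (solve 4 (λ a b c d → (((d :- a :+ b) :- b :+ c) :- c) :+ a := d) refl
        (⅓ *ℚ T t) (⅓ *ℚ T (4 + t)) (⅓ *ℚ T (8 + t)) (u t)))

∑-lin : ∀ n a b f g → ∑ n (λ i → a *ℚ f i +ℚ b *ℚ g i) ≡ a *ℚ ∑ n f +ℚ b *ℚ ∑ n g
∑-lin n a b f g = trans (∑-⊕ n (λ i → a *ℚ f i) (λ i → b *ℚ g i)) (cong₂ _+ℚ_ (∑-* n a f) (∑-* n b g))

module ThreeLeaves {e : ℕ → ℕ} (τ : Traj e) (l : ℕ) (e≡3 : e (suc l) ≡ 3) (e≡0 : e (suc (suc l)) ≡ 0) where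
  open Traj τ
  open RS

  T f : ℕ → ℕ → ℚ
  T t x = ∑ 3 (λ j → U t (suc (suc l)) (x * 3 + j))
  f t x = ½ *ℚ (T t x +ℚ D t (suc l) x)

  inside : ∀ {x j} → x < W e (suc l) → j < 3 → x * 3 + j < W e (suc (suc l))
  inside {x} {j} x<W j<3 = subst (x * 3 + j <_) (cong (W e (suc l) *_) (sym e≡3)) (next-bound 3 x<W j<3)

  outflow≡f : ∀ t x → outflow e (D t) (U t) (suc l) x ≡ f t x
  outflow≡f t x rewrite e≡3 = refl

  U+1 : ∀ t x → x < W e (suc l) → U (suc t) (suc l) x ≡ f t x -ℚ D t (suc l) x
  U+1 t x x<W = trans (U-step t l x x<W) (cong (_-ℚ D t (suc l) x) (outflow≡f t x))

  leafD+1 : ∀ t x j → x < W e (suc l) → j < 3 →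
    D (suc t) (suc (suc l)) (x * 3 + j) ≡ f t x -ℚ U t (suc (suc l)) (x * 3 + j)
  leafD+1 t x j x<W j<3 = subst
    (λ n → D (suc t) (suc (suc l)) (x * n + j) ≡ f t x -ℚ U t (suc (suc l)) (x * n + j)) e≡3
    (trans (D-step t (suc l) x j x<W (subst (j <_) (sym e≡3) j<3))
           (cong (_-ℚ U t (suc (suc l)) (x * e (suc l) + j)) (outflow≡f t x)))

  leafU+1 : ∀ t y → y < W e (suc (suc l)) → U (suc t) (suc (suc l)) y ≡ D t (suc (suc l)) y
  leafU+1 t y y<W = leaf-U τ t (suc l) y e≡0 y<W

  leafU+2 : ∀ t x j → x < W e (suc l) → j < 3 →
    U (2 + t) (suc (suc l)) (x * 3 + j) ≡ f t x -ℚ U t (suc (suc l)) (x * 3 + j)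
  leafU+2 t x j x<W j<3 = trans (leafU+1 (suc t) (x * 3 + j) (inside x<W j<3)) (leafD+1 t x j x<W j<3)

  T+2 : ∀ t x → x < W e (suc l) → T (2 + t) x ≡ ½ *ℚ (T t x +ℚ 3ℚ *ℚ D t (suc l) x)
  T+2 t x x<W = trans (∑-cong 3 λ j j<3 → leafU+2 t x j x<W j<3)
    (trans (∑-outflow 3 (f t x) (λ j → U t (suc (suc l)) (x * 3 + j)))
      (solve 2 (λ T D → con (ι 3) :* (con ½ :* (T :+ D)) :- T := con ½ :* (T :+ con 3ℚ :* D)) refl
        (T t x) (D t (suc l) x)))

  U+1′ : ∀ t x → x < W e (suc l) → U (suc t) (suc l) x ≡ ½ *ℚ T t x +ℚ (⊖ ½) *ℚ D t (suc l) x
  U+1′ t x x<W = trans (U+1 t x x<W)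
    (solve 2 (λ T D → con ½ :* (T :+ D) :- D := con ½ :* T :+ con (⊖ ½) :* D) refl (T t x) (D t (suc l) x))

  T+2′ : ∀ t x → x < W e (suc l) → T (2 + t) x ≡ ½ *ℚ T t x +ℚ 1½ *ℚ D t (suc l) x
  T+2′ t x x<W = trans (T+2 t x x<W)
    (solve 2 (λ T D → con ½ :* (T :+ con 3ℚ :* D) := con ½ :* T :+ con 1½ :* D) refl (T t x) (D t (suc l) x))

  split3 : ∀ y → y < W e (suc (suc l)) → Σ ℕ λ x → Σ ℕ λ j → x < W e (suc l) × j < 3 × y ≡ x * 3 + j
  split3 y y<W = y / 3 , y % 3 , ℕ.m<n*o⇒m/o<n (subst (y <_) (cong (W e (suc l) *_) e≡3) y<W) , ℕ.m%n<n y 3 ,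
    trans (ℕ.m≡m%n+[m/n]*n y 3) (ℕ.+-comm (y % 3) (y / 3 * 3))

  -- One signal g serves all x because, in both trees to which this is applied, the vertices with
  -- three leaves share their parent.
  module Driven (g : ℕ → ℚ)
    (D+1 : ∀ t x → x < W e (suc l) → D (suc t) (suc l) x ≡ g t -ℚ U t (suc l) x)
    (g-pair : ∀ t → g (7 + t) +ℚ g (9 + t) ≡ g (1 + t) +ℚ g (3 + t)) where

    D+2 : ∀ t x → x < W e (suc l) → D (2 + t) (suc l) x ≡ g (1 + t) +ℚ ½ *ℚ (D t (suc l) x -ℚ T t x)
    D+2 t x x<W = trans (D+1 (suc t) x x<W) (trans (cong (g (1 + t) -ℚ_) (U+1 t x x<W))
      (solve 3 (λ T D g → g :- (con ½ :* (T :+ D) :- D) := g :+ con ½ :* (D :- T)) refl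
        (T t x) (D t (suc l) x) (g (1 + t))))

    module At (x : ℕ) (x<W : x < W e (suc l)) where
      module _ (j : ℕ) (j<3 : j < 3) where
        open Claw (λ t → D t (suc l) x) (λ t → T t x) (λ t → U t (suc (suc l)) (x * 3 + j)) g (λ t → f t x)
          (λ t → refl) (λ t → D+2 t x x<W) (λ t → T+2 t x x<W) (λ t → leafU+2 t x j x<W j<3) public

    D+12 : ∀ t x → x < W e (suc l) → D (12 + t) (suc l) x ≡ D t (suc l) x
    D+12 t x x<W = At.D+12 x x<W 0 z<s g-pair t

    T+12 : ∀ t x → x < W e (suc l) → T (12 + t) x ≡ T t x
    T+12 t x x<W = At.T+12 x x<W 0 z<s g-pair t

    leafU+12 : ∀ t y → y < W e (suc (suc l)) → U (12 + t) (suc (suc l)) y ≡ U t (suc (suc l)) y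
    leafU+12 t y y<W with split3 y y<W
    ... | x , j , x<W , j<3 , refl = At.u+12 x x<W j j<3 g-pair t

    leafD+12 : ∀ t y → y < W e (suc (suc l)) → D (12 + t) (suc (suc l)) y ≡ D t (suc (suc l)) y
    leafD+12 t y y<W = trans (sym (leafU+1 (12 + t) y y<W)) (trans (leafU+12 (suc t) y y<W) (leafU+1 t y y<W))

    U+12 : ∀ t x → g (12 + t) ≡ g t → x < W e (suc l) → U (12 + t) (suc l) x ≡ U t (suc l) x
    U+12 t x g≡ x<W = trans (back (12 + t)) (trans (cong₂ _-ℚ_ g≡ (D+12 (suc t) x x<W)) (sym (back t)))
      where
      back : ∀ t → U t (suc l) x ≡ g t -ℚ D (suc t) (suc l) x
      back t = trans (solve 2 (λ u g → u := g :- (g :- u)) refl (U t (suc l) x) (g t))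
                     (cong (g t -ℚ_) (sym (D+1 t x x<W)))

-- The sums over the s vertices of level 1 are scaled by 2/s. With this scaling s disappears from
-- their recurrences, which give the drive g period 4 for every s; then g(t) + g(t+2) even has
-- period 2.
Bs3-period : ∀ m (ps : All (1 ≤_) (suc m ∷ 3 ∷ [])) τ → BetheWalk.ReturnsAt (suc m ∷ 3 ∷ []) ps 12 τ
Bs3-period m ps τ = record { D-return = DR ; U-return = UR }
  where
  open Traj τ
  open RS
  s = suc m
  e = nth (s ∷ 3 ∷ [])
  c = 2/ s
  open ThreeLeaves τ 0 refl refl
  W1 : W e 1 ≡ s
  W1 = ℕ.+-identityʳ s
  below : ∀ {x} → x < s → x < W e 1
  below {x} = subst (x <_) (sym W1)
  g D̄ T̄ : ℕ → ℚ
  g t = c *ℚ ∑ s (U t 1)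
  D̄ t = c *ℚ ∑ s (D t 1)
  T̄ t = c *ℚ ∑ s (T t)
  D+1 : ∀ t x → x < W e 1 → D (suc t) 1 x ≡ g t -ℚ U t 1 x
  D+1 t x x<W = D-step t 0 0 x z<s (subst (x <_) W1 x<W)
  D̄+1 : ∀ t → D̄ (1 + t) ≡ g t
  D̄+1 t = begin
    c *ℚ ∑ s (D (suc t) 1)                 ≡⟨ cong (c *ℚ_) (∑-cong s λ x x<s → D+1 t x (below x<s)) ⟩
    c *ℚ ∑ s (λ x → g t -ℚ U t 1 x)        ≡⟨ cong (c *ℚ_) (∑-outflow s (g t) (U t 1)) ⟩
    c *ℚ (ι s *ℚ g t -ℚ ∑ s (U t 1))
      ≡⟨ solve 4 (λ c i g u → c :* (i :* g :- u) := (c :* i) :* g :- c :* u) refl c (ι s) (g t) (∑ s (U t 1)) ⟩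
    (c *ℚ ι s) *ℚ g t -ℚ g t               ≡⟨ cong (λ z → z *ℚ g t -ℚ g t) (2/-inverse m) ⟩
    2ℚ *ℚ g t -ℚ g t                       ≡⟨ solve 1 (λ u → con 2ℚ :* u :- u := u) refl (g t) ⟩
    g t                                    ∎
    where open ≡-Reasoning
  mean : ∀ a b (h h₁ h₂ : ℕ → ℚ) → (∀ x → x < s → h x ≡ a *ℚ h₁ x +ℚ b *ℚ h₂ x) →
    c *ℚ ∑ s h ≡ a *ℚ (c *ℚ ∑ s h₁) +ℚ b *ℚ (c *ℚ ∑ s h₂)
  mean a b h h₁ h₂ eq = trans (cong (c *ℚ_) (trans (∑-cong s eq) (∑-lin s a b h₁ h₂)))
    (solve 5 (λ c a b x y → c :* (a :* x :+ b :* y) := a :* (c :* x) :+ b :* (c :* y)) refl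
        c a b (∑ s h₁) (∑ s h₂))
  g+1 : ∀ t → g (1 + t) ≡ ½ *ℚ T̄ t +ℚ (⊖ ½) *ℚ D̄ t
  g+1 t = mean ½ (⊖ ½) (U (suc t) 1) (T t) (D t 1) λ x x<s → U+1′ t x (below x<s)
  T̄+2 : ∀ t → T̄ (2 + t) ≡ ½ *ℚ T̄ t +ℚ 1½ *ℚ D̄ t
  T̄+2 t = mean ½ 1½ (T (2 + t)) (T t) (D t 1) λ x x<s → T+2′ t x (below x<s)
  g+3 : ∀ t → g (3 + t) ≡ D̄ t
  g+3 t = trans (g+1 (2 + t)) (trans (cong₂ (λ a b → ½ *ℚ a +ℚ (⊖ ½) *ℚ b) (T̄+2 t)
    (trans (D̄+1 (1 + t)) (g+1 t)))
    (solve 2 (λ T D → con ½ :* (con ½ :* T :+ con 1½ :* D) :+ con (⊖ ½) :* (con ½ :* T :+ con (⊖ ½) :* D) := D)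
      refl (T̄ t) (D̄ t)))
  g+4 : ∀ t → g (4 + t) ≡ g t
  g+4 t = trans (g+3 (1 + t)) (D̄+1 t)
  g-pair : ∀ t → g (7 + t) +ℚ g (9 + t) ≡ g (1 + t) +ℚ g (3 + t)
  g-pair t = trans (cong₂ _+ℚ_ (g+4 (3 + t)) (trans (g+4 (5 + t)) (g+4 (1 + t))))
    (ℚ.+-comm (g (3 + t)) (g (1 + t)))
  open Driven g D+1 g-pair
  beyond : ∀ m x → ¬ (x < W e (suc (suc (suc m))))
  beyond m x lt = ℕ.n≮0 (subst (x <_) (ℕ.*-zeroʳ (W e (suc (suc m)))) lt)
  DR : ∀ m x → x < W e (suc m) → D 12 (suc m) x ≡ D 0 (suc m) x
  DR zero          x x<W = D+12 0 x x<W
  DR (suc zero)    x x<W = leafD+12 0 x x<W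
  DR (suc (suc m)) x x<W = contradiction x<W (beyond m x)
  UR : ∀ m x → x < W e (suc m) → U 12 (suc m) x ≡ U 0 (suc m) x
  UR zero          x x<W = U+12 0 x (trans (g+4 8) (trans (g+4 4) (g+4 0))) x<W
  UR (suc zero)    x x<W = leafU+12 0 x x<W
  UR (suc (suc m)) x x<W = contradiction x<W (beyond m x)

-- The drive also contains the wave on the edge to the root, but this cancels in g(1+t) + g(3+t),
-- which equals two thirds of the total T̄ of the leaves. Summing `T+6` over both vertices gives
-- T̄(6+t) = 2 · 3/2 · 2/3 · T̄(t) - T̄(t) = T̄(t), so the pair condition holds.
B123-period : ∀ (ps : All (1 ≤_) (1 ∷ 2 ∷ 3 ∷ [])) τ → BetheWalk.ReturnsAt (1 ∷ 2 ∷ 3 ∷ []) ps 12 τ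
B123-period ps τ = record { D-return = DR ; U-return = UR }
  where
  open Traj τ
  open RS
  e = nth (1 ∷ 2 ∷ 3 ∷ [])
  open ThreeLeaves τ 1 refl refl
  g D̄ T̄ u : ℕ → ℚ
  g t = ⅔ *ℚ (∑ 2 (U t 2) +ℚ D t 1 0)
  D̄ t = ∑ 2 (D t 2)
  T̄ t = ∑ 2 (T t)
  u t = U t 1 0
  D1+1 : ∀ t → D (suc t) 1 0 ≡ u t
  D1+1 t = trans (D-step t 0 0 0 z<s z<s)
    (solve 1 (λ u → con (2/ 1) :* (u :+ con 0ℚ) :- u := u) refl (u t))
  u+1 : ∀ t → u (suc t) ≡ g t -ℚ D t 1 0
  u+1 t = U-step t 0 0 z<s
  D+1 : ∀ t x → x < W e 2 → D (suc t) 2 x ≡ g t -ℚ U t 2 x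
  D+1 t x x<2 = D-step t 1 0 x z<s x<2
  U̅+1 : ∀ t → ∑ 2 (U (suc t) 2) ≡ ½ *ℚ T̄ t +ℚ (⊖ ½) *ℚ D̄ t
  U̅+1 t = trans (∑-cong 2 (U+1′ t)) (∑-lin 2 ½ (⊖ ½) (T t) (D t 2))
  T̄+2 : ∀ t → T̄ (2 + t) ≡ ½ *ℚ T̄ t +ℚ 1½ *ℚ D̄ t
  T̄+2 t = trans (∑-cong 2 (T+2′ t)) (∑-lin 2 ½ 1½ (T t) (D t 2))
  D̄+1 : ∀ t → D̄ (1 + t) ≡ 2ℚ *ℚ g t -ℚ ∑ 2 (U t 2)
  D̄+1 t = trans (∑-cong 2 (D+1 t)) (∑-outflow 2 (g t) (U t 2))
  g+1 : ∀ t → g (1 + t) ≡ ⅔ *ℚ ((½ *ℚ T̄ t +ℚ (⊖ ½) *ℚ D̄ t) +ℚ u t)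
  g+1 t = cong₂ (λ a b → ⅔ *ℚ (a +ℚ b)) (U̅+1 t) (D1+1 t)
  D̄+2 : ∀ t → D̄ (2 + t) ≡ 2ℚ *ℚ g (1 + t) -ℚ (½ *ℚ T̄ t +ℚ (⊖ ½) *ℚ D̄ t)
  D̄+2 t = trans (D̄+1 (1 + t)) (cong (2ℚ *ℚ g (1 + t) -ℚ_) (U̅+1 t))
  u+2 : ∀ t → u (2 + t) ≡ g (1 + t) -ℚ u t
  u+2 t = trans (u+1 (1 + t)) (cong (g (1 + t) -ℚ_) (D1+1 t))
  pair : ∀ t → g (1 + t) +ℚ g (3 + t) ≡ ⅔ *ℚ T̄ t
  pair t = trans (cong₂ _+ℚ_ (g+1 t) (trans (g+1 (2 + t)) (trans
      (cong₂ (λ a b → ⅔ *ℚ ((½ *ℚ a +ℚ (⊖ ½) *ℚ b) +ℚ u (2 + t))) (T̄+2 t) (D̄+2 t))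
      (cong (λ z → ⅔ *ℚ ((½ *ℚ (½ *ℚ T̄ t +ℚ 1½ *ℚ D̄ t) +ℚ (⊖ ½) *ℚ
        (2ℚ *ℚ g (1 + t) -ℚ (½ *ℚ T̄ t +ℚ (⊖ ½) *ℚ D̄ t))) +ℚ z)) (u+2 t)))))
    (solve 4 (λ T D u g →
        con ⅔ :* ((con ½ :* T :+ con (⊖ ½) :* D) :+ u)
        :+ con ⅔ :* ((con ½ :* (con ½ :* T :+ con 1½ :* D)
             :+ con (⊖ ½) :* (con 2ℚ :* g :- (con ½ :* T :+ con (⊖ ½) :* D))) :+ (g :- u))
        := con ⅔ :* T) refl (T̄ t) (D̄ t) (u t) (g (1 + t)))
  D+2 : ∀ t x → x < W e 2 → D (2 + t) 2 x ≡ g (1 + t) +ℚ ½ *ℚ (D t 2 x -ℚ T t x)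
  D+2 t x x<W = trans (D+1 (suc t) x x<W) (trans (cong (g (1 + t) -ℚ_) (U+1 t x x<W))
      (solve 3 (λ T D g → g :- (con ½ :* (T :+ D) :- D) := g :+ con ½ :* (D :- T)) refl
          (T t x) (D t 2 x) (g (1 + t))))
  T̄+6 : ∀ t → T̄ (6 + t) ≡ T̄ t
  T̄+6 t = trans (∑-cong 2 λ x x<2 → Claw.T+6 (λ t → D t 2 x) (λ t → T t x) (λ t → U t 3 (x * 3 + 0)) g
    (λ t → f t x)
                    (λ t → refl) (λ t → D+2 t x x<2) (λ t → T+2 t x x<2) (λ t → leafU+2 t x 0 x<2 z<s) t)
    (trans (∑-outflow 2 (1½ *ℚ (g (1 + t) +ℚ g (3 + t))) (T t))
      (trans (cong (λ z → ι 2 *ℚ (1½ *ℚ z) -ℚ T̄ t) (pair t))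
        (solve 1 (λ T → con (ι 2) :* (con 1½ :* (con ⅔ :* T)) :- T := T) refl (T̄ t))))
  g-pair : ∀ t → g (7 + t) +ℚ g (9 + t) ≡ g (1 + t) +ℚ g (3 + t)
  g-pair t = trans (pair (6 + t)) (trans (cong (⅔ *ℚ_) (T̄+6 t)) (sym (pair t)))
  open Driven g D+1 g-pair hiding (D+2)
  D̄+12 : ∀ t → D̄ (12 + t) ≡ D̄ t
  D̄+12 t = ∑-cong 2 (D+12 t)
  g+1′ : ∀ t → g (1 + t) ≡ D (2 + t) 2 0 -ℚ ½ *ℚ (D t 2 0 -ℚ T t 0)
  g+1′ t = trans (solve 2 (λ g z → g := g :+ z :- z) refl (g (1 + t)) (½ *ℚ (D t 2 0 -ℚ T t 0)))
    (cong (_-ℚ ½ *ℚ (D t 2 0 -ℚ T t 0)) (sym (D+2 t 0 z<s)))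
  g+13 : ∀ t → g (13 + t) ≡ g (1 + t)
  g+13 t = trans (g+1′ (12 + t)) (trans
    (cong₂ _-ℚ_ (D+12 (2 + t) 0 z<s)
      (cong₂ (λ a b → ½ *ℚ (a -ℚ b)) (D+12 t 0 z<s) (T+12 t 0 z<s)))
    (sym (g+1′ t)))
  u≡ : ∀ t → u t ≡ 1½ *ℚ g (1 + t) -ℚ (½ *ℚ T̄ t +ℚ (⊖ ½) *ℚ D̄ t)
  u≡ t = trans (solve 2 (λ u z → u := con 1½ :* (con ⅔ :* (z :+ u)) :- z) refl
      (u t) (½ *ℚ T̄ t +ℚ (⊖ ½) *ℚ D̄ t))
    (cong (λ z → 1½ *ℚ z -ℚ (½ *ℚ T̄ t +ℚ (⊖ ½) *ℚ D̄ t)) (sym (g+1 t)))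
  u+12 : ∀ t → u (12 + t) ≡ u t
  u+12 t = trans (u≡ (12 + t)) (trans
    (cong₂ (λ a b → 1½ *ℚ a -ℚ b) (g+13 t)
      (cong₂ (λ a b → ½ *ℚ a +ℚ (⊖ ½) *ℚ b) (trans (T̄+6 (6 + t)) (T̄+6 t)) (D̄+12 t)))
    (sym (u≡ t)))
  -- The amplitudes leaving a vertex have the same mean as those arriving there.
  g≡ : ∀ t → g t ≡ ⅔ *ℚ (D̄ (1 + t) +ℚ u (1 + t))
  g≡ t = trans (solve 2 (λ s d → con ⅔ :* (s :+ d)
        := con ⅔ :* ((con 2ℚ :* (con ⅔ :* (s :+ d)) :- s) :+ (con ⅔ :* (s :+ d) :- d)))
                 refl (∑ 2 (U t 2)) (D t 1 0))
    (cong₂ (λ a b → ⅔ *ℚ (a +ℚ b)) (sym (D̄+1 t)) (sym (u+1 t)))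
  g+12 : ∀ t → g (12 + t) ≡ g t
  g+12 t = trans (g≡ (12 + t)) (trans (cong₂ (λ a b → ⅔ *ℚ (a +ℚ b)) (D̄+12 (1 + t)) (u+12 (1 + t)))
    (sym (g≡ t)))
  D1≡ : ∀ t → D t 1 0 ≡ g t -ℚ u (1 + t)
  D1≡ t = trans (solve 2 (λ d g → d := g :- (g :- d)) refl (D t 1 0) (g t)) (cong (g t -ℚ_) (sym (u+1 t)))
  DR : ∀ m x → x < W e (suc m) → D 12 (suc m) x ≡ D 0 (suc m) x
  DR zero zero _ = trans (D1≡ 12) (trans (cong₂ _-ℚ_ (g+12 0) (u+12 1)) (sym (D1≡ 0)))
  DR zero (suc x) (s≤s ())
  DR (suc zero) x x<W = D+12 0 x x<W
  DR (suc (suc zero)) x x<W = leafD+12 0 x x<W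
  DR (suc (suc (suc m))) x x<W = contradiction (subst (x <_) (ℕ.*-zeroʳ (W e (suc (suc (suc m))))) x<W) λ ()
  UR : ∀ m x → x < W e (suc m) → U 12 (suc m) x ≡ U 0 (suc m) x
  UR zero zero _ = u+12 0
  UR zero (suc x) (s≤s ())
  UR (suc zero) x x<W = U+12 0 x (g+12 0) x<W
  UR (suc (suc zero)) x x<W = leafU+12 0 x x<W
  UR (suc (suc (suc m))) x x<W = contradiction (subst (x <_) (ℕ.*-zeroʳ (W e (suc (suc (suc m))))) x<W) λ ()

-- Reduction to a line

-- The walk on a half line with levels 1, 2, ...: a wave meeting level 0 is reflected with
-- factor σ, and the level m ≥ 1 scatters as a vertex with w m children carrying equal amplitudes.
module Line (σ : ℚ) (w : ℕ → ℕ) (D₀ U₀ : ℕ → ℚ) where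

  D U out : ℕ → ℕ → ℚ
  D zero    m             = D₀ m
  -- Level 0 is a dummy: no value at it enters the values at the levels m ≥ 1.
  D (suc t) zero          = 0ℚ
  D (suc t) (suc zero)    = σ *ℚ U t 1
  D (suc t) (suc (suc m)) = out t (suc m) -ℚ U t (suc (suc m))
  U zero    m             = U₀ m
  U (suc t) m             = out t m -ℚ D t m
  out t m = 2/ (suc (w m)) *ℚ (ι (w m) *ℚ U t (suc m) +ℚ D t m)

quotient remainder : ℕ → ℕ → ℕ
quotient  y zero    = 0
quotient  y (suc n) = y / suc n
remainder y zero    = 0
remainder y (suc n) = y % suc n

quotient-unique : ∀ x n j → j < n → quotient (x * n + j) n ≡ x
quotient-unique x (suc n) j j<n = proj₁ (divMod-unique x (suc n) j j<n)

remainder-unique : ∀ x n j → j < n → remainder (x * n + j) n ≡ j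
remainder-unique x (suc n) j j<n = proj₂ (divMod-unique x (suc n) j j<n)

split-< : ∀ a b {y} → y < a * b → Σ ℕ λ x → Σ ℕ λ j → x < a × j < b × y ≡ x * b + j
split-< a zero {y} y< = contradiction (subst (y <_) (ℕ.*-zeroʳ a) y<) λ ()
split-< a (suc b) {y} y< = y / suc b , y % suc b , ℕ.m<n*o⇒m/o<n {y} {a} {suc b} y< , ℕ.m%n<n y (suc b) ,
  trans (ℕ.m≡m%n+[m/n]*n y (suc b)) (ℕ.+-comm (y % suc b) (y / suc b * suc b))

-- ε spreads a state of the line over the levels below level i of the tree.
record Profile (d : ℕ → ℕ) (i : ℕ) (σ : ℚ) : Set where
  field
    ε      : ℕ → ℕ → ℚ
    ε-root : ∀ m → ε (suc m) 0 ≡ 1ℚ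
    lifts  : (τ : Traj d) (D₀ U₀ : ℕ → ℚ) →
      let open Traj τ; open Line σ (λ m → d (m + i)) D₀ U₀ renaming (D to LD; U to LU) in
      (∀ l x → x < W d (suc l) → D 0 (suc l) x ≡ ε (suc l ∸ i) x *ℚ D₀ (suc l ∸ i)) →
      (∀ l x → x < W d (suc l) → U 0 (suc l) x ≡ ε (suc l ∸ i) x *ℚ U₀ (suc l ∸ i)) →
      ∀ t m x → x < W d (suc m + i) →
        D t (suc m + i) x ≡ ε (suc m) x *ℚ LD t (suc m) × U t (suc m + i) x ≡ ε (suc m) x *ℚ LU t (suc m)

module Lifting {d : ℕ → ℕ} (τ : Traj d) (i : ℕ) (σ : ℚ) (D₀ U₀ : ℕ → ℚ) (ε : ℕ → ℕ → ℚ)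
  (ε-const : ∀ m x j → x < W d (suc m + i) → j < d (suc m + i) →
             ε (suc (suc m)) (x * d (suc m + i) + j) ≡ ε (suc m) x) where
  open Traj τ
  open Line σ (λ m → d (m + i)) D₀ U₀ renaming (D to LD; U to LU)
  open RS

  Lifted : ℕ → Set
  Lifted t = ∀ m x → x < W d (suc m + i) →
    D t (suc m + i) x ≡ ε (suc m) x *ℚ LD t (suc m) × U t (suc m + i) x ≡ ε (suc m) x *ℚ LU t (suc m)

  outflow-lift : ∀ t → Lifted t → ∀ m x → x < W d (suc m + i) →
    outflow d (D t) (U t) (suc m + i) x ≡ ε (suc m) x *ℚ out t (suc m)
  outflow-lift t h m x x<W = begin
    c *ℚ (∑ n (λ j → U t (suc l) (x * n + j)) +ℚ D t l x)
      ≡⟨ cong₂ (λ a b → c *ℚ (a +ℚ b)) (trans (∑-cong n child) (∑-const n (η *ℚ u))) (proj₁ (h m x x<W)) ⟩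
    c *ℚ (ι n *ℚ (η *ℚ u) +ℚ η *ℚ v)
      ≡⟨ solve 5 (λ c n e u v → c :* (n :* (e :* u) :+ e :* v) := e :* (c :* (n :* u :+ v))) refl
          c (ι n) η u v ⟩
    η *ℚ (c *ℚ (ι n *ℚ u +ℚ v)) ∎
    where
    open ≡-Reasoning
    l = suc m + i
    n = d l
    c = 2/ (suc n)
    η = ε (suc m) x
    u = LU t (suc (suc m))
    v = LD t (suc m)
    child : ∀ j → j < n → U t (suc l) (x * n + j) ≡ η *ℚ u
    child j j<n = trans (proj₂ (h (suc m) (x * n + j) (next-bound n x<W j<n)))
      (cong (_*ℚ u) (ε-const m x j x<W j<n))

  -- A wave u coming back at the top must leave as σ u. Since the outgoing wave is the outflow minus
  -- u, the condition on level i is that the outflow be (1 + σ) u: twice u for σ = 1, nothing for σ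
  -- = -1.
  lift-step : ∀ t → Lifted t →
    (∀ x j → x < W d i → j < d i → outflow d (D t) (U t) i x ≡ ε 1 (x * d i + j) *ℚ ((1ℚ +ℚ σ) *ℚ LU t 1)) →
    Lifted (suc t)
  lift-step t h boundary m x x<W = down m x x<W , up
    where
    up : U (suc t) (suc m + i) x ≡ ε (suc m) x *ℚ LU (suc t) (suc m)
    up = trans (U-step t (m + i) x x<W)
      (trans (cong₂ _-ℚ_ (outflow-lift t h m x x<W) (proj₁ (h m x x<W)))
        (solve 3 (λ e a b → e :* a :- e :* b := e :* (a :- b)) refl
            (ε (suc m) x) (out t (suc m)) (LD t (suc m))))
    down : ∀ m x → x < W d (suc m + i) → D (suc t) (suc m + i) x ≡ ε (suc m) x *ℚ LD (suc t) (suc m)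
    down zero y y<W with split-< (W d i) (d i) y<W
    ... | x , j , x<W , j<n , refl = trans (D-step t i x j x<W j<n)
      (trans (cong₂ _-ℚ_ (boundary x j x<W j<n) (proj₂ (h 0 y y<W)))
        (solve 3 (λ e s u → e :* ((con 1ℚ :+ s) :* u) :- e :* u := e :* (s :* u)) refl (ε 1 y) σ (LU t 1)))
    down (suc m) y y<W with split-< (W d (suc m + i)) (d (suc m + i)) y<W
    ... | x , j , x<W , j<n , refl = trans (D-step t (suc m + i) x j x<W j<n)
      (trans (cong₂ _-ℚ_ (trans (outflow-lift t h m x x<W)
        (cong (_*ℚ out t (suc m)) (sym (ε-const m x j x<W j<n))))
                         (proj₂ (h (suc m) y y<W)))
        (solve 3 (λ e a b → e :* a :- e :* b := e :* (a :- b)) refl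
          (ε (suc (suc m)) y) (out t (suc m)) (LU t (suc (suc m)))))

-- If all waves arriving at the root equal u, the outflow is 2/d(0) · d(0) u = 2u, so each edge gets
-- back 2u - u = u, whatever the degree of the root.
neumann : ∀ d → Profile d 0 1ℚ
neumann d = record { ε = λ _ _ → 1ℚ ; ε-root = λ _ → refl ; lifts = lifts }
  where
  lifts : _
  lifts τ D₀ U₀ D-init U-init = go
    where
    open Traj τ
    open Lifting τ 0 1ℚ D₀ U₀ (λ _ _ → 1ℚ) (λ _ _ _ _ _ → refl)
    open Line 1ℚ (λ m → d (m + 0)) D₀ U₀ renaming (D to LD; U to LU)
    boundary : ∀ t → Lifted t → ∀ x j → x < 1 → j < d 0 →
      outflow d (D t) (U t) 0 x ≡ 1ℚ *ℚ ((1ℚ +ℚ 1ℚ) *ℚ LU t 1)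
    boundary t h x j x<1 j<n with d 0 in d≡
    ... | suc n = begin
      2/ (suc n) *ℚ ∑ (suc n) (λ j → U t 1 (x * suc n + j))
        ≡⟨ cong (2/ (suc n) *ℚ_) (trans (∑-cong (suc n) child) (∑-const (suc n) (1ℚ *ℚ LU t 1))) ⟩
      2/ (suc n) *ℚ (ι (suc n) *ℚ (1ℚ *ℚ LU t 1))
        ≡⟨ sym (ℚ.*-assoc (2/ (suc n)) (ι (suc n)) (1ℚ *ℚ LU t 1)) ⟩
      (2/ (suc n) *ℚ ι (suc n)) *ℚ (1ℚ *ℚ LU t 1)
        ≡⟨ cong (_*ℚ (1ℚ *ℚ LU t 1)) (2/-inverse n) ⟩
      2ℚ *ℚ (1ℚ *ℚ LU t 1)
        ≡⟨ RS.solve 1 (λ u → RS.con 2ℚ RS.:* (RS.con 1ℚ RS.:* u)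
              RS.:= RS.con 1ℚ RS.:* (RS.con (1ℚ +ℚ 1ℚ) RS.:* u)) refl (LU t 1) ⟩
      1ℚ *ℚ ((1ℚ +ℚ 1ℚ) *ℚ LU t 1) ∎
      where
      open ≡-Reasoning
      child : ∀ j → j < suc n → U t 1 (x * suc n + j) ≡ 1ℚ *ℚ LU t 1
      child j j<n = proj₂ (h 0 (x * suc n + j)
        (subst (λ z → x * suc n + j < 1 * z) (sym d≡) (next-bound (suc n) x<1 j<n)))
    go : ∀ t → Lifted t
    go zero    m x x<W = level D₀ (D-init (m + 0) x x<W) , level U₀ (U-init (m + 0) x x<W)
      where
      level : ∀ {a} (f : ℕ → ℚ) → a ≡ 1ℚ *ℚ f (suc m + 0) → a ≡ 1ℚ *ℚ f (suc m)
      level f eq = trans eq (cong (λ n → 1ℚ *ℚ f (suc n)) (ℕ.+-identityʳ m))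
    go (suc t) = lift-step t (go t) (boundary t (go t))

sgn : ℕ → ℚ
sgn zero          = 1ℚ
sgn (suc zero)    = ⊖ 1ℚ
sgn (suc (suc j)) = 0ℚ

-- Opposite amplitudes on the first two children of every vertex of level i cancel there,
-- so that nothing passes to the upper levels.
dirichlet : ∀ d i → 2 ≤ d i → Profile d i (⊖ 1ℚ)
dirichlet d i 2≤d = record { ε = ε ; ε-root = ε-root ; lifts = lifts }
  where
  ε : ℕ → ℕ → ℚ
  -- In the initial state `suc l ∸ i` truncates to 0 at every tree level up to i, so this value
  -- extinguishes everything above the branching.
  ε zero          y = 0ℚ
  ε (suc zero)    y = sgn (remainder y (d i))
  -- Every deeper vertex inherits the sign of its ancestor in level i + 1.
  ε (suc (suc m)) y = ε (suc m) (quotient y (d (suc m + i)))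
  quotient-0 : ∀ n → quotient 0 n ≡ 0
  quotient-0 zero    = refl
  quotient-0 (suc n) = ℕ.0/n≡0 (suc n)
  remainder-0 : ∀ n → remainder 0 n ≡ 0
  remainder-0 zero    = refl
  remainder-0 (suc n) = remainder-unique 0 (suc n) 0 z<s
  ε-root : ∀ m → ε (suc m) 0 ≡ 1ℚ
  ε-root zero    = cong sgn (remainder-0 (d i))
  ε-root (suc m) = trans (cong (ε (suc m)) (quotient-0 (d (suc m + i)))) (ε-root m)
  ε-const : ∀ m x j → x < W d (suc m + i) → j < d (suc m + i) →
            ε (suc (suc m)) (x * d (suc m + i) + j) ≡ ε (suc m) x
  ε-const m x j _ j<n = cong (ε (suc m)) (quotient-unique x (d (suc m + i)) j j<n)
  ∑sgn : ∀ n → 2 ≤ n → ∑ n sgn ≡ 0ℚ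
  ∑sgn (suc (suc n)) (s≤s (s≤s _)) = cong (λ z → 1ℚ +ℚ ((⊖ 1ℚ) +ℚ z)) (∑-ε n λ _ _ → refl)
  cancel : ∀ x → ∑ (d i) (λ j → ε 1 (x * d i + j)) ≡ 0ℚ
  cancel x = trans (∑-cong (d i) λ j j<n → cong sgn (remainder-unique x (d i) j j<n)) (∑sgn (d i) 2≤d)
  lifts : _
  lifts τ D₀ U₀ D-init U-init t = proj₂ (go t)
    where
    open Traj τ
    open Lifting τ i (⊖ 1ℚ) D₀ U₀ ε ε-const
    open Line (⊖ 1ℚ) (λ m → d (m + i)) D₀ U₀ renaming (D to LD; U to LU)
    Above : ℕ → Set
    Above t = ∀ l x → suc l ≤ i → x < W d (suc l) → D t (suc l) x ≡ 0ℚ × U t (suc l) x ≡ 0ℚ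
    children-zero : ∀ t → Above t → Lifted t → ∀ l x → l ≤ i → x < W d l →
      ∑ (d l) (λ j → U t (suc l) (x * d l + j)) ≡ 0ℚ
    children-zero t a h l x l≤i x<W with l ≟ i
    ... | yes refl = trans (∑-cong (d l) λ j j<n → trans (proj₂ (h 0 (x * d l + j) (next-bound (d l) x<W j<n)))
                             (ℚ.*-comm (ε 1 (x * d l + j)) (LU t 1)))
      (trans (∑-* (d l) (LU t 1) (λ j → ε 1 (x * d l + j)))
        (trans (cong (LU t 1 *ℚ_) (cancel x)) (ℚ.*-zeroʳ (LU t 1))))
    ... | no l≢i = ∑-ε (d l) λ j j<n → proj₂ (a l (x * d l + j) (ℕ.≤∧≢⇒< l≤i l≢i) (next-bound (d l) x<W j<n))
    outflow-zero : ∀ t → Above t → Lifted t → ∀ l x → l ≤ i → x < W d l → outflow d (D t) (U t) l x ≡ 0ℚ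
    outflow-zero t a h zero    x l≤i x<W =
      trans (cong (2/ (d 0) *ℚ_) (children-zero t a h 0 x l≤i x<W)) (ℚ.*-zeroʳ (2/ (d 0)))
    outflow-zero t a h (suc l) x l≤i x<W =
      trans (cong₂ (λ p q → 2/ (suc (d (suc l))) *ℚ (p +ℚ q)) (children-zero t a h (suc l) x l≤i x<W)
        (proj₁ (a l x l≤i x<W)))
            (ℚ.*-zeroʳ (2/ (suc (d (suc l)))))
    go : ∀ t → Above t × Lifted t
    go zero = above , lifted
      where
      above : Above 0
      above l x l<i x<W = zeroed D₀ (D-init l x x<W) , zeroed U₀ (U-init l x x<W)
        where
        zeroed : ∀ {a} (f : ℕ → ℚ) → a ≡ ε (suc l ∸ i) x *ℚ f (suc l ∸ i) → a ≡ 0ℚ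
        zeroed f eq rewrite ℕ.m≤n⇒m∸n≡0 l<i = trans eq (ℚ.*-zeroˡ (f 0))
      lifted : Lifted 0
      lifted m x x<W = level D₀ (D-init (m + i) x x<W) , level U₀ (U-init (m + i) x x<W)
        where
        level : ∀ {a} (f : ℕ → ℚ) → a ≡ ε (suc m + i ∸ i) x *ℚ f (suc m + i ∸ i) → a ≡ ε (suc m) x *ℚ f (suc m)
        level f eq = trans eq (cong (λ n → ε n x *ℚ f n) (ℕ.m+n∸n≡m (suc m) i))
    go (suc t) with go t
    ... | a , h = above , lift-step t h (λ x j x<W j<n → trans (outflow-zero t a h i x ℕ.≤-refl x<W)
                    (sym (trans (cong (ε 1 (x * d i + j) *ℚ_) (ℚ.*-zeroˡ (LU t 1)))
                      (ℚ.*-zeroʳ (ε 1 (x * d i + j))))))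
      where
      above : Above (suc t)
      above l y l<i y<W with split-< (W d l) (d l) y<W
      ... | x , j , x<W , j<n , refl =
        trans (D-step t l x j x<W j<n) (cong₂ _-ℚ_ (outflow-zero t a h l x (ℕ.<⇒≤ l<i) x<W)
          (proj₂ (a l y l<i y<W))) ,
        trans (U-step t l y y<W) (cong₂ _-ℚ_ (outflow-zero t a h (suc l) y l<i y<W) (proj₁ (a l y l<i y<W)))

W-positive : ∀ ds → All (1 ≤_) ds → ∀ m → m ≤ length ds → 1 ≤ W (nth ds) m
W-positive ds ps zero    _ = z<s
W-positive ds ps (suc m) m<n = ℕ.*-mono-≤ (W-positive ds ps m (ℕ.<⇒≤ m<n)) (nth-positive ds ps m m<n)
  where
  nth-positive : ∀ ds → All (1 ≤_) ds → ∀ m → m < length ds → 1 ≤ nth ds m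
  nth-positive (d ∷ ds) (p ∷ ps) zero    _         = p
  nth-positive (d ∷ ds) (p ∷ ps) (suc m) (s≤s m<n) = nth-positive ds ps m m<n

module _ (ds : List ℕ) (ps : All (1 ≤_) ds) {i σ} (P : Profile (nth ds) i σ) (k : ℕ) (h : UpowIsId (B ds) k)
         (D₀ U₀ : ℕ → ℚ) where
  open Profile P
  open Line σ (λ m → nth ds (m + i)) D₀ U₀

  -- The profile is 1 at offset 0, so the amplitudes of the tree there are exactly those of the
  -- line.
  line-periodic : ∀ t m → m + i < length ds → D (k + t) (suc m) ≡ D t (suc m) × U (k + t) (suc m) ≡ U t (suc m)
  line-periodic t m m+i<n =
    read (proj₁ (at (k + t))) (proj₁ (at t)) (τ.D-period t (m + i) 0 0<W) ,
    read (proj₂ (at (k + t))) (proj₂ (at t)) (τ.U-period t (m + i) 0 0<W)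
    where
    module τ = BetheWalk.PeriodicTrajectory
      (BetheWalk.periodicTrajectory ds ps k h (λ l x → ε (l ∸ i) x *ℚ D₀ (l ∸ i))
        (λ l x → ε (l ∸ i) x *ℚ U₀ (l ∸ i)))
    0<W : 0 < W (nth ds) (suc m + i)
    0<W = W-positive ds ps (suc m + i) m+i<n
    at : ∀ t →
      τ.D t (suc m + i) 0 ≡ ε (suc m) 0 *ℚ D t (suc m) × τ.U t (suc m + i) 0 ≡ ε (suc m) 0 *ℚ U t (suc m)
    at t = lifts τ.traj D₀ U₀ τ.D-init τ.U-init t m 0 0<W
    unit : ∀ z → ε (suc m) 0 *ℚ z ≡ z
    unit z = trans (cong (_*ℚ z) (ε-root m)) (ℚ.*-identityˡ z)
    read : ∀ {a a′ z z′} → a ≡ ε (suc m) 0 *ℚ z → a′ ≡ ε (suc m) 0 *ℚ z′ → a ≡ a′ → z ≡ z′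
    read {z = z} {z′} p q r = trans (sym (unit z)) (trans (sym p) (trans r (trans q (unit z′))))

-- Minimality of the periods

module _ (σ : ℚ) (w : ℕ → ℕ) where
  open Line σ w (λ _ → 0ℚ) (λ _ → 0ℚ)
  line-zero : ∀ t m → D t m ≡ 0ℚ × U t m ≡ 0ℚ
  line-zero zero    m = refl , refl
  line-zero (suc t) m = down m , cong₂ _-ℚ_ (out-zero m) (proj₁ (line-zero t m))
    where
    out-zero : ∀ m → out t m ≡ 0ℚ
    out-zero m = trans (cong₂ (λ u v → 2/ (suc (w m)) *ℚ (ι (w m) *ℚ u +ℚ v)) (proj₂ (line-zero t (suc m)))
      (proj₁ (line-zero t m)))
      (RS.solve 2 (λ a b → a RS.:* (b RS.:* RS.con 0ℚ RS.:+ RS.con 0ℚ) RS.:= RS.con 0ℚ) refl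
          (2/ (suc (w m))) (ι (w m)))
    down : ∀ m → D (suc t) m ≡ 0ℚ
    down zero          = refl
    down (suc zero)    = trans (cong (σ *ℚ_) (proj₂ (line-zero t 1))) (ℚ.*-zeroʳ σ)
    down (suc (suc m)) = cong₂ _-ℚ_ (out-zero (suc m)) (proj₂ (line-zero t (suc (suc m))))

δ₁ : ℕ → ℚ
δ₁ (suc zero) = 1ℚ
δ₁ _          = 0ℚ

δ₁-off : ∀ {m} → m ≢ 1 → δ₁ m ≡ 0ℚ
δ₁-off {zero}        _  = refl
δ₁-off {suc zero}    ne = contradiction refl ne
δ₁-off {suc (suc m)} _  = refl

module _ (k : ℕ) (e : List ℕ) (ps : All (1 ≤_) e) {i σ} (P : Profile (nth e) i σ) (i<n : i < length e) (p : ℕ)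
         (not-earlier : ∀ q → 1 ≤ q → q < p → Line.D σ (λ m → nth e (m + i)) δ₁ (λ _ → 0ℚ) q 1 ≢ 1ℚ) where
  private
    K = suc k
    d = nth (expand k e)
    w = nth e
    open Profile P

  -- The test state has waves only at the lower ends of the subdivided edges below level i, spread
  -- by the profile. If j = qK, sampling gives the line of `e` started from `δ₁`, which does not
  -- return for q < p. If j has another residue, the sampled walk of that phase starts from zero and
  -- stays zero, whereas the test state has amplitude 1.
  expand-not-earlier : ∀ j → 1 ≤ j → j < p * K → ¬ UpowIsId (B (expand k e)) j
  expand-not-earlier j 1≤j j<pK h = cases (j % K) (j / K) (ℕ.m%n<n j K) (ℕ.m≡m%n+[m/n]*n j K)
    where
    D₀ : LevelState
    D₀ l x = if l ≡ᵇ suc i * K then ε 1 x else 0ℚ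
    module τ = BetheWalk.PeriodicTrajectory
      (BetheWalk.periodicTrajectory (expand k e) (expand-positive k e ps) j h D₀ (λ _ _ → 0ℚ))
    open Expansion k e
    0<W : 0 < W w (suc i)
    0<W = W-positive e ps (suc i) i<n
    inside : ∀ l a {x} → a ≤ k → x < W w (suc l) → x < W d (suc a + l * K)
    inside l a {x} a≤k = subst (x <_) (sym (W-inner l a a≤k))
    U-start : ∀ r → r ≤ k → ∀ l x → x < W w (suc l) → arrivalU τ.traj r 0 (suc l) x ≡ 0ℚ
    U-start r r≤k l x x<W = trans (transit-U τ.traj r 0 l x r≤k x<W)
      (τ.U-init (r + l * K) x (inside l r r≤k x<W))
    returned : τ.D j (suc i * K) 0 ≡ 1ℚ
    returned = trans (cong (λ t → τ.D t (suc i * K) 0) (sym (ℕ.+-identityʳ j)))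
      (trans (τ.D-period 0 (k + i * K) 0 (inside i k ℕ.≤-refl 0<W))
        (trans (τ.D-init (k + i * K) 0 (inside i k ℕ.≤-refl 0<W))
          (trans (cong (λ b → if b then ε 1 0 else 0ℚ) (≡ᵇ-true {suc i * K} refl)) (ε-root 0))))
    cases : ∀ r q → r < K → j ≡ r + q * K → ⊥
    cases zero q _ refl = not-earlier q 1≤q (ℕ.*-cancelʳ-< K q p j<pK) (begin
      Line.D σ (λ m → w (m + i)) δ₁ (λ _ → 0ℚ) q 1
        ≡⟨ sym (trans (cong (_*ℚ Line.D σ (λ m → w (m + i)) δ₁ (λ _ → 0ℚ) q 1) (ε-root 0)) (ℚ.*-identityˡ _)) ⟩
      ε 1 0 *ℚ Line.D σ (λ m → w (m + i)) δ₁ (λ _ → 0ℚ) q 1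
        ≡⟨ sym (proj₁ (lifts (arrival τ.traj 0) δ₁ (λ _ → 0ℚ) D-start
                  (λ l x x<W → trans (U-start 0 z≤n l x x<W) (sym (ℚ.*-zeroʳ (ε (suc l ∸ i) x)))) q 0 0 0<W)) ⟩
      τ.D (q * K) (suc i * K) 0
        ≡⟨ returned ⟩
      1ℚ ∎)
      where
      open ≡-Reasoning
      1≤q : 1 ≤ q
      1≤q = ℕ.n≢0⇒n>0 λ { refl → contradiction 1≤j λ () }
      D-start : ∀ l x → x < W w (suc l) → arrivalD τ.traj 0 0 (suc l) x ≡ ε (suc l ∸ i) x *ℚ δ₁ (suc l ∸ i)
      D-start l x x<W = trans (τ.D-init (k + l * K) x (inside l k ℕ.≤-refl x<W)) eq
        where
        off : ∀ l → suc l ∸ i ≡ 1 → l ≡ i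
        off l eq = ℕ.suc-injective (trans (sym (ℕ.m∸n+n≡m {suc l} {i}
          (ℕ.<⇒≤ (ℕ.m∸n≢0⇒n<m λ z → contradiction (trans (sym eq) z) λ ())))) (cong (_+ i) eq))
        eq : D₀ (suc l * K) x ≡ ε (suc l ∸ i) x *ℚ δ₁ (suc l ∸ i)
        eq with l ≟ i
        ... | yes refl rewrite ≡ᵇ-true {suc l * K} refl | ℕ.m+n∸n≡m 1 l = sym (ℚ.*-identityʳ (ε 1 x))
        ... | no l≢i rewrite ≡ᵇ-false {suc l * K} {suc i * K}
          (l≢i ∘ ℕ.suc-injective ∘ ℕ.*-cancelʳ-≡ (suc l) (suc i) K)
          | δ₁-off {suc l ∸ i} (λ eq → l≢i (off l eq)) = sym (ℚ.*-zeroʳ (ε (suc l ∸ i) x))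
    cases (suc r) q (s≤s r<k) j≡ = ℚ-0≢1 (begin
      0ℚ
        ≡⟨ sym (trans (cong (ε 1 0 *ℚ_) (proj₁ (line-zero σ (λ m → w (m + i)) q 1))) (ℚ.*-zeroʳ (ε 1 0))) ⟩
      ε 1 0 *ℚ Line.D σ (λ m → w (m + i)) (λ _ → 0ℚ) (λ _ → 0ℚ) q 1
        ≡⟨ sym (proj₁ (lifts (arrival τ.traj (suc r)) (λ _ → 0ℚ) (λ _ → 0ℚ)
             (λ l x x<W → trans (D-start l x x<W) (sym (ℚ.*-zeroʳ (ε (suc l ∸ i) x))))
             (λ l x x<W → trans (U-start (suc r) r<k l x x<W) (sym (ℚ.*-zeroʳ (ε (suc l ∸ i) x)))) q 0 0 0<W)) ⟩
      τ.D (suc r + q * K) (suc i * K) 0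
        ≡⟨ cong (λ t → τ.D t (suc i * K) 0) (sym j≡) ⟩
      τ.D j (suc i * K) 0
        ≡⟨ returned ⟩
      1ℚ ∎)
      where
      open ≡-Reasoning
      ℚ-0≢1 : 0ℚ ≢ 1ℚ
      ℚ-0≢1 ()
      a = k ∸ suc r
      a<k : suc a ≤ k
      a<k = ℕ.≤-trans (ℕ.≤-reflexive (sym (ℕ.+-∸-assoc 1 r<k))) (ℕ.m∸n≤m k r)
      off : ∀ l → suc a + l * K ≢ suc i * K
      off l eq = contradiction (begin
        suc a               ≡⟨ sym (ℕ.m<n⇒m%n≡m (s≤s a<k)) ⟩
        suc a % K           ≡⟨ sym (ℕ.[m+kn]%n≡m%n (suc a) l K) ⟩
        (suc a + l * K) % K ≡⟨ cong (_% K) eq ⟩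
        (suc i * K) % K     ≡⟨ ℕ.m*n%n≡0 (suc i) K ⟩
        0                   ∎) λ ()
      D-start : ∀ l x → x < W w (suc l) → arrivalD τ.traj (suc r) 0 (suc l) x ≡ 0ℚ
      D-start l x x<W = begin
        τ.D (suc r + 0) (suc l * K) x
          ≡⟨ cong (λ b → τ.D (suc r + 0) (suc b + l * K) x) (sym (ℕ.m+[n∸m]≡n r<k)) ⟩
        τ.D (suc r + 0) (suc (suc r + a) + l * K) x
          ≡⟨ transit-D τ.traj (suc r) 0 l a x (ℕ.≤-reflexive (ℕ.m+[n∸m]≡n r<k)) x<W ⟩
        τ.D 0 (suc a + l * K) x
          ≡⟨ τ.D-init (a + l * K) x (inside l a (ℕ.<⇒≤ a<k) x<W) ⟩
        D₀ (suc a + l * K) x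
          ≡⟨ cong (λ b → if b then ε 1 x else 0ℚ) (≡ᵇ-false (off l)) ⟩
        0ℚ ∎

expand-HasPeriod : ∀ k e (ps : All (1 ≤_) e) {i σ} (P : Profile (nth e) i σ) → i < length e → ∀ p → 1 ≤ p →
  (∀ τ → BetheWalk.ReturnsAt e ps p τ) →
  (∀ q → 1 ≤ q → q < p → Line.D σ (λ m → nth e (m + i)) δ₁ (λ _ → 0ℚ) q 1 ≢ 1ℚ) →
  HasPeriod (B (expand k e)) (p * suc k)
expand-HasPeriod k e ps P i<n p 1≤p returns not-earlier =
  ℕ.*-mono-≤ 1≤p z<s ,
  BetheWalk.returns⇒UpowIsId (expand k e) (expand-positive k e ps) (p * suc k)
    (Expansion.expand-returns k e p ps returns) ,
  expand-not-earlier k e ps P i<n p not-earlier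

-- A root with a single child carries no opposite states, so the test uses the states that depend on
-- the level only.
ones-HasPeriod : ∀ k → HasPeriod (B (expand k (1 ∷ []))) (2 * suc k)
ones-HasPeriod k = expand-HasPeriod k (1 ∷ []) ps (neumann (nth (1 ∷ []))) z<s 2 z<s (one-period ps) early
  where
  ps : All (1 ≤_) (1 ∷ [])
  ps = z<s ∷ []
  early : ∀ q → 1 ≤ q → q < 2 → Line.D 1ℚ (λ m → nth (1 ∷ []) (m + 0)) δ₁ (λ _ → 0ℚ) q 1 ≢ 1ℚ
  early 1 _ _ ()
  early (suc (suc q)) _ (s≤s (s≤s ()))

star-HasPeriod : ∀ k m → HasPeriod (B (expand k (2 + m ∷ []))) (4 * suc k)
star-HasPeriod k m =
  expand-HasPeriod k e ps (dirichlet (nth e) 0 (s≤s z<s)) z<s 4 z<s (star-period (suc m) ps) early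
  where
  e = 2 + m ∷ []
  ps : All (1 ≤_) e
  ps = z<s ∷ []
  early : ∀ q → 1 ≤ q → q < 4 → Line.D (⊖ 1ℚ) (λ m → nth e (m + 0)) δ₁ (λ _ → 0ℚ) q 1 ≢ 1ℚ
  early 1 _ _ ()
  early 2 _ _ ()
  early 3 _ _ ()
  early (suc (suc (suc (suc q)))) _ (s≤s (s≤s (s≤s (s≤s ()))))

module _ (w : ℕ → ℕ) (w1 : w 1 ≡ 3) (w2 : w 2 ≡ 0) where
  open Line (⊖ 1ℚ) w δ₁ (λ _ → 0ℚ)

  private
    out1 : ∀ t → out t 1 ≡ ½ *ℚ (ι 3 *ℚ U t 2 +ℚ D t 1)
    out1 t = cong (λ n → 2/ (suc n) *ℚ (ι n *ℚ U t 2 +ℚ D t 1)) w1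
    U2+1 : ∀ t → U (suc t) 2 ≡ D t 2
    U2+1 t = trans (cong (λ n → 2/ (suc n) *ℚ (ι n *ℚ U t 3 +ℚ D t 2) -ℚ D t 2) w2)
      (RS.solve 2 (λ u v → RS.con 2ℚ RS.:* (RS.con 0ℚ RS.:* u RS.:+ v) RS.:- v RS.:= v) refl (U t 3) (D t 2))
    D1+2 : ∀ t → D (2 + t) 1 ≡ ½ *ℚ (D t 1 -ℚ ι 3 *ℚ U t 2)
    D1+2 t = trans (cong (λ z → ⊖ 1ℚ *ℚ (z -ℚ D t 1)) (out1 t))
      (RS.solve 2 (λ u d → RS.con (⊖ 1ℚ) RS.:* (RS.con ½ RS.:* (RS.con (ι 3) RS.:* u RS.:+ d) RS.:- d)
                 RS.:= RS.con ½ RS.:* (d RS.:- RS.con (ι 3) RS.:* u)) refl (U t 2) (D t 1))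
    U2+2 : ∀ t → U (2 + t) 2 ≡ ½ *ℚ (ι 3 *ℚ U t 2 +ℚ D t 1) -ℚ U t 2
    U2+2 t = trans (U2+1 (suc t)) (cong (_-ℚ U t 2) (out1 t))

  -- Opposite states cancel at the vertex above, so the claw runs without a drive and the recurrence
  -- with the twelfth cyclotomic polynomial is homogeneous.
  claw-line-rec : ∀ t → D (4 + t) 1 ≡ D (2 + t) 1 -ℚ D t 1
  claw-line-rec t = trans (D1+2 (2 + t)) (trans (cong₂ (λ a b → ½ *ℚ (a -ℚ ι 3 *ℚ b)) (D1+2 t) (U2+2 t))
    (trans (RS.solve 2 (λ u d → RS.con ½ RS.:* (RS.con ½ RS.:* (d RS.:- RS.con (ι 3) RS.:* u)
              RS.:- RS.con (ι 3) RS.:* (RS.con ½ RS.:* (RS.con (ι 3) RS.:* u RS.:+ d) RS.:- u))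
            RS.:= RS.con ½ RS.:* (d RS.:- RS.con (ι 3) RS.:* u) RS.:- d) refl (U t 2) (D t 1))
      (cong (_-ℚ D t 1) (sym (D1+2 t)))))

  claw-line-early : ∀ q → 1 ≤ q → q < 12 → D q 1 ≢ 1ℚ
  claw-line-early q 1≤q q<12 eq = check q 1≤q q<12 (trans (sym (table q)) eq)
    where
    -- Zero at odd t and cos(πt/6) at even t, so the value 1 first recurs at t = 12.
    value : ℕ → ℚ
    value 0 = 1ℚ
    value 1 = 0ℚ
    value 2 = ½
    value 3 = 0ℚ
    value (suc (suc (suc (suc t)))) = value (suc (suc t)) -ℚ value t
    table : ∀ t → D t 1 ≡ value t
    table 0 = refl
    table 1 = refl
    table 2 = D1+2 0
    table 3 = trans (D1+2 1) (cong (λ z → ½ *ℚ (0ℚ -ℚ ι 3 *ℚ z)) (U2+1 0))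
    table (suc (suc (suc (suc t)))) = trans (claw-line-rec t) (cong₂ _-ℚ_ (table (suc (suc t))) (table t))
    check : ∀ q → 1 ≤ q → q < 12 → value q ≢ 1ℚ
    check 1 _ _ ()
    check 2 _ _ ()
    check 3 _ _ ()
    check 4 _ _ ()
    check 5 _ _ ()
    check 6 _ _ ()
    check 7 _ _ ()
    check 8 _ _ ()
    check 9 _ _ ()
    check 10 _ _ ()
    check 11 _ _ ()
    check (suc (suc (suc (suc (suc (suc (suc (suc (suc (suc (suc (suc q)))))))))))) _
      (s≤s (s≤s (s≤s (s≤s (s≤s (s≤s (s≤s (s≤s (s≤s (s≤s (s≤s (s≤s ()))))))))))))

Bs3-HasPeriod : ∀ k m → HasPeriod (B (expand k (2 + m ∷ 3 ∷ []))) (12 * suc k)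
Bs3-HasPeriod k m =
  expand-HasPeriod k e ps (dirichlet (nth e) 0 (s≤s z<s)) z<s 12 z<s (Bs3-period (suc m) ps)
    (claw-line-early (λ m → nth e (m + 0)) refl refl)
  where
  e = 2 + m ∷ 3 ∷ []
  ps : All (1 ≤_) e
  ps = z<s ∷ z<s ∷ []

B123-HasPeriod : ∀ k → HasPeriod (B (expand k (1 ∷ 2 ∷ 3 ∷ []))) (12 * suc k)
B123-HasPeriod k =
  expand-HasPeriod k e ps (dirichlet (nth e) 1 (s≤s z<s)) (s≤s z<s) 12 z<s (B123-period ps)
    (claw-line-early (λ m → nth e (m + 1)) refl refl)
  where
  e = 1 ∷ 2 ∷ 3 ∷ []
  ps : All (1 ≤_) e
  ps = z<s ∷ z<s ∷ z<s ∷ []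

-- Isomorphisms of trees

module _ (S T : PTree) (f g : ℕ → ℕ)
  (f< : ∀ v → v < tsize S → f v < tsize T) (g< : ∀ v → v < tsize T → g v < tsize S)
  (gf : ∀ v → v < tsize S → g (f v) ≡ v) (fg : ∀ v → v < tsize T → f (g v) ≡ v)
  (f-edge : ∀ v → 1 ≤ v → v < tsize S → par S v < v → treeAdj (par T) (f (par S v)) (f v) ≡ true)
  (g-edge : ∀ v → 1 ≤ v → v < tsize T → par T v < v → treeAdj (par S) (g (par T v)) (g v) ≡ true) where

  private
    preserve : ∀ S T (f : ℕ → ℕ) →
      (∀ v → 1 ≤ v → v < tsize S → par S v < v → treeAdj (par T) (f (par S v)) (f v) ≡ true) →
      ∀ a b → a < tsize S → b < tsize S → treeAdj (par S) a b ≡ true → treeAdj (par T) (f a) (f b) ≡ true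
    preserve S T f edge a b a<N b<N ab with treeAdj⇒ (par S) a b ab
    ... | inj₁ (a<b , refl) = edge b (ℕ.≤-trans z<s a<b) b<N a<b
    ... | inj₂ (b<a , refl) = trans (treeAdj-sym (par T) (f a) (f b)) (edge a (ℕ.≤-trans z<s b<a) a<N b<a)

    bool-ext : ∀ {x y : Bool} → (x ≡ true → y ≡ true) → (y ≡ true → x ≡ true) → x ≡ y
    bool-ext {true}  {y}     p q = sym (p refl)
    bool-ext {false} {true}  p q = q refl
    bool-ext {false} {false} p q = refl

  -- An adjacency is a parent link in one of two orders, so links to parents suffice. Checking them
  -- for both maps yields the two implications that make the Boolean adjacencies equal.
  tree-≅ : graph S ≅ graph T
  tree-≅ = mk↔ₛ′ F G FG GF , λ u v → trans
    (bool-ext (preserve S T f f-edge (toℕ u) (toℕ v) (Fin.toℕ<n u) (Fin.toℕ<n v))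
      λ h → subst₂ (λ a b → treeAdj (par S) a b ≡ true) (gf (toℕ u) (Fin.toℕ<n u)) (gf (toℕ v) (Fin.toℕ<n v))
        (preserve T S g g-edge (f (toℕ u)) (f (toℕ v)) (f< _ (Fin.toℕ<n u)) (f< _ (Fin.toℕ<n v)) h))
    (sym (cong₂ (treeAdj (par T)) (Fin.toℕ-fromℕ< (f< (toℕ u) (Fin.toℕ<n u)))
      (Fin.toℕ-fromℕ< (f< (toℕ v) (Fin.toℕ<n v)))))
    where
    F : Fin (tsize S) → Fin (tsize T)
    F u = fromℕ< (f< (toℕ u) (Fin.toℕ<n u))
    G : Fin (tsize T) → Fin (tsize S)
    G u = fromℕ< (g< (toℕ u) (Fin.toℕ<n u))
    FG : ∀ u → F (G u) ≡ u
    FG u = Fin.toℕ-injective (trans (Fin.toℕ-fromℕ< _)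
      (trans (cong f (Fin.toℕ-fromℕ< _)) (fg (toℕ u) (Fin.toℕ<n u))))
    GF : ∀ u → G (F u) ≡ u
    GF u = Fin.toℕ-injective (trans (Fin.toℕ-fromℕ< _)
      (trans (cong g (Fin.toℕ-fromℕ< _)) (gf (toℕ u) (Fin.toℕ<n u))))

same-tree-≅ : ∀ S T → tsize S ≡ tsize T → (∀ v → 1 ≤ v → v < tsize S → par S v ≡ par T v) → graph S ≅ graph T
same-tree-≅ S T size≡ par≡ = tree-≅ S T (λ v → v) (λ v → v)
  (λ v v<N → subst (v <_) size≡ v<N) (λ v v<N → subst (v <_) (sym size≡) v<N) (λ _ _ → refl) (λ _ _ → refl)
  (λ v 1≤v v<N lt → subst (λ p → treeAdj (par T) p v ≡ true) (sym (par≡ v 1≤v v<N))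
     (treeAdj-parent (par T) v (subst (_< v) (par≡ v 1≤v v<N) lt)))
  (λ v 1≤v v<N lt → let eq = par≡ v 1≤v (subst (v <_) (sym size≡) v<N) in
     subst (λ p → treeAdj (par S) p v ≡ true) eq (treeAdj-parent (par S) v (subst (_< v) (sym eq) lt)))

≅-trans : ∀ {G H I} → G ≅ H → H ≅ I → G ≅ I
≅-trans (σ , h) (ρ , h′) = ρ ↔-∘ σ , λ u v → trans (h u v) (h′ _ _)

rest-ones : ∀ n k xs → rest n (replicate k 1 ++ xs) ≡ k * n + rest n xs
rest-ones n zero    xs = refl
rest-ones n (suc k) xs rewrite ℕ.*-identityʳ n =
  trans (cong (n +_) (rest-ones n k xs)) (sym (ℕ.+-assoc n (k * n) (rest n xs)))

path-≅ : ∀ n → B (replicate n 1) ≅ P (suc n)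
path-≅ n = same-tree-≅ (betheT (replicate n 1)) (pathT (suc n)) (trans (betheSizeGo≡ 1 (replicate n 1)) size≡)
  λ v 1≤v v<N → subst (λ v → betheParGo 0 1 (replicate n 1) v ≡ v ∸ 1) (ℕ.m+[n∸m]≡n 1≤v)
    (ones-par 0 n (v ∸ 1) (ℕ.≤-pred (subst₂ _<_ (sym (ℕ.m+[n∸m]≡n 1≤v))
      (trans (betheSizeGo≡ 1 (replicate n 1)) size≡) v<N)))
  where
  size≡ : 1 + rest 1 (replicate n 1) ≡ suc n
  size≡ = cong suc (go n)
    where
    go : ∀ n → rest 1 (replicate n 1) ≡ n
    go zero    = refl
    go (suc n) = cong suc (go n)
  ones-par : ∀ start n i → i < n → betheParGo start 1 (replicate n 1) (start + 1 + i) ≡ start + i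
  ones-par start (suc n) zero    _         = par-near start 1 0 (replicate n 1) 0 z<s
  ones-par start (suc n) (suc i) (s≤s i<n) = begin
    betheParGo start 1 (replicate (suc n) 1) (start + 1 + suc i)
      ≡⟨ cong (betheParGo start 1 (replicate (suc n) 1)) (sym (ℕ.+-assoc (start + 1) 1 i)) ⟩
    betheParGo start 1 (replicate (suc n) 1) (start + 1 + 1 + i)
      ≡⟨ par-far start 1 0 (replicate n 1) (start + 1 + 1 + i) (ℕ.m≤m+n (start + 1 + 1) i) ⟩
    betheParGo (start + 1) 1 (replicate n 1) (start + 1 + 1 + i)
      ≡⟨ ones-par (start + 1) n i i<n ⟩
    start + 1 + i
      ≡⟨ ℕ.+-assoc start 1 i ⟩
    start + suc i ∎
    where open ≡-Reasoning

module SubdivisionPar (k : ℕ) (T : PTree) where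
  private K = suc k

  subdiv-inner : ∀ j i → suc i < K → par (subdivT K T) (suc (j * K + suc i)) ≡ j * K + suc i
  subdiv-inner j i i<K rewrite proj₂ (divMod-unique j K (suc i) i<K) = refl

  subdiv-end : ∀ j → par (subdivT K T) (suc (j * K)) ≡ par T (suc j) * K
  subdiv-end j rewrite ℕ.m*n%n≡0 j K {{_}} | ℕ.m*n/n≡m j K {{_}} = refl

module Subdivided (k : ℕ) (e : List ℕ) (ps : All (1 ≤_) e) where
  private
    K  = suc k
    E  = expand k e
    d  = nth E
    w  = nth e
    module V = BetheWalk e ps
    module VE = BetheWalk E (expand-positive k e ps)
    S = betheT E
    T = subdivT K (betheT e)
    posE = pos 0 1 E
    pose = pos 0 1 e
  open Expansion k e
  open SubdivisionPar k (betheT e)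

  -- The expanded tree is numbered level by level, whereas `subdivT` numbers edge by edge: the edge
  -- above the original vertex v occupies the numbers (v - 1)K + 1, ..., vK. The maps translate
  -- through the level l = i + mK inside the edge and the offset x, which subdivision leaves
  -- unchanged.
  f g : ℕ → ℕ
  f v with coords 0 1 E v
  ... | zero  , x = 0
  ... | suc l , x = (pose (suc (l / K)) x ∸ 1) * K + suc (l % K)
  g zero    = 0
  g (suc u) = let (m , x) = coords 0 1 e (suc (u / K)) in posE (suc (u % K) + (m ∸ 1) * K) x

  private
    inside : ∀ m i {x} → i ≤ k → x < W w (suc m) → x < W d (suc i + m * K)
    inside m i {x} i≤k = subst (x <_) (sym (W-inner m i i≤k))

    image : ℕ → ℕ → ℕ → ℕ
    image m i x = suc ((pose (suc m) x ∸ 1) * K + i)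

    f-pos : ∀ m i x → i ≤ k → x < W w (suc m) → f (posE (suc i + m * K) x) ≡ image m i x
    f-pos m i x i≤k x<W rewrite VE.coords-V (suc i + m * K) x (inside m i i≤k x<W)
      | ℕ.+-comm i (m * K) | proj₁ (divMod-unique m K i (s≤s i≤k)) | proj₂ (divMod-unique m K i (s≤s i≤k)) =
      ℕ.+-suc ((pose (suc m) x ∸ 1) * K) i

    g-image : ∀ m i x → i ≤ k → x < W w (suc m) → g (image m i x) ≡ posE (suc i + m * K) x
    g-image m i x i≤k x<W
      rewrite proj₁ (divMod-unique (pose (suc m) x ∸ 1) K i (s≤s i≤k))
            | proj₂ (divMod-unique (pose (suc m) x ∸ 1) K i (s≤s i≤k))
            | ℕ.m+[n∸m]≡n (V.V≥1 m x x<W)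
            | V.coords-V (suc m) x x<W = refl

    f-0 : f 0 ≡ 0
    f-0 rewrite VE.coords-V 0 0 z<s = refl

    f-top : ∀ m x → x < W w m → f (posE (m * K) x) ≡ pose m x * K
    f-top zero    zero    x<W = f-0
    f-top zero    (suc x) (s≤s ())
    f-top (suc m) x       x<W = begin
      f (posE (suc m * K) x)                  ≡⟨ f-pos m k x ℕ.≤-refl x<W ⟩
      suc ((pose (suc m) x ∸ 1) * K + k)      ≡⟨ sym (ℕ.+-suc ((pose (suc m) x ∸ 1) * K) k) ⟩
      (pose (suc m) x ∸ 1) * K + K            ≡⟨ ℕ.+-comm ((pose (suc m) x ∸ 1) * K) K ⟩
      suc (pose (suc m) x ∸ 1) * K            ≡⟨ cong (_* K) (ℕ.m+[n∸m]≡n (V.V≥1 m x x<W)) ⟩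
      pose (suc m) x * K                      ∎
      where open ≡-Reasoning

    data Source : ℕ → Set where
      root : Source 0
      at   : ∀ m i x → i ≤ k → x < W w (suc m) → Source (posE (suc i + m * K) x)

    source : ∀ v → v < tsize S → Source v
    source zero    _   = root
    source (suc v) v<N with VE.levels (suc v) z<s v<N
    ... | l , x , x<W , eq = subst Source (sym (trans eq (cong (λ n → posE n x) l≡))) (at (l / K) (l % K) x i≤k
            (subst (x <_) (trans (cong (W d) l≡) (W-inner (l / K) (l % K) i≤k)) x<W))
      where
      i≤k : l % K ≤ k
      i≤k = ℕ.≤-pred (ℕ.m%n<n l K)
      l≡ : suc l ≡ suc (l % K) + l / K * K
      l≡ = cong suc (ℕ.m≡m%n+[m/n]*n l K)

    size-T : tsize T ≡ suc (rest 1 e * K)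
    size-T = cong (λ n → suc ((n ∸ 1) * K)) (betheSizeGo≡ 1 e)

    data Target : ℕ → Set where
      root : Target 0
      at   : ∀ m i x → i ≤ k → x < W w (suc m) → Target (image m i x)

    target : ∀ u → u < tsize T → Target u
    target zero    _   = root
    target (suc u) u<N with V.levels (suc (u / K)) z<s (subst (suc (u / K) <_) (sym (betheSizeGo≡ 1 e))
                              (s≤s (ℕ.m<n*o⇒m/o<n (ℕ.≤-pred (subst (suc u <_) size-T u<N)))))
    ... | m , x , x<W , eq = subst Target (cong suc u≡) (at m (u % K) x (ℕ.≤-pred (ℕ.m%n<n u K)) x<W)
      where
      u≡ : (pose (suc m) x ∸ 1) * K + u % K ≡ u
      u≡ = trans (cong (λ z → (z ∸ 1) * K + u % K) (sym eq))
        (trans (ℕ.+-comm (u / K * K) (u % K)) (sym (ℕ.m≡m%n+[m/n]*n u K)))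

    f< : ∀ v → v < tsize S → f v < tsize T
    f< v v<N with source v v<N
    ... | root = subst (_< tsize T) (sym f-0) z<s
    ... | at m i x i≤k x<W = subst₂ _<_ (sym (f-pos m i x i≤k x<W)) (sym size-T)
      (s≤s (next-bound K (ℕ.≤-pred (subst₂ _<_ (sym (ℕ.m+[n∸m]≡n (V.V≥1 m x x<W))) (betheSizeGo≡ 1 e)
        (V.V<N (suc m) x x<W))) (s≤s i≤k)))

    g< : ∀ v → v < tsize T → g v < tsize S
    g< v v<N with target v v<N
    ... | root = VE.V<N 0 0 z<s
    ... | at m i x i≤k x<W = subst (_< tsize S) (sym (g-image m i x i≤k x<W))
      (VE.V<N (suc i + m * K) x (inside m i i≤k x<W))

    gf : ∀ v → v < tsize S → g (f v) ≡ v
    gf v v<N with source v v<N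
    ... | root = cong g f-0
    ... | at m i x i≤k x<W = trans (cong g (f-pos m i x i≤k x<W)) (g-image m i x i≤k x<W)

    fg : ∀ v → v < tsize T → f (g v) ≡ v
    fg v v<N with target v v<N
    ... | root = f-0
    ... | at m i x i≤k x<W = trans (cong f (g-image m i x i≤k x<W)) (f-pos m i x i≤k x<W)

    commute : ∀ m i x → i ≤ k → x < W w (suc m) →
      par T (image m i x) ≡ f (par S (posE (suc i + m * K) x))
    commute m zero y i≤k y<W with split-< (W w m) (w m) y<W
    ... | x , j , x<W , j<n , refl = begin
      par T (suc ((pose (suc m) y ∸ 1) * K + 0))
        ≡⟨ cong (λ n → par T (suc n)) (ℕ.+-identityʳ ((pose (suc m) y ∸ 1) * K)) ⟩
      par T (suc ((pose (suc m) y ∸ 1) * K))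
        ≡⟨ subdiv-end (pose (suc m) y ∸ 1) ⟩
      par (betheT e) (suc (pose (suc m) y ∸ 1)) * K
        ≡⟨ cong (λ n → par (betheT e) n * K) (ℕ.m+[n∸m]≡n (V.V≥1 m y y<W)) ⟩
      par (betheT e) (pose (suc m) y) * K
        ≡⟨ cong (_* K) (V.parent-V m x j x<W j<n) ⟩
      pose m x * K
        ≡⟨ sym (f-top m x x<W) ⟩
      f (posE (m * K) x)
        ≡⟨ cong f (sym (VE.parent-V (m * K) x j (subst (x <_) (sym (W-expand m)) x<W)
          (subst (j <_) (sym (nth-expand k e m)) j<n))) ⟩
      f (par S (posE (suc (m * K)) (x * d (m * K) + j)))
        ≡⟨ cong (λ n → f (par S (posE (suc (m * K)) (x * n + j)))) (nth-expand k e m) ⟩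
      f (par S (posE (suc (m * K)) y)) ∎
      where open ≡-Reasoning
    commute m (suc i) x i≤k x<W = begin
      par T (suc ((pose (suc m) x ∸ 1) * K + suc i))
        ≡⟨ subdiv-inner (pose (suc m) x ∸ 1) i (s≤s i≤k) ⟩
      (pose (suc m) x ∸ 1) * K + suc i
        ≡⟨ ℕ.+-suc ((pose (suc m) x ∸ 1) * K) i ⟩
      image m i x
        ≡⟨ sym (f-pos m i x (ℕ.<⇒≤ i≤k) x<W) ⟩
      f (posE (suc i + m * K) x)
        ≡⟨ cong f (sym (VE.parent-V (suc i + m * K) x 0 (inside m i (ℕ.<⇒≤ i≤k) x<W)
          (subst (0 <_) (sym one) z<s))) ⟩
      f (par S (posE (suc (suc i) + m * K) (x * d (suc i + m * K) + 0)))
        ≡⟨ cong (λ n → f (par S (posE (suc (suc i) + m * K) n)))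
             (trans (ℕ.+-identityʳ (x * d (suc i + m * K))) (trans (cong (x *_) one) (ℕ.*-identityʳ x))) ⟩
      f (par S (posE (suc (suc i) + m * K) x)) ∎
      where
      open ≡-Reasoning
      one : d (suc i + m * K) ≡ 1
      one = inner-one m i i≤k x<W

    par-image< : ∀ m i x → i ≤ k → x < W w (suc m) → par T (image m i x) < image m i x
    par-image< m (suc i) x i≤k x<W = s≤s (ℕ.≤-reflexive (subdiv-inner (pose (suc m) x ∸ 1) i (s≤s i≤k)))
    par-image< m zero    x i≤k x<W rewrite ℕ.+-identityʳ ((pose (suc m) x ∸ 1) * K) | subdiv-end
      (pose (suc m) x ∸ 1)
      | ℕ.m+[n∸m]≡n (V.V≥1 m x x<W) = s≤s (ℕ.*-monoˡ-≤ K (ℕ.≤-pred (subst (par (betheT e) (pose (suc m) x) <_)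
          (sym (ℕ.m+[n∸m]≡n (V.V≥1 m x x<W))) (V.parent< (pose (suc m) x) (V.V≥1 m x x<W)
            (V.V<N (suc m) x x<W)))))

    f-edge : ∀ v → 1 ≤ v → v < tsize S → par S v < v → treeAdj (par T) (f (par S v)) (f v) ≡ true
    f-edge v 1≤v v<N _ with source v v<N
    ... | root = contradiction 1≤v λ ()
    ... | at m i x i≤k x<W = subst₂ (λ a b → treeAdj (par T) a b ≡ true) (commute m i x i≤k x<W)
      (sym (f-pos m i x i≤k x<W))
            (treeAdj-parent (par T) (image m i x) (par-image< m i x i≤k x<W))

    g-edge : ∀ v → 1 ≤ v → v < tsize T → par T v < v → treeAdj (par S) (g (par T v)) (g v) ≡ true
    g-edge v 1≤v v<N _ with target v v<N
    ... | root = contradiction 1≤v λ ()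
    ... | at m i x i≤k x<W = subst₂ (λ a b → treeAdj (par S) a b ≡ true)
            (sym (trans (cong g (commute m i x i≤k x<W)) (gf (par S q) (ℕ.<-trans lt q<N))))
              (sym (g-image m i x i≤k x<W))
            (treeAdj-parent (par S) q lt)
      where
      q = posE (suc i + m * K) x
      q<N : q < tsize S
      q<N = VE.V<N (suc i + m * K) x (inside m i i≤k x<W)
      lt : par S q < q
      lt = VE.parent< q (VE.V≥1 (i + m * K) x (inside m i i≤k x<W)) q<N

  expand-≅ : B E ≅ graph T
  expand-≅ = tree-≅ S T f g f< g< gf fg f-edge g-edge

star-≅ : ∀ k m → graph (subdivT (suc k) (betheT (suc m ∷ []))) ≅ S[ suc k ]ST (2 + m)
star-≅ k m = same-tree-≅ (subdivT K (betheT e)) (subdivT K (starT (2 + m))) size≡ par≡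
  where
  K = suc k
  e = suc m ∷ []
  size≡ : suc ((1 + 1 * suc m ∸ 1) * K) ≡ suc (suc m * K)
  size≡ = cong (λ n → suc (n * K)) (ℕ.*-identityˡ (suc m))
  par≡ : ∀ v → 1 ≤ v → v < suc ((1 + 1 * suc m ∸ 1) * K) →
    par (subdivT K (betheT e)) v ≡ par (subdivT K (starT (2 + m))) v
  par≡ (suc u) _ u<N with u % K ≡ᵇ 0
  ... | false = refl
  ... | true  = cong (_* K) (trans (par-near 0 1 m [] (u / K) near)
                               (ℕ.m<n⇒m/n≡0 (subst (u / K <_) (ℕ.*-identityˡ (suc m)) near)))
    where
    near : u / K < 1 * suc m
    near = ℕ.m<n*o⇒m/o<n (ℕ.≤-pred u<N)

-- The star seen from one of its leaves: the root path has length K and carries the centre at its end.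
module Rerooted (k m : ℕ) (1≤m : 1 ≤ m) where
  private
    K = suc k
    E = replicate K 1 ++ expand k (m ∷ [])
    psE : All (1 ≤_) E
    psE = ones K
      where
      ones : ∀ i → All (1 ≤_) (replicate i 1 ++ expand k (m ∷ []))
      ones zero    = expand-positive k (m ∷ []) (1≤m ∷ [])
      ones (suc i) = z<s ∷ ones i
    d = nth E
    module V = BetheWalk E psE
    S = betheT E
    T = subdivT K (starT (2 + m))
    posE = pos 0 1 E
  open SubdivisionPar k (starT (2 + m))

  private
    d-stem : ∀ l → l < K → d l ≡ 1
    d-stem l l<K = nth-replicate K l (expand k (m ∷ [])) l<K

    d-leg : ∀ i → d (i + K) ≡ nth (expand k (m ∷ [])) i
    d-leg i = trans (cong d (ℕ.+-comm i K)) (nth-replicate-++ K i (expand k (m ∷ [])))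

    d-leg-inner : ∀ i → i < k → d (suc i + K) ≡ 1
    d-leg-inner i i<k = trans (d-leg (suc i)) (nth-replicate k i [] i<k)

    W-stem : ∀ l → l ≤ K → W d l ≡ 1
    W-stem zero    _   = refl
    W-stem (suc l) l<K = cong₂ _*_ (W-stem l (ℕ.<⇒≤ l<K)) (d-stem l l<K)

    W-leg : ∀ i → i ≤ k → W d (suc i + K) ≡ m
    W-leg zero    _   = trans (cong₂ _*_ (W-stem K ℕ.≤-refl) (d-leg 0)) (ℕ.*-identityˡ m)
    W-leg (suc i) i<k = trans (cong₂ _*_ (W-leg i (ℕ.<⇒≤ i<k)) (d-leg-inner i i<k)) (ℕ.*-identityʳ m)

    in-stem : ∀ l → l ≤ K → 0 < W d l
    in-stem l l≤K = subst (0 <_) (sym (W-stem l l≤K)) z<s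

    in-leg : ∀ i {x} → i ≤ k → x < m → x < W d (suc i + K)
    in-leg i {x} i≤k = subst (x <_) (sym (W-leg i i≤k))

    leaf : ℕ → ℕ → ℕ
    leaf i x = suc (suc x * K + i)

    -- The centre of the star has number 0 and its first leg the numbers 1, ..., K. The stem is this
    -- leg read backwards, so level K becomes the centre, and child x of the branching vertex starts
    -- leg x + 1.
    fromLevel : ℕ × ℕ → ℕ
    fromLevel (l , x) = if l <ᵇ suc K then K ∸ l else suc x * K + (l ∸ K)

    f g : ℕ → ℕ
    f v = fromLevel (coords 0 1 E v)
    g u = if u <ᵇ suc K then posE (K ∸ u) 0 else posE (suc ((u ∸ 1) % K) + K) ((u ∸ 1) / K ∸ 1)

    f-stem : ∀ l → l ≤ K → f (posE l 0) ≡ K ∸ l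
    f-stem l l≤K rewrite V.coords-V l 0 (in-stem l l≤K) | <ᵇ-true (s≤s l≤K) = refl

    f-leg : ∀ i x → i ≤ k → x < m → f (posE (suc i + K) x) ≡ leaf i x
    f-leg i x i≤k x<m rewrite V.coords-V (suc i + K) x (in-leg i i≤k x<m)
      | <ᵇ-false {suc i + K} {suc K} (s≤s (ℕ.m≤n+m K i)) | ℕ.m+n∸n≡m (suc i) K = ℕ.+-suc (suc x * K) i

    g-stem : ∀ u → u ≤ K → g u ≡ posE (K ∸ u) 0
    g-stem u u≤K rewrite <ᵇ-true (s≤s u≤K) = refl

    g-leg : ∀ i x → i ≤ k → x < m → g (leaf i x) ≡ posE (suc i + K) x
    g-leg i x i≤k x<m
      rewrite <ᵇ-false {leaf i x} {suc K} (s≤s (ℕ.≤-trans (ℕ.m≤m+n K (x * K)) (ℕ.m≤m+n (suc x * K) i)))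
            | proj₁ (divMod-unique (suc x) K i (s≤s i≤k)) | proj₂ (divMod-unique (suc x) K i (s≤s i≤k)) = refl

    data Source : ℕ → Set where
      stem : ∀ l → l ≤ K → Source (posE l 0)
      leg  : ∀ i x → i ≤ k → x < m → Source (posE (suc i + K) x)

    source : ∀ v → v < tsize S → Source v
    source zero    _   = stem 0 z≤n
    source (suc v) v<N with V.levels (suc v) z<s v<N
    ... | l , x , x<W , eq with suc l ≤? K
    ...   | yes l<K = subst Source (sym (trans eq (cong (posE (suc l)) x≡0))) (stem (suc l) l<K)
      where
      x≡0 : x ≡ 0
      x≡0 = ℕ.n<1⇒n≡0 (subst (x <_) (W-stem (suc l) l<K) x<W)
    ...   | no l≮K with suc l ∸ K in i≡
    ...     | zero  = contradiction (ℕ.m∸n≡0⇒m≤n i≡) l≮K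
    ...     | suc i = subst Source (sym (trans eq (cong (λ n → posE n x) l≡)))
      (leg i x i≤k (subst (x <_) (W-leg i i≤k) x<W′))
      where
      l≡ : suc l ≡ suc i + K
      l≡ = trans (sym (ℕ.m∸n+n≡m (ℕ.<⇒≤ (ℕ.≰⇒> l≮K)))) (cong (_+ K) i≡)
      x<W′ : x < W d (suc i + K)
      x<W′ = subst (λ n → x < W d n) l≡ x<W
      beyond : ∀ j → W d (suc (k + suc j) + K) ≡ 0
      beyond zero    = trans (cong (W d (k + 1 + K) *_) (trans (d-leg (k + 1)) (trans
          (cong (nth (expand k (m ∷ []))) (ℕ.+-comm k 1))
            (trans (cong (nth (replicate k 1 ++ [])) (sym (ℕ.+-identityʳ k)))
            (nth-replicate-++ k 0 []))))) (ℕ.*-zeroʳ (W d (k + 1 + K)))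
      beyond (suc j) = trans (cong (λ n → W d (n + K) * d (n + K)) (ℕ.+-suc k (suc j)))
                             (cong (_* d (suc (k + suc j) + K)) (beyond j))
      i≤k : i ≤ k
      i≤k with i ≤? k
      ... | yes i≤k = i≤k
      ... | no  i≰k = contradiction (subst (x <_) zeroW x<W′) λ ()
        where
        j = i ∸ suc k
        zeroW : W d (suc i + K) ≡ 0
        zeroW = trans (cong (λ n → W d (suc n + K))
          (trans (sym (ℕ.m+[n∸m]≡n (ℕ.≰⇒> i≰k))) (sym (ℕ.+-suc k j)))) (beyond j)

    data Target : ℕ → Set where
      stem : ∀ u → u ≤ K → Target u
      leg  : ∀ i x → i ≤ k → x < m → Target (leaf i x)

    target : ∀ u → u < tsize T → Target u
    target u u<N with u ≤? K
    ... | yes u≤K = stem u u≤K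
    target zero u<N | no u≰K = contradiction z≤n u≰K
    target (suc u) (s≤s u<N) | no u≰K with u / K in q≡
    ...   | zero  = contradiction (ℕ.m/n≡0⇒m<n q≡) u≰K
    ...   | suc x = subst Target (cong suc u≡) (leg (u % K) x (ℕ.≤-pred (ℕ.m%n<n u K))
              (ℕ.≤-pred (subst (_< suc m) q≡ (ℕ.m<n*o⇒m/o<n u<N))))
      where
      u≡ : suc x * K + u % K ≡ u
      u≡ = trans (cong (λ z → z * K + u % K) (sym q≡))
        (trans (ℕ.+-comm (u / K * K) (u % K)) (sym (ℕ.m≡m%n+[m/n]*n u K)))

    f< : ∀ v → v < tsize S → f v < tsize T
    f< v v<N with source v v<N
    ... | stem l l≤K     = subst (_< tsize T) (sym (f-stem l l≤K))
      (s≤s (ℕ.≤-trans (ℕ.m∸n≤m K l) (ℕ.m≤m+n K (m * K))))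
    ... | leg i x i≤k x<m = subst (_< tsize T) (sym (f-leg i x i≤k x<m))
      (s≤s (next-bound K (s≤s x<m) (s≤s i≤k)))

    g< : ∀ v → v < tsize T → g v < tsize S
    g< v v<N with target v v<N
    ... | stem u u≤K      = subst (_< tsize S) (sym (g-stem u u≤K))
      (V.V<N (K ∸ u) 0 (in-stem (K ∸ u) (ℕ.m∸n≤m K u)))
    ... | leg i x i≤k x<m = subst (_< tsize S) (sym (g-leg i x i≤k x<m))
      (V.V<N (suc i + K) x (in-leg i i≤k x<m))

    gf : ∀ v → v < tsize S → g (f v) ≡ v
    gf v v<N with source v v<N
    ... | stem l l≤K      = trans (cong g (f-stem l l≤K)) (trans (g-stem (K ∸ l) (ℕ.m∸n≤m K l))
                              (cong (λ n → posE n 0) (ℕ.m∸[m∸n]≡n l≤K)))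
    ... | leg i x i≤k x<m = trans (cong g (f-leg i x i≤k x<m)) (g-leg i x i≤k x<m)

    fg : ∀ v → v < tsize T → f (g v) ≡ v
    fg v v<N with target v v<N
    ... | stem u u≤K      = trans (cong f (g-stem u u≤K))
      (trans (f-stem (K ∸ u) (ℕ.m∸n≤m K u)) (ℕ.m∸[m∸n]≡n u≤K))
    ... | leg i x i≤k x<m = trans (cong f (g-leg i x i≤k x<m)) (f-leg i x i≤k x<m)

    par-stem-T : ∀ u → u < K → par T (suc u) ≡ u
    par-stem-T zero    _   = subdiv-end 0
    par-stem-T (suc u) u<K = subdiv-inner 0 u u<K

    par-stem-S : ∀ l → l < K → par S (posE (suc l) 0) ≡ posE l 0
    par-stem-S l l<K = V.parent-V l 0 0 (in-stem l (ℕ.<⇒≤ l<K)) (subst (0 <_) (sym (d-stem l l<K)) z<s)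

    commute : ∀ i x → i ≤ k → x < m → par T (leaf i x) ≡ f (par S (posE (suc i + K) x))
    commute zero x i≤k x<m = trans
      (trans (cong (λ n → par T (suc n)) (ℕ.+-identityʳ (suc x * K))) (subdiv-end (suc x)))
      (sym (trans (cong f (V.parent-V K 0 x (in-stem K ℕ.≤-refl) (subst (x <_) (sym (d-leg 0)) x<m)))
                  (trans (f-stem K ℕ.≤-refl) (ℕ.n∸n≡0 K))))
    commute (suc i) x i<k x<m = trans
      (trans (subdiv-inner (suc x) i (s≤s i<k)) (ℕ.+-suc (suc x * K) i))
      (sym (trans (cong f (trans (cong (λ n → par S (posE (suc (suc i) + K) n)) (sym x≡))
              (V.parent-V (suc i + K) x 0 (in-leg i (ℕ.<⇒≤ i<k) x<m) (subst (0 <_) (sym one) z<s))))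
            (f-leg i x (ℕ.<⇒≤ i<k) x<m)))
      where
      one : d (suc i + K) ≡ 1
      one = d-leg-inner i i<k
      x≡ : x * d (suc i + K) + 0 ≡ x
      x≡ = trans (ℕ.+-identityʳ (x * d (suc i + K))) (trans (cong (x *_) one) (ℕ.*-identityʳ x))

    par-leaf< : ∀ i x → i ≤ k → x < m → par T (leaf i x) < leaf i x
    par-leaf< zero    x i≤k x<m = subst (_< leaf 0 x)
      (sym (trans (cong (λ n → par T (suc n)) (ℕ.+-identityʳ (suc x * K))) (subdiv-end (suc x)))) z<s
    par-leaf< (suc i) x i<k x<m = s≤s (ℕ.≤-reflexive (subdiv-inner (suc x) i (s≤s i<k)))

    descend : ∀ {l} → l < K → K ∸ l ≡ suc (K ∸ suc l)
    descend {l} l<K = ℕ.+-∸-assoc 1 l<K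

    f-edge : ∀ v → 1 ≤ v → v < tsize S → par S v < v → treeAdj (par T) (f (par S v)) (f v) ≡ true
    f-edge v 1≤v v<N _ with source v v<N
    ... | stem zero _ = contradiction 1≤v λ ()
    -- Along the stem the map exchanges parent and child, so the edge is found in the opposite
    -- order.
    ... | stem (suc l) l<K = subst₂ (λ a b → treeAdj (par T) a b ≡ true)
        (sym (trans (cong f (par-stem-S l l<K)) (trans (f-stem l (ℕ.<⇒≤ l<K)) (descend l<K))))
          (sym (f-stem (suc l) l<K))
        (subst (λ a → treeAdj (par T) (suc u) a ≡ true) pu
          (treeAdj-child (par T) (suc u) (subst (_< suc u) (sym pu) (s≤s ℕ.≤-refl))))
      where
      u = K ∸ suc l
      pu : par T (suc u) ≡ u
      pu = par-stem-T u (s≤s (ℕ.m∸n≤m k l))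
    ... | leg i x i≤k x<m = subst₂ (λ a b → treeAdj (par T) a b ≡ true) (commute i x i≤k x<m)
      (sym (f-leg i x i≤k x<m))
            (treeAdj-parent (par T) (leaf i x) (par-leaf< i x i≤k x<m))

    parent<V : ∀ l x → x < W d (suc l) → par S (posE (suc l) x) < posE (suc l) x
    parent<V l x x<W = V.parent< (posE (suc l) x) (V.V≥1 l x x<W) (V.V<N (suc l) x x<W)

    g-edge : ∀ v → 1 ≤ v → v < tsize T → par T v < v → treeAdj (par S) (g (par T v)) (g v) ≡ true
    g-edge v 1≤v v<N _ with target v v<N
    ... | stem zero _ = contradiction 1≤v λ ()
    ... | stem (suc u) u<K = subst₂ (λ a b → treeAdj (par S) a b ≡ true)
        (sym (trans (cong g (par-stem-T u u<K)) (trans (g-stem u (ℕ.<⇒≤ u<K))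
          (cong (λ n → posE n 0) (descend u<K)))))
        (sym (g-stem (suc u) u<K))
        (subst (λ a → treeAdj (par S) (posE (suc l) 0) a ≡ true) (par-stem-S l l<K)
          (treeAdj-child (par S) (posE (suc l) 0) (parent<V l 0 (in-stem (suc l) l<K))))
      where
      l = K ∸ suc u
      l<K : l < K
      l<K = s≤s (ℕ.m∸n≤m k u)
    ... | leg i x i≤k x<m = subst₂ (λ a b → treeAdj (par S) a b ≡ true)
            (sym (trans (cong g (commute i x i≤k x<m))
              (gf (par S q) (ℕ.<-trans lt (V.V<N (suc i + K) x (in-leg i i≤k x<m))))))
            (sym (g-leg i x i≤k x<m)) (treeAdj-parent (par S) q lt)
      where
      q = posE (suc i + K) x
      lt : par S q < q
      lt = parent<V (i + K) x (in-leg i i≤k x<m)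

  rerooted-≅ : B E ≅ S[ K ]ST (2 + m)
  rerooted-≅ = tree-≅ S T f g f< g< gf fg f-edge g-edge

-- Integer sequences and descent

infix 4 _∣_
_∣_ : ℤ → ℤ → Set
_∣_ = Signed._∣_

module ZS = ℤSolver.+-*-Solver

even-odd : ∀ n → Σ ℕ λ c → n ≡ c + c ⊎ n ≡ suc (c + c)
even-odd zero = 0 , inj₁ refl
even-odd (suc n) with even-odd n
... | c , inj₁ eq = c , inj₂ (cong suc eq)
... | c , inj₂ eq = suc c , inj₁ (cong suc (trans eq (sym (ℕ.+-suc c c))))

module _ (P : (ℕ → ℤ) → Set) (q : ℕ) (2≤q : 2 ≤ q)
  (divisible : ∀ X → P X → ∀ n → ℤ.+ q ∣ X n)
  (divided : ∀ X Y → P X → (∀ n → X n ≡ Y n ℤ.* ℤ.+ q) → P Y) where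

  descent : ∀ X → P X → ∀ n → X n ≡ 0ℤ
  descent X p n = go (suc ℤ.∣ X n ∣) X p ℕ.≤-refl
    where
    go : ∀ b X → P X → ℤ.∣ X n ∣ < b → X n ≡ 0ℤ
    go (suc b) X p (s≤s X≤b) with ℤ.∣ X n ∣ in X≡
    ... | zero  = ℤ.∣i∣≡0⇒i≡0 X≡
    ... | suc x = trans (eq n) (cong (ℤ._* ℤ.+ q) (go b Y (divided X Y p eq) (ℕ.<-≤-trans smaller X≤b)))
      where
      Y : ℕ → ℤ
      Y n = Signed.quotient (divisible X p n)
      eq : ∀ n → X n ≡ Y n ℤ.* ℤ.+ q
      eq n = Signed._∣_.equality (divisible X p n)
      abs : ℤ.∣ Y n ∣ * q ≡ suc x
      abs = trans (sym (ℤ.abs-* (Y n) (ℤ.+ q))) (trans (cong ℤ.∣_∣ (sym (eq n))) X≡)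
      smaller : ℤ.∣ Y n ∣ < suc x
      smaller with ℤ.∣ Y n ∣ in Y≡
      ... | zero  = z<s
      ... | suc y = subst (suc y <_) (trans (cong (_* q) (sym Y≡)) abs)
          (ℕ.<-≤-trans (ℕ.m<m+n (suc y) z<s) (ℕ.≤-trans (ℕ.≤-reflexive double) (ℕ.*-monoʳ-≤ (suc y) 2≤q)))
        where
        double : suc y + suc y ≡ suc y * 2
        double = trans (cong (suc y +_) (sym (ℕ.+-identityʳ (suc y)))) (ℕ.*-comm 2 (suc y))

-- Bézout for 1 + 2z and 2: one has x = (1 + 2z) x - z · 2x.
odd-cancel : ∀ z x → 1ℤ ℤ.+ (z ℤ.+ z) ∣ x ℤ.+ x → 1ℤ ℤ.+ (z ℤ.+ z) ∣ x
odd-cancel z x (Signed.divides y eq) = Signed.divides (x ℤ.- z ℤ.* y) (begin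
  x
    ≡⟨ solve 2 (λ z x → x := (con 1ℤ :+ (z :+ z)) :* x :- z :* (x :+ x)) refl z x ⟩
  (1ℤ ℤ.+ (z ℤ.+ z)) ℤ.* x ℤ.- z ℤ.* (x ℤ.+ x)
    ≡⟨ cong (λ s → (1ℤ ℤ.+ (z ℤ.+ z)) ℤ.* x ℤ.- z ℤ.* s) eq ⟩
  (1ℤ ℤ.+ (z ℤ.+ z)) ℤ.* x ℤ.- z ℤ.* (y ℤ.* (1ℤ ℤ.+ (z ℤ.+ z)))
    ≡⟨ solve 3 (λ z x y → (con 1ℤ :+ (z :+ z)) :* x :- z :* (y :* (con 1ℤ :+ (z :+ z)))
                       := (x :- z :* y) :* (con 1ℤ :+ (z :+ z))) refl z x y ⟩
  (x ℤ.- z ℤ.* y) ℤ.* (1ℤ ℤ.+ (z ℤ.+ z))                      ∎)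
  where
  open ≡-Reasoning
  open ZS

-- Since d - 1 = (d + 1) - 2, the equation says 2f = (d + 1)(f - e), and d + 1 is odd.
even-denominator : ∀ c e f → ℤ.+ suc (c + c) ℤ.* e ≡ (ℤ.+ (c + c) ℤ.- 1ℤ) ℤ.* f → ℤ.+ suc (c + c) ∣ f
even-denominator c e f eq = odd-cancel (ℤ.+ c) f (Signed.divides (f ℤ.- e) (begin
  f ℤ.+ f
    ≡⟨ solve 2 (λ z f → f :+ f := (con 1ℤ :+ (z :+ z)) :* f :- (z :+ z :- con 1ℤ) :* f) refl (ℤ.+ c) f ⟩
  ℤ.+ suc (c + c) ℤ.* f ℤ.- (ℤ.+ (c + c) ℤ.- 1ℤ) ℤ.* f    ≡⟨ cong (λ s → ℤ.+ suc (c + c) ℤ.* f ℤ.- s) (sym eq) ⟩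
  ℤ.+ suc (c + c) ℤ.* f ℤ.- ℤ.+ suc (c + c) ℤ.* e
    ≡⟨ solve 3 (λ m f e → m :* f :- m :* e := (f :- e) :* m) refl (ℤ.+ suc (c + c)) f e ⟩
  (f ℤ.- e) ℤ.* ℤ.+ suc (c + c)                              ∎))
  where
  open ≡-Reasoning
  open ZS

odd-reduce : ∀ c e f → ℤ.+ suc (suc (c + c)) ℤ.* e ≡ (ℤ.+ suc (c + c) ℤ.- 1ℤ) ℤ.* f →
  ℤ.+ suc c ℤ.* e ≡ ℤ.+ c ℤ.* f
odd-reduce c e f eq = ℤ.*-cancelˡ-≡ (ℤ.+ 2) _ _ (begin
  ℤ.+ 2 ℤ.* (ℤ.+ suc c ℤ.* e)
    ≡⟨ solve 2 (λ z e → con (ℤ.+ 2) :* ((con 1ℤ :+ z) :* e) := (con (ℤ.+ 2) :+ (z :+ z)) :* e) refl (ℤ.+ c) e ⟩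
  ℤ.+ suc (suc (c + c)) ℤ.* e                  ≡⟨ eq ⟩
  (ℤ.+ suc (c + c) ℤ.- 1ℤ) ℤ.* f
    ≡⟨ solve 2 (λ z f → (con 1ℤ :+ (z :+ z) :- con 1ℤ) :* f := con (ℤ.+ 2) :* (z :* f)) refl (ℤ.+ c) f ⟩
  ℤ.+ 2 ℤ.* (ℤ.+ c ℤ.* f)                      ∎)
  where
  open ≡-Reasoning
  open ZS

odd-denominator : ∀ c e f → ℤ.+ suc c ℤ.* e ≡ ℤ.+ c ℤ.* f → ℤ.+ suc c ∣ f
odd-denominator c e f eq = Signed.divides (f ℤ.- e) (begin
  f
    ≡⟨ solve 2 (λ z f → f := (con 1ℤ :+ z) :* f :- z :* f) refl (ℤ.+ c) f ⟩
  ℤ.+ suc c ℤ.* f ℤ.- ℤ.+ c ℤ.* f          ≡⟨ cong (λ s → ℤ.+ suc c ℤ.* f ℤ.- s) (sym eq) ⟩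
  ℤ.+ suc c ℤ.* f ℤ.- ℤ.+ suc c ℤ.* e
    ≡⟨ solve 3 (λ m f e → m :* f :- m :* e := (f :- e) :* m) refl (ℤ.+ suc c) f e ⟩
  (f ℤ.- e) ℤ.* ℤ.+ suc c                  ∎)
  where
  open ≡-Reasoning
  open ZS

∣0 : ∀ q {x} → x ≡ 0ℤ → q ∣ x
∣0 q refl = Signed.divides 0ℤ refl

all-divisible : ∀ q L (X : ℕ → ℤ) → (∀ n → n < L → X n ≡ 0ℤ) →
  (∀ n → L ≤ n → (∀ i → i < n → q ∣ X i) → q ∣ X n) → ∀ n → q ∣ X n
all-divisible q L X zeros next = <-rec (λ n → q ∣ X n) λ n ih → case n <? L of λ where
  (yes n<L) → ∣0 q (zeros n n<L)
  (no n≮L)  → next n (ℕ.≮⇒≥ n≮L) λ i i<n → ih i<n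

data Sign : ℤ → Set where
  plus  : Sign 1ℤ
  minus : Sign -1ℤ

sign-∣ : ∀ q {s} x → Sign s → q ∣ s ℤ.* x → q ∣ x
sign-∣ q x plus = subst (q ∣_) (ℤ.*-identityˡ x)
sign-∣ q x minus h = subst (q ∣_) (ZS.solve 1 (λ x → ZS.:- (ZS.con -1ℤ ZS.:* x) ZS.:= x) refl
    x) (Signed.∣m⇒∣-m h)

-- The recurrences of the signal on a line with reflection sign s at its top, where the first
-- vertex with d > 1 children is met again after A steps on its upper side and after B steps
-- on its lower side; in the second case the lower path has a vertex with three children halfway.
module _ (d : ℕ) (s : ℤ) (A B n₀ : ℕ) (A≡ : A ≡ suc n₀) (1≤B : 1 ≤ B) where

  record OneInterface (X : ℕ → ℤ) : Set where
    field
      zeros : ∀ n → n < n₀ + B → X n ≡ 0ℤ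
      rec   : ∀ t → ℤ.+ suc d ℤ.* (X (A + (B + t)) ℤ.- s ℤ.* X t) ≡ (ℤ.+ d ℤ.- 1ℤ) ℤ.*
        (X (A + t) ℤ.- s ℤ.* X (B + t))

  record TwoInterfaces (X : ℕ → ℤ) : Set where
    field
      zeros : ∀ n → n < n₀ + (B + B) → X n ≡ 0ℤ
      rec   : ∀ t → ℤ.+ suc d ℤ.* ((ℤ.+ 2 ℤ.* X (A + (B + (B + t))) ℤ.- X (A + (B + t))) ℤ.- s ℤ.*
        (ℤ.+ 2 ℤ.* X t ℤ.- X (B + t)))
                  ≡ (ℤ.+ d ℤ.- 1ℤ) ℤ.* ((ℤ.+ 2 ℤ.* X (A + t) ℤ.- X (A + (B + t))) ℤ.- s ℤ.*
                    (ℤ.+ 2 ℤ.* X (B + (B + t)) ℤ.- X (B + t)))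

module _ {d : ℕ} {s : ℤ} {A B n₀ : ℕ} {A≡ : A ≡ suc n₀} {1≤B : 1 ≤ B} where
  open ZS

  private
    cancel-q : ∀ q M N {e f e′ f′} → e ≡ e′ ℤ.* ℤ.+ suc q → f ≡ f′ ℤ.* ℤ.+ suc q → M ℤ.* e ≡ N ℤ.* f →
      M ℤ.* e′ ≡ N ℤ.* f′
    cancel-q q M N {e′ = e′} {f′} refl refl eq = ℤ.*-cancelʳ-≡ (M ℤ.* e′) (N ℤ.* f′) (ℤ.+ suc q)
      (trans (ℤ.*-assoc M e′ (ℤ.+ suc q)) (trans eq (sym (ℤ.*-assoc N f′ (ℤ.+ suc q)))))
    cancel-0 : ∀ q x → x ℤ.* ℤ.+ suc q ≡ 0ℤ → x ≡ 0ℤ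
    cancel-0 q x eq = ℤ.*-cancelʳ-≡ x 0ℤ (ℤ.+ suc q) eq

  one-divided : ∀ q → 2 ≤ q → ∀ X Y → OneInterface d s A B n₀ A≡ 1≤B X → (∀ n → X n ≡ Y n ℤ.* ℤ.+ q) →
    OneInterface d s A B n₀ A≡ 1≤B Y
  one-divided (suc q) _ X Y h eq = record
    { zeros = λ n n< → cancel-0 q (Y n) (trans (sym (eq n)) (h.zeros n n<))
    ; rec = λ t → cancel-q q (ℤ.+ suc d) (ℤ.+ d ℤ.- 1ℤ)
        (lin (A + (B + t)) t) (lin (A + t) (B + t)) (h.rec t)
    }
    where
    module h = OneInterface h
    Q = ℤ.+ suc q
    lin : ∀ a b → X a ℤ.- s ℤ.* X b ≡ (Y a ℤ.- s ℤ.* Y b) ℤ.* Q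
    lin a b = trans (cong₂ (λ x y → x ℤ.- s ℤ.* y) (eq a) (eq b))
      (solve 4 (λ q s a b → a :* q :- s :* (b :* q) := (a :- s :* b) :* q) refl Q s (Y a) (Y b))

  two-divided : ∀ q → 2 ≤ q → ∀ X Y → TwoInterfaces d s A B n₀ A≡ 1≤B X → (∀ n → X n ≡ Y n ℤ.* ℤ.+ q) →
    TwoInterfaces d s A B n₀ A≡ 1≤B Y
  two-divided (suc q) _ X Y h eq = record
    { zeros = λ n n< → cancel-0 q (Y n) (trans (sym (eq n)) (h.zeros n n<))
    ; rec = λ t → cancel-q q (ℤ.+ suc d) (ℤ.+ d ℤ.- 1ℤ)
        (lin (A + (B + (B + t))) (A + (B + t)) t (B + t)) (lin (A + t) (A + (B + t)) (B + (B + t)) (B + t))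
          (h.rec t)
    }
    where
    module h = TwoInterfaces h
    Q = ℤ.+ suc q
    lin : ∀ a b c e → (ℤ.+ 2 ℤ.* X a ℤ.- X b) ℤ.- s ℤ.* (ℤ.+ 2 ℤ.* X c ℤ.- X e)
                      ≡ ((ℤ.+ 2 ℤ.* Y a ℤ.- Y b) ℤ.- s ℤ.* (ℤ.+ 2 ℤ.* Y c ℤ.- Y e)) ℤ.* Q
    lin a b c e rewrite eq a | eq b | eq c | eq e =
      solve 6 (λ q s a b c e → (con (ℤ.+ 2) :* (a :* q) :- b :* q) :- s :* (con (ℤ.+ 2) :* (c :* q) :- e :* q)
                 := ((con (ℤ.+ 2) :* a :- b) :- s :* (con (ℤ.+ 2) :* c :- e)) :* q) refl Q s (Y a) (Y b) (Y c)
                   (Y e)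

-- m is the denominator of (d - 1) / (d + 1) in lowest terms: d + 1 for even d, (d + 1) / 2 for odd d.
record Denominator (d m : ℕ) : Set where
  field
    2≤m      : 2 ≤ m
    divides-right : ∀ e f → ℤ.+ suc d ℤ.* e ≡ (ℤ.+ d ℤ.- 1ℤ) ℤ.* f → ℤ.+ m ∣ f

denominator : ∀ d → 2 ≤ d → (Σ ℕ λ c → d ≡ c + c × 1 ≤ c × Denominator d (suc (c + c)))
                          ⊎ (Σ ℕ λ c → d ≡ suc (c + c) × 1 ≤ c × Denominator d (suc c))
denominator d 2≤d with even-odd d
... | zero  , inj₁ refl = contradiction 2≤d λ ()
... | suc c , inj₁ refl = inj₁ (suc c , refl , z<s , record { 2≤m = s≤s z<s ; divides-right = even-denominator
  (suc c) })
... | zero  , inj₂ refl = contradiction 2≤d λ { (s≤s ()) }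
... | suc c , inj₂ refl = inj₂ (suc c , refl , z<s , record { 2≤m = s≤s z<s
    ; divides-right = λ e f eq → odd-denominator (suc c) e f (odd-reduce (suc c) e f eq) })

module OneNecessary (d : ℕ) (2≤d : 2 ≤ d) (s : ℤ) (sgn : Sign s) (A B n₀ : ℕ) (A≡ : A ≡ suc n₀)
  (1≤B : 1 ≤ B) where
  private
    L = n₀ + B
    One = OneInterface d s A B n₀ A≡ 1≤B

    A≤L : A ≤ L
    A≤L = subst₂ _≤_ (trans (ℕ.+-comm n₀ 1) (sym A≡)) refl (ℕ.+-monoʳ-≤ n₀ 1≤B)

    B≤L : B ≤ L
    B≤L = ℕ.m≤n+m B n₀

    -- The congruence ties X at the later index A + t to the earlier B + t, and every n ≥ L has the
    -- form A + t because A ≤ L. `step-B` exchanges the roles; there the sign has to be cancelled.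
    step-A : ∀ q (X : ℕ → ℤ) → (∀ t → q ∣ X (A + t) ℤ.- s ℤ.* X (B + t)) → B < A →
      ∀ n → L ≤ n → (∀ i → i < n → q ∣ X i) → q ∣ X n
    step-A q X h B<A n L≤n ih = subst (λ n → q ∣ X n) A+t (subst (q ∣_)
        (solve 2 (λ a b → (a :- b) :+ b := a) refl (X (A + t)) (s ℤ.* X (B + t)))
        (Signed.∣m∣n⇒∣m+n (h t) (Signed.∣n⇒∣m*n s (ih (B + t) (subst (B + t <_) A+t (ℕ.+-monoˡ-< t B<A))))))
      where
      open ZS
      t = n ∸ A
      A+t : A + t ≡ n
      A+t = ℕ.m+[n∸m]≡n (ℕ.≤-trans A≤L L≤n)

    step-B : ∀ q (X : ℕ → ℤ) → (∀ t → q ∣ X (A + t) ℤ.- s ℤ.* X (B + t)) → A < B →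
      ∀ n → L ≤ n → (∀ i → i < n → q ∣ X i) → q ∣ X n
    step-B q X h A<B n L≤n ih = subst (λ n → q ∣ X n) B+t (sign-∣ q (X (B + t)) sgn (subst (q ∣_)
        (solve 2 (λ a b → a :- (a :- b) := b) refl (X (A + t)) (s ℤ.* X (B + t)))
        (Signed.∣m∣n⇒∣m-n (ih (A + t) (subst (A + t <_) B+t (ℕ.+-monoˡ-< t A<B))) (h t))))
      where
      open ZS
      t = n ∸ B
      B+t : B + t ≡ n
      B+t = ℕ.m+[n∸m]≡n (ℕ.≤-trans B≤L L≤n)

    vanish : ∀ q → 2 ≤ q → (∀ X → One X → ∀ n → L ≤ n → (∀ i → i < n → ℤ.+ q ∣ X i) → ℤ.+ q ∣ X n) →
      ∀ X → One X → ∀ n → X n ≡ 0ℤ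
    vanish q 2≤q next = descent One q 2≤q
      (λ X h → all-divisible (ℤ.+ q) L X (OneInterface.zeros h) (next X h)) (one-divided q 2≤q)

    congruence : ∀ {m} → Denominator d m → ∀ X → One X → ∀ t → ℤ.+ m ∣ X (A + t) ℤ.- s ℤ.* X (B + t)
    congruence den X h t = Denominator.divides-right den _ _ (OneInterface.rec h t)

    unequal : A ≢ B → ∀ {m} → Denominator d m → ∀ X → One X → ∀ n → X n ≡ 0ℤ
    unequal A≢B {m} den = vanish m (Denominator.2≤m den) λ X h → case ℕ.<-cmp A B of λ where
      (tri< A<B _ _) → step-B (ℤ.+ m) X (congruence den X h) A<B
      (tri≈ _ A≡B _) → contradiction A≡B A≢B
      (tri> _ _ B<A) → step-A (ℤ.+ m) X (congruence den X h) B<A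

    -- With A = B both indices of the congruence coincide, and the sign -1 makes the two terms add
    -- up instead of cancelling.
    doubled : ∀ {m} → A ≡ B → s ≡ -1ℤ → Denominator d m → ∀ X → One X → ∀ n → A ≤ n → ℤ.+ m ∣ X n ℤ.+ X n
    doubled {m} refl refl den X h n A≤n = subst (λ n → ℤ.+ m ∣ X n ℤ.+ X n) (ℕ.m+[n∸m]≡n A≤n)
      (subst (ℤ.+ m ∣_) (solve 1 (λ x → x :- con -1ℤ :* x := x :+ x) refl
          (X (A + (n ∸ A)))) (congruence den X h (n ∸ A)))
      where open ZS

    equal-odd-m : ∀ c → 1 ≤ c → Denominator d (suc (c + c)) → A ≡ B → s ≡ -1ℤ → ∀ X → One X → ∀ n → X n ≡ 0ℤ
    equal-odd-m c 1≤c den A≡B s≡ = vanish (suc (c + c)) (Denominator.2≤m den)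
      λ X h n L≤n _ → odd-cancel (ℤ.+ c) (X n) (doubled A≡B s≡ den X h n (ℕ.≤-trans A≤L L≤n))

    -- From 2c | 2X follows c | X, so the descent runs with c instead of m = 2c and needs c ≥ 2.
    equal-even-m : ∀ c → 2 ≤ c → Denominator d (c + c) → A ≡ B → s ≡ -1ℤ → ∀ X → One X → ∀ n → X n ≡ 0ℤ
    equal-even-m c 2≤c den A≡B s≡ = vanish c 2≤c
      λ X h n L≤n _ → halve (X n) (doubled A≡B s≡ den X h n (ℕ.≤-trans A≤L L≤n))
      where
      open ZS
      halve : ∀ x → ℤ.+ (c + c) ∣ x ℤ.+ x → ℤ.+ c ∣ x
      halve x (Signed.divides y eq) = Signed.divides y (ℤ.*-cancelˡ-≡ (ℤ.+ 2) x (y ℤ.* ℤ.+ c)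
        (trans (solve 1 (λ x → con (ℤ.+ 2) :* x := x :+ x) refl x) (trans eq
          (solve 2 (λ y z → y :* (z :+ z) := con (ℤ.+ 2) :* (y :* z)) refl y (ℤ.+ c)))))

  one-necessary : ∀ X → One X → X L ≢ 0ℤ → A ≡ B × (s ≡ -1ℤ → d ≡ 3)
  one-necessary X h X≢0 with A ≟ B
  ... | no A≢B = contradiction (some-den (denominator d 2≤d)) X≢0
    where
    some-den : _ → X L ≡ 0ℤ
    some-den (inj₁ (c , _ , _ , den)) = unequal A≢B den X h L
    some-den (inj₂ (c , _ , _ , den)) = unequal A≢B den X h L
  ... | yes A≡B = A≡B , λ s≡ → three s≡ (denominator d 2≤d)
    where
    three : s ≡ -1ℤ → _ → d ≡ 3
    three s≡ (inj₁ (c , _ , 1≤c , den)) = contradiction (equal-odd-m c 1≤c den A≡B s≡ X h L) X≢0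
    three s≡ (inj₂ (c , d≡ , 1≤c , den)) with even-odd (suc c)
    ... | zero        , inj₁ ()
    -- Here m = c + 1 = 2, the one denominator whose half is too small for a descent; it gives d =
    -- 2c + 1 = 3.
    ... | suc zero    , inj₁ eq = trans d≡ (cong (λ c → suc (c + c)) (ℕ.suc-injective eq))
    ... | suc (suc j) , inj₁ eq = contradiction
        (equal-even-m (suc (suc j)) (s≤s z<s) (subst (Denominator d) eq den) A≡B s≡ X h L) X≢0
    ... | zero        , inj₂ eq = contradiction (subst (1 ≤_) (ℕ.suc-injective eq) 1≤c) λ ()
    ... | suc j       , inj₂ eq = contradiction
        (equal-odd-m (suc j) z<s (subst (Denominator d) eq den) A≡B s≡ X h L) X≢0

-- The witness is m/3 if 3 divides m, where m ≥ 5 gives m/3 ≥ 2, and otherwise m itself, by Bézout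
-- for m and 3. It is applied to m = 2c + 1 with c ≥ 2.
three-cancel : ∀ m → 5 ≤ m → Σ ℕ λ q → 2 ≤ q × (∀ x → ℤ.+ m ∣ ℤ.+ 3 ℤ.* x → ℤ.+ q ∣ x)
three-cancel m 5≤m = residue (m % 3) (m / 3) (ℕ.m%n<n m 3)
  (trans (ℕ.m≡m%n+[m/n]*n m 3) (cong (m % 3 +_) (ℕ.*-comm (m / 3) 3)))
  where
  open ZS
  open ≡-Reasoning
  residue : ∀ r j → r < 3 → m ≡ r + 3 * j → Σ ℕ λ q → 2 ≤ q × (∀ x → ℤ.+ m ∣ ℤ.+ 3 ℤ.* x → ℤ.+ q ∣ x)
  residue 0 j _ refl = j , ℕ.*-cancelˡ-< 3 1 j (ℕ.≤-trans (s≤s (s≤s (s≤s z<s))) 5≤m) ,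
    λ { x (Signed.divides y eq) → Signed.divides y (ℤ.*-cancelˡ-≡ (ℤ.+ 3) x (y ℤ.* ℤ.+ j) (trans eq
      (trans (cong (y ℤ.*_) (ℤ.pos-* 3 j)) (solve 2 (λ y j → y :* (con (ℤ.+ 3) :* j) := con (ℤ.+ 3) :* (y :* j)) refl
          y (ℤ.+ j))))) }
  residue 1 j _ refl = 1 + 3 * j , ℕ.≤-trans (s≤s z<s) 5≤m , λ { x (Signed.divides y eq) →
    let M = ℤ.+ (1 + 3 * j)
        M≡ = cong (λ z → 1ℤ ℤ.+ z) (ℤ.pos-* 3 j) in
    Signed.divides (x ℤ.- ℤ.+ j ℤ.* y) (begin
      x ≡⟨ solve 2 (λ x j → x := x :* (con 1ℤ :+ con (ℤ.+ 3) :* j) :- j :* (con (ℤ.+ 3) :* x)) refl x (ℤ.+ j) ⟩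
      x ℤ.* (1ℤ ℤ.+ ℤ.+ 3 ℤ.* ℤ.+ j) ℤ.- ℤ.+ j ℤ.* (ℤ.+ 3 ℤ.* x)
        ≡⟨ cong₂ (λ a b → x ℤ.* a ℤ.- ℤ.+ j ℤ.* b) (sym M≡) eq ⟩
      x ℤ.* M ℤ.- ℤ.+ j ℤ.* (y ℤ.* M)
        ≡⟨ solve 4 (λ x M j y → x :* M :- j :* (y :* M) := (x :- j :* y) :* M) refl x M (ℤ.+ j) y ⟩
      (x ℤ.- ℤ.+ j ℤ.* y) ℤ.* M ∎) }
  residue 2 j _ refl = 2 + 3 * j , ℕ.≤-trans (s≤s z<s) 5≤m , λ { x (Signed.divides y eq) →
    let M = ℤ.+ (2 + 3 * j)
        M≡ = cong (λ z → ℤ.+ 2 ℤ.+ z) (ℤ.pos-* 3 j) in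
    Signed.divides (ℤ.+ j ℤ.* y ℤ.+ y ℤ.- x) (begin
      x
        ≡⟨ solve 2 (λ x j → x
              := j :* (con (ℤ.+ 3) :* x) :+ con (ℤ.+ 3) :* x :- x :* (con (ℤ.+ 2) :+ con (ℤ.+ 3) :* j)) refl x
                (ℤ.+ j) ⟩
      ℤ.+ j ℤ.* (ℤ.+ 3 ℤ.* x) ℤ.+ ℤ.+ 3 ℤ.* x ℤ.- x ℤ.* (ℤ.+ 2 ℤ.+ ℤ.+ 3 ℤ.* ℤ.+ j)
        ≡⟨ cong₂ (λ a b → ℤ.+ j ℤ.* b ℤ.+ b ℤ.- x ℤ.* a) (sym M≡) eq ⟩
      ℤ.+ j ℤ.* (y ℤ.* M) ℤ.+ y ℤ.* M ℤ.- x ℤ.* M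
        ≡⟨ solve 4 (λ x M j y → j :* (y :* M) :+ y :* M :- x :* M := (j :* y :+ y :- x) :* M) refl
            x M (ℤ.+ j) y ⟩
      (ℤ.+ j ℤ.* y ℤ.+ y ℤ.- x) ℤ.* M ∎) }
  residue (suc (suc (suc r))) j (s≤s (s≤s (s≤s ()))) _

module TwoNecessary (d : ℕ) (2≤d : 2 ≤ d) (s : ℤ) (sgn : Sign s) (A B n₀ : ℕ) (A≡ : A ≡ suc n₀)
  (1≤B : 1 ≤ B) where
  open ZS
  private
    L = n₀ + (B + B)
    Two = TwoInterfaces d s A B n₀ A≡ 1≤B

    AB≤L : A + B ≤ L
    AB≤L = subst₂ _≤_ (trans (ℕ.+-suc n₀ B) (cong (_+ B) (sym A≡))) refl (ℕ.+-monoʳ-≤ n₀ (ℕ.+-monoˡ-≤ B 1≤B))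

    BB≤L : B + B ≤ L
    BB≤L = ℕ.m≤n+m (B + B) n₀

    F : (ℕ → ℤ) → ℕ → ℤ
    F X t = (ℤ.+ 2 ℤ.* X (A + t) ℤ.- X (A + (B + t))) ℤ.- s ℤ.* (ℤ.+ 2 ℤ.* X (B + (B + t)) ℤ.- X (B + t))

    at-AB : ∀ q (X : ℕ → ℤ) →
      (∀ t → (∀ i → i < A + (B + t) → q ∣ X i) → q ∣ X (A + (B + t))) →
      ∀ n → L ≤ n → (∀ i → i < n → q ∣ X i) → q ∣ X n
    at-AB q X h n L≤n ih = subst (λ n → q ∣ X n) n≡ (h t λ i i< → ih i (subst (i <_) n≡ i<))
      where
      t = n ∸ (A + B)
      n≡ : A + (B + t) ≡ n
      n≡ = trans (sym (ℕ.+-assoc A B t)) (ℕ.m+[n∸m]≡n (ℕ.≤-trans AB≤L L≤n))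

    at-BB : ∀ q (X : ℕ → ℤ) →
      (∀ t → (∀ i → i < B + (B + t) → q ∣ X i) → q ∣ X (B + (B + t))) →
      ∀ n → L ≤ n → (∀ i → i < n → q ∣ X i) → q ∣ X n
    at-BB q X h n L≤n ih = subst (λ n → q ∣ X n) n≡ (h t λ i i< → ih i (subst (i <_) n≡ i<))
      where
      t = n ∸ (B + B)
      n≡ : B + (B + t) ≡ n
      n≡ = trans (sym (ℕ.+-assoc B B t)) (ℕ.m+[n∸m]≡n (ℕ.≤-trans BB≤L L≤n))

    vanish : ∀ q → 2 ≤ q → (∀ X → Two X → ∀ n → L ≤ n → (∀ i → i < n → ℤ.+ q ∣ X i) → ℤ.+ q ∣ X n) →
      ∀ X → Two X → ∀ n → X n ≡ 0ℤ
    vanish q 2≤q next = descent Two q 2≤q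
      (λ X h → all-divisible (ℤ.+ q) L X (TwoInterfaces.zeros h) (next X h)) (two-divided q 2≤q)

    BA : ∀ t → B + t < A + (B + t)
    BA t = subst (λ a → B + t < a + (B + t)) (sym A≡) (s≤s (ℕ.m≤n+m (B + t) n₀))

    -- After cancelling 2 the coefficients are c + 1 and c, and modulo 2 the terms 2X vanish. Both
    -- sides then contain the same difference X(A+B+t) - s X(B+t), with coefficients differing by 1,
    -- so this difference is even.
    odd-d : ∀ c → d ≡ suc (c + c) → ∀ X → Two X → ∀ n → X n ≡ 0ℤ
    odd-d c refl = vanish 2 (s≤s z<s) λ X h → at-AB (ℤ.+ 2) X λ t ih →
      let a = X (A + (B + (B + t))); b = X (A + (B + t)); x = X t; y = X (B + t); g = X (A + t); e = X (B + (B + t))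
          eq = odd-reduce c _ _ (TwoInterfaces.rec h t)
          even : ℤ.+ 2 ∣ b ℤ.- s ℤ.* y
          even = Signed.divides (ℤ.+ suc c ℤ.* (a ℤ.- s ℤ.* x) ℤ.- ℤ.+ c ℤ.* (g ℤ.- s ℤ.* e)) (trans
            (solve 8 (λ z s a b x y g e → b :- s :* y :=
                ((con 1ℤ :+ z) :* (a :- s :* x) :- z :* (g :- s :* e)) :* con (ℤ.+ 2)
                :- ((con 1ℤ :+ z) :* ((con (ℤ.+ 2) :* a :- b) :- s :* (con (ℤ.+ 2) :* x :- y))
                    :- z :* ((con (ℤ.+ 2) :* g :- b) :- s :* (con (ℤ.+ 2) :* e :- y))))
              refl (ℤ.+ c) s a b x y g e)
            (trans (cong (λ w → (ℤ.+ suc c ℤ.* (a ℤ.- s ℤ.* x) ℤ.- ℤ.+ c ℤ.* (g ℤ.- s ℤ.* e)) ℤ.* ℤ.+ 2 ℤ.-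
              (w ℤ.- ℤ.+ c ℤ.* F X t)) eq)
              (solve 2 (λ p q → p :- (q :- q) := p) refl _ (ℤ.+ c ℤ.* F X t)))) in
      subst (ℤ.+ 2 ∣_) (solve 2 (λ b w → (b :- w) :+ w := b) refl b (s ℤ.* y))
        (Signed.∣m∣n⇒∣m+n even (Signed.∣n⇒∣m*n s (ih (B + t) (BA t))))

    module Even (c : ℕ) (den : Denominator d (suc (c + c))) where
      M = ℤ.+ suc (c + c)

      M∣F : ∀ X → Two X → ∀ t → M ∣ F X t
      M∣F X h t = Denominator.divides-right den _ _ (TwoInterfaces.rec h t)

      -- For B < A the largest index in F is A + B + t, with coefficient -1, so its value is
      -- determined modulo m by earlier ones.
      above : B < A → ∀ X → Two X → ∀ n → X n ≡ 0ℤ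
      above B<A = vanish _ (Denominator.2≤m den) λ X h → at-AB M X λ t ih →
        let b = X (A + (B + t)); y = X (B + t); g = X (A + t); e = X (B + (B + t)) in
        subst (M ∣_) (solve 5 (λ s b y g e → (con (ℤ.+ 2) :* g :- s :* (con (ℤ.+ 2) :* e :- y))
                          :- ((con (ℤ.+ 2) :* g :- b) :- s :* (con (ℤ.+ 2) :* e :- y)) := b) refl s b y g e)
          (Signed.∣m∣n⇒∣m-n
            (Signed.∣m∣n⇒∣m-n (Signed.∣n⇒∣m*n (ℤ.+ 2) (ih (A + t) (ℕ.+-monoʳ-< A (ℕ.m<n+m t 1≤B))))
              (Signed.∣n⇒∣m*n s (Signed.∣m∣n⇒∣m-n (Signed.∣n⇒∣m*n (ℤ.+ 2)
                (ih (B + (B + t)) (ℕ.+-monoˡ-< (B + t) B<A))) (ih (B + t) (BA t)))))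
            (M∣F X h t))

      -- For A < B the largest index is 2B + t. Its coefficient is 2 up to sign, which cancels
      -- because m is odd.
      below : A < B → ∀ X → Two X → ∀ n → X n ≡ 0ℤ
      below A<B = vanish _ (Denominator.2≤m den) λ X h → at-BB M X λ t ih →
        let b = X (A + (B + t)); y = X (B + t); g = X (A + t); e = X (B + (B + t)) in
        odd-cancel (ℤ.+ c) e (sign-∣ M (e ℤ.+ e) sgn
          (subst (M ∣_) (solve 5 (λ s b y g e → ((con (ℤ.+ 2) :* g :- b) :+ s :* y)
                            :- ((con (ℤ.+ 2) :* g :- b) :- s :* (con (ℤ.+ 2) :* e :- y)) := s :*
                              (e :+ e)) refl s b y g e)
            (Signed.∣m∣n⇒∣m-n
              (Signed.∣m∣n⇒∣m+n
                (Signed.∣m∣n⇒∣m-n (Signed.∣n⇒∣m*n (ℤ.+ 2)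
                  (ih (A + t) (ℕ.<-≤-trans (ℕ.+-monoˡ-< t A<B) (ℕ.m≤n+m (B + t) B))))
                  (ih (A + (B + t)) (ℕ.+-monoˡ-< (B + t) A<B)))
                (Signed.∣n⇒∣m*n s (ih (B + t) (ℕ.m<n+m (B + t) 1≤B))))
              (M∣F X h t))))

      -- For A = B the four indices collapse to two, and F becomes X(A+t) + X(2A+t).
      dirichlet-equal : A ≡ B → s ≡ -1ℤ → ∀ X → Two X → ∀ n → X n ≡ 0ℤ
      dirichlet-equal refl refl = vanish _ (Denominator.2≤m den) λ X h → at-AB M X λ t ih →
        let b = X (A + (A + t)); y = X (A + t) in
        subst (M ∣_) (solve 2 (λ b y → ((con (ℤ.+ 2) :* y :- b) :- con -1ℤ :* (con (ℤ.+ 2) :* b :- y)) :- y := b) refl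
            b y)
          (Signed.∣m∣n⇒∣m-n (M∣F X h t) (ih (A + t) (BA t)))

      -- Here F becomes 3(X(A+t) - X(2A+t)). Only for m = 3, that is c = 1 and d = 2, would
      -- cancelling the 3 leave nothing to divide by.
      neumann-equal : A ≡ B → s ≡ 1ℤ → 2 ≤ c → ∀ X → Two X → ∀ n → X n ≡ 0ℤ
      neumann-equal refl refl 2≤c with three-cancel (suc (c + c)) (s≤s (ℕ.+-mono-≤ 2≤c 2≤c))
      ... | q , 2≤q , cancel = vanish q 2≤q λ X h → at-AB (ℤ.+ q) X λ t ih →
        let b = X (A + (A + t)); y = X (A + t) in
        subst (ℤ.+ q ∣_) (solve 2 (λ b y → y :- (y :- b) := b) refl b y)
          (Signed.∣m∣n⇒∣m-n (ih (A + t) (BA t)) (cancel (y ℤ.- b) (subst (M ∣_)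
            (solve 2 (λ b y → ((con (ℤ.+ 2) :* y :- b) :- con 1ℤ :* (con (ℤ.+ 2) :* b :- y))
                  := con (ℤ.+ 3) :* (y :- b)) refl b y)
            (M∣F X h t))))

  two-necessary : ∀ X → Two X → X L ≢ 0ℤ → A ≡ B × s ≡ 1ℤ × d ≡ 2
  two-necessary X h X≢0 with denominator d 2≤d
  ... | inj₂ (c , d≡ , _ , _) = contradiction (odd-d c d≡ X h L) X≢0
  ... | inj₁ (c , d≡ , 1≤c , den) with ℕ.<-cmp A B
  ...   | tri< A<B _ _ = contradiction (Even.below c den A<B X h L) X≢0
  ...   | tri> _ _ B<A = contradiction (Even.above c den B<A X h L) X≢0
  ...   | tri≈ _ A≡B _ = A≡B , equal refl sgn c d≡ 1≤c den
    where
    equal : ∀ {s′} → s ≡ s′ → Sign s′ → ∀ c → d ≡ c + c → 1 ≤ c → Denominator d (suc (c + c)) → s ≡ 1ℤ × d ≡ 2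
    equal s≡ minus c d≡ 1≤c den = contradiction (Even.dirichlet-equal c den A≡B s≡ X h L) X≢0
    equal s≡ plus (suc zero) d≡ 1≤c den = s≡ , d≡
    equal s≡ plus (suc (suc c)) d≡ 1≤c den =
      contradiction (Even.neumann-equal (suc (suc c)) den A≡B s≡ (s≤s z<s) X h L) X≢0

-- Bounded denominators

ζ : ℤ → ℚ
ζ z = z ℚ./ 1

private
  toℚᵘ-ζ : ∀ z → ℚ.toℚᵘ (ζ z) ℚᵘ.≃ ℚᵘ.mkℚᵘ z 0
  toℚᵘ-ζ z = ℚ.toℚᵘ-fromℚᵘ (ℚᵘ.mkℚᵘ z 0)

ζ-injective : ∀ {a b} → ζ a ≡ ζ b → a ≡ b
ζ-injective {a} {b} eq with ℚᵘ.≃-trans (ℚᵘ.≃-sym (toℚᵘ-ζ a))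
  (ℚᵘ.≃-trans (ℚᵘ.≃-reflexive (cong ℚ.toℚᵘ eq)) (toℚᵘ-ζ b))
... | ℚᵘ.*≡* h = trans (sym (ℤ.*-identityʳ a)) (trans h (ℤ.*-identityʳ b))

ζ-+ : ∀ a b → ζ (a ℤ.+ b) ≡ ζ a +ℚ ζ b
ζ-+ a b = ℚ.toℚᵘ-injective (begin
  ℚ.toℚᵘ (ζ (a ℤ.+ b))             ≈⟨ toℚᵘ-ζ (a ℤ.+ b) ⟩
  ℚᵘ.mkℚᵘ (a ℤ.+ b) 0              ≈⟨ ℚᵘ.*≡*
    (cong (ℤ._* 1ℤ) (sym (cong₂ ℤ._+_ (ℤ.*-identityʳ a) (ℤ.*-identityʳ b)))) ⟩
  ℚᵘ.mkℚᵘ a 0 ℚᵘ.+ ℚᵘ.mkℚᵘ b 0     ≈⟨ ℚᵘ.≃-sym (ℚᵘ.+-cong (toℚᵘ-ζ a) (toℚᵘ-ζ b)) ⟩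
  ℚ.toℚᵘ (ζ a) ℚᵘ.+ ℚ.toℚᵘ (ζ b)   ≈⟨ ℚᵘ.≃-sym (ℚ.toℚᵘ-homo-+ (ζ a) (ζ b)) ⟩
  ℚ.toℚᵘ (ζ a +ℚ ζ b)              ∎)
  where open ℚᵘ.≃-Reasoning

ζ-* : ∀ a b → ζ (a ℤ.* b) ≡ ζ a *ℚ ζ b
ζ-* a b = ℚ.toℚᵘ-injective (begin
  ℚ.toℚᵘ (ζ (a ℤ.* b))             ≈⟨ toℚᵘ-ζ (a ℤ.* b) ⟩
  ℚᵘ.mkℚᵘ (a ℤ.* b) 0              ≈⟨ ℚᵘ.*≡* refl ⟩
  ℚᵘ.mkℚᵘ a 0 ℚᵘ.* ℚᵘ.mkℚᵘ b 0     ≈⟨ ℚᵘ.≃-sym (ℚᵘ.*-cong (toℚᵘ-ζ a) (toℚᵘ-ζ b)) ⟩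
  ℚ.toℚᵘ (ζ a) ℚᵘ.* ℚ.toℚᵘ (ζ b)   ≈⟨ ℚᵘ.≃-sym (ℚ.toℚᵘ-homo-* (ζ a) (ζ b)) ⟩
  ℚ.toℚᵘ (ζ a *ℚ ζ b)              ∎)
  where open ℚᵘ.≃-Reasoning

ζ-- : ∀ a b → ζ (a ℤ.- b) ≡ ζ a -ℚ ζ b
ζ-- a b = begin
  ζ (a ℤ.- b)                    ≡⟨ RS.solve 2 (λ x y → x RS.:= (x RS.:+ y) RS.:- y) refl (ζ (a ℤ.- b)) (ζ b) ⟩
  ζ (a ℤ.- b) +ℚ ζ b -ℚ ζ b      ≡⟨ cong (_-ℚ ζ b) (sym (ζ-+ (a ℤ.- b) b)) ⟩
  ζ (a ℤ.- b ℤ.+ b) -ℚ ζ b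
    ≡⟨ cong (λ z → ζ z -ℚ ζ b) (ZS.solve 2 (λ a b → a ZS.:- b ZS.:+ b ZS.:= a) refl a b) ⟩
  ζ a -ℚ ζ b                     ∎
  where open ≡-Reasoning

clear-denominator : ∀ q → ι (ℚ.↧ₙ q) *ℚ q ≡ ζ (ℚ.↥ q)
clear-denominator q = trans (cong₂ _*ℚ_ (ι≡/1 (ℚ.↧ₙ q)) refl) (ℚ.toℚᵘ-injective (begin
  ℚ.toℚᵘ (ζ (ℚ.↧ q) *ℚ q)                               ≈⟨ ℚ.toℚᵘ-homo-* (ζ (ℚ.↧ q)) q ⟩
  ℚ.toℚᵘ (ζ (ℚ.↧ q)) ℚᵘ.* ℚ.toℚᵘ q                       ≈⟨ ℚᵘ.*-cong (toℚᵘ-ζ (ℚ.↧ q)) (ℚᵘ.≃-refl {ℚ.toℚᵘ q}) ⟩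
  ℚᵘ.mkℚᵘ (ℚ.↧ q) 0 ℚᵘ.* ℚ.toℚᵘ q                        ≈⟨ cancel q ⟩
  ℚᵘ.mkℚᵘ (ℚ.↥ q) 0                                      ≈⟨ ℚᵘ.≃-sym (toℚᵘ-ζ (ℚ.↥ q)) ⟩
  ℚ.toℚᵘ (ζ (ℚ.↥ q))                                     ∎))
  where
  open ℚᵘ.≃-Reasoning
  cancel : ∀ q → ℚᵘ.mkℚᵘ (ℚ.↧ q) 0 ℚᵘ.* ℚ.toℚᵘ q ℚᵘ.≃ ℚᵘ.mkℚᵘ (ℚ.↥ q) 0
  cancel q@record{} = ℚᵘ.*≡* (trans (ℤ.*-identityʳ (ℚ.↧ q ℤ.* ℚ.↥ q)) (trans (ℤ.*-comm (ℚ.↧ q) (ℚ.↥ q))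
    (cong (λ n → ℚ.↥ q ℤ.* ℤ.+ n) (sym (ℕ.+-identityʳ (ℚ.↧ₙ q))))))

ι-* : ∀ m n → ι (m * n) ≡ ι m *ℚ ι n
ι-* m n = trans (ι≡/1 (m * n)) (trans (cong ζ (ℤ.pos-* m n))
  (trans (ζ-* (ℤ.+ m) (ℤ.+ n)) (sym (cong₂ _*ℚ_ (ι≡/1 m) (ι≡/1 n)))))

common-denominator : ∀ T (X : ℕ → ℚ) → Σ ℕ λ D → 1 ≤ D × (∀ t → t < T → Σ ℤ λ z → ι D *ℚ X t ≡ ζ z)
common-denominator zero    X = 1 , z<s , λ t ()
common-denominator (suc T) X with common-denominator T X
... | D , 1≤D , h = D * ℚ.↧ₙ (X T) , ℕ.*-mono-≤ 1≤D z<s , λ t t<sT → cases t (t ≟ T) t<sT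
  where
  q = ℚ.↧ₙ (X T)
  cases : ∀ t → Dec (t ≡ T) → t < suc T → Σ ℤ λ z → ι (D * q) *ℚ X t ≡ ζ z
  cases t (yes refl) _ = ℤ.+ D ℤ.* ℚ.↥ (X t) , (begin
    ι (D * q) *ℚ X t          ≡⟨ cong (_*ℚ X t) (ι-* D q) ⟩
    (ι D *ℚ ι q) *ℚ X t       ≡⟨ ℚ.*-assoc (ι D) (ι q) (X t) ⟩
    ι D *ℚ (ι q *ℚ X t)       ≡⟨ cong₂ _*ℚ_ (ι≡/1 D) (clear-denominator (X t)) ⟩
    ζ (ℤ.+ D) *ℚ ζ (ℚ.↥ (X t)) ≡⟨ sym (ζ-* (ℤ.+ D) (ℚ.↥ (X t))) ⟩
    ζ (ℤ.+ D ℤ.* ℚ.↥ (X t))   ∎)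
    where open ≡-Reasoning
  cases t (no t≢T) t<sT with h t (ℕ.≤∧≢⇒< (ℕ.≤-pred t<sT) t≢T)
  ... | z , eq = z ℤ.* ℤ.+ q , (begin
    ι (D * q) *ℚ X t          ≡⟨ cong (_*ℚ X t) (ι-* D q) ⟩
    (ι D *ℚ ι q) *ℚ X t
      ≡⟨ RS.solve 3 (λ a b c → (a RS.:* b) RS.:* c RS.:= (a RS.:* c) RS.:* b) refl (ι D) (ι q) (X t) ⟩
    (ι D *ℚ X t) *ℚ ι q       ≡⟨ cong₂ _*ℚ_ eq (ι≡/1 q) ⟩
    ζ z *ℚ ζ (ℤ.+ q)          ≡⟨ sym (ζ-* z (ℤ.+ q)) ⟩
    ζ (z ℤ.* ℤ.+ q)           ∎)
    where open ≡-Reasoning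

BoundedDenominators : (ℕ → ℚ) → Set
BoundedDenominators X = Σ ℕ λ D → 1 ≤ D × Σ (ℕ → ℤ) λ Y → ∀ t → ι D *ℚ X t ≡ ζ (Y t)

module _ (T : ℕ) (X : ℕ → ℚ) (period : ∀ t → X (suc T + t) ≡ X t) where
  private
    reduce : ∀ j r → X (r + j * suc T) ≡ X r
    reduce zero    r = cong X (ℕ.+-identityʳ r)
    reduce (suc j) r = trans (cong X (trans (sym (ℕ.+-assoc r (suc T) (j * suc T)))
      (trans (cong (_+ j * suc T) (ℕ.+-comm r (suc T))) (ℕ.+-assoc (suc T) r (j * suc T)))))
      (trans (period (r + j * suc T)) (reduce j r))

  periodic⇒bounded : BoundedDenominators X
  periodic⇒bounded with common-denominator (suc T) X
  ... | D , 1≤D , h = D , 1≤D , (λ t → proj₁ (at t)) , λ t →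
      trans (cong (ι D *ℚ_) (trans (cong X (ℕ.m≡m%n+[m/n]*n t (suc T))) (reduce (t / suc T) (t % suc T))))
        (proj₂ (at t))
    where
    at : ∀ t → Σ ℤ λ z → ι D *ℚ X (t % suc T) ≡ ζ z
    at t = h (t % suc T) (ℕ.m%n<n t (suc T))

reflection : ∀ d → ι (suc d) *ℚ (1ℚ -ℚ 2/ (suc d)) ≡ ζ (ℤ.+ d ℤ.- 1ℤ)
reflection d = begin
  ι (suc d) *ℚ (1ℚ -ℚ 2/ (suc d))
    ≡⟨ solve 2 (λ i c → i :* (con 1ℚ :- c) := i :- c :* i) refl (ι (suc d)) (2/ (suc d)) ⟩
  ι (suc d) -ℚ 2/ (suc d) *ℚ ι (suc d)      ≡⟨ cong (ι (suc d) -ℚ_) (2/-inverse d) ⟩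
  1ℚ +ℚ ι d -ℚ 2ℚ                           ≡⟨ solve 1 (λ i → con 1ℚ :+ i :- con 2ℚ := i :- con 1ℚ) refl (ι d) ⟩
  ι d -ℚ 1ℚ                                 ≡⟨ cong (_-ℚ 1ℚ) (ι≡/1 d) ⟩
  ζ (ℤ.+ d) -ℚ ζ 1ℤ                    ≡⟨ sym (ζ-- (ℤ.+ d) 1ℤ) ⟩
  ζ (ℤ.+ d ℤ.- 1ℤ)                       ∎
  where
  open ≡-Reasoning
  open RS

private
  clear : ∀ d D {P Q : ℚ} {p q : ℤ} → P ≡ (1ℚ -ℚ 2/ (suc d)) *ℚ Q → ι D *ℚ P ≡ ζ p → ι D *ℚ Q ≡ ζ q →
    ℤ.+ suc d ℤ.* p ≡ (ℤ.+ d ℤ.- 1ℤ) ℤ.* q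
  clear d D {P} {Q} {p} {q} eq Dp Dq = ζ-injective (begin
    ζ (ℤ.+ suc d ℤ.* p)                                      ≡⟨ ζ-* (ℤ.+ suc d) p ⟩
    ζ (ℤ.+ suc d) *ℚ ζ p                                     ≡⟨ cong₂ _*ℚ_ (sym (ι≡/1 (suc d))) (sym Dp) ⟩
    ι (suc d) *ℚ (ι D *ℚ P)                                  ≡⟨ cong (λ z → ι (suc d) *ℚ (ι D *ℚ z)) eq ⟩
    ι (suc d) *ℚ (ι D *ℚ ((1ℚ -ℚ 2/ (suc d)) *ℚ Q))
      ≡⟨ RS.solve 4 (λ a b r q → a RS.:* (b RS.:* (r RS.:* q)) RS.:= (a RS.:* r) RS.:* (b RS.:* q)) refl
          (ι (suc d)) (ι D) (1ℚ -ℚ 2/ (suc d)) Q ⟩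
    (ι (suc d) *ℚ (1ℚ -ℚ 2/ (suc d))) *ℚ (ι D *ℚ Q)          ≡⟨ cong₂ _*ℚ_ (reflection d) Dq ⟩
    ζ (ℤ.+ d ℤ.- 1ℤ) *ℚ ζ q                               ≡⟨ sym (ζ-* (ℤ.+ d ℤ.- 1ℤ) q) ⟩
    ζ ((ℤ.+ d ℤ.- 1ℤ) ℤ.* q)                              ∎)
    where open ≡-Reasoning

  zero-multiple : ∀ D {x : ℚ} {y : ℤ} → ι D *ℚ x ≡ ζ y → x ≡ 0ℚ → y ≡ 0ℤ
  zero-multiple D eq refl = ζ-injective (trans (sym eq) (ℚ.*-zeroʳ (ι D)))

  nonzero-multiple : ∀ {D} {x : ℚ} {y : ℤ} → 1 ≤ D → ι D *ℚ x ≡ ζ y → x ≢ 0ℚ → y ≢ 0ℤ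
  nonzero-multiple {suc D} {x} 1≤D eq x≢0 refl = x≢0 (begin
    x                                            ≡⟨ sym (half x) ⟩
    ½ *ℚ (2ℚ *ℚ x)                               ≡⟨ cong (λ z → ½ *ℚ (z *ℚ x)) (sym (2/-inverse D)) ⟩
    ½ *ℚ ((2/ (suc D) *ℚ ι (suc D)) *ℚ x)        ≡⟨ cong (½ *ℚ_) (ℚ.*-assoc (2/ (suc D)) (ι (suc D)) x) ⟩
    ½ *ℚ (2/ (suc D) *ℚ (ι (suc D) *ℚ x))        ≡⟨ cong (λ z → ½ *ℚ (2/ (suc D) *ℚ z)) eq ⟩
    ½ *ℚ (2/ (suc D) *ℚ 0ℚ)                      ≡⟨ cong (½ *ℚ_) (ℚ.*-zeroʳ (2/ (suc D))) ⟩
    0ℚ                                           ∎)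
    where
    open ≡-Reasoning
    half : ∀ x → ½ *ℚ (2ℚ *ℚ x) ≡ x
    half = RS.solve 1 (λ x → RS.con ½ RS.:* (RS.con 2ℚ RS.:* x) RS.:= x) refl

module _ (d : ℕ) (2≤d : 2 ≤ d) (s : ℤ) (sgn : Sign s) (A B n₀ : ℕ) (A≡ : A ≡ suc n₀) (1≤B : 1 ≤ B)
  (X : ℕ → ℚ) (bounded : BoundedDenominators X) where
  private
    D   = proj₁ bounded
    1≤D = proj₁ (proj₂ bounded)
    Y   = proj₁ (proj₂ (proj₂ bounded))
    DX  = proj₂ (proj₂ (proj₂ bounded))
    σ r : ℚ
    σ = ζ s
    r = 1ℚ -ℚ 2/ (suc d)

  one-rational : (∀ n → n < n₀ + B → X n ≡ 0ℚ) → X (n₀ + B) ≢ 0ℚ →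
    (∀ t → X (A + (B + t)) -ℚ σ *ℚ X t ≡ r *ℚ (X (A + t) -ℚ σ *ℚ X (B + t))) →
    A ≡ B × (s ≡ -1ℤ → d ≡ 3)
  one-rational zeros nonzero rec = OneNecessary.one-necessary d 2≤d s sgn A B n₀ A≡ 1≤B Y
      (record { zeros = λ n n< → zero-multiple D (DX n) (zeros n n<)
              ; rec = λ t → clear d D (rec t) (lin (A + (B + t)) t) (lin (A + t) (B + t)) })
      (nonzero-multiple 1≤D (DX (n₀ + B)) nonzero)
    where
    lin : ∀ a b → ι D *ℚ (X a -ℚ σ *ℚ X b) ≡ ζ (Y a ℤ.- s ℤ.* Y b)
    lin a b = begin
      ι D *ℚ (X a -ℚ σ *ℚ X b)
        ≡⟨ RS.solve 4 (λ D x s y → D RS.:* (x RS.:- s RS.:* y) RS.:= D RS.:* x RS.:- s RS.:* (D RS.:* y)) refl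
            (ι D) (X a) σ (X b) ⟩
      ι D *ℚ X a -ℚ σ *ℚ (ι D *ℚ X b)      ≡⟨ cong₂ (λ p q → p -ℚ σ *ℚ q) (DX a) (DX b) ⟩
      ζ (Y a) -ℚ ζ s *ℚ ζ (Y b)            ≡⟨ cong (ζ (Y a) -ℚ_) (sym (ζ-* s (Y b))) ⟩
      ζ (Y a) -ℚ ζ (s ℤ.* Y b)             ≡⟨ sym (ζ-- (Y a) (s ℤ.* Y b)) ⟩
      ζ (Y a ℤ.- s ℤ.* Y b)                ∎
      where open ≡-Reasoning

  two-rational : (∀ n → n < n₀ + (B + B) → X n ≡ 0ℚ) → X (n₀ + (B + B)) ≢ 0ℚ →
    (∀ t → (2ℚ *ℚ X (A + (B + (B + t))) -ℚ X (A + (B + t))) -ℚ σ *ℚ (2ℚ *ℚ X t -ℚ X (B + t)) ≡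
           r *ℚ ((2ℚ *ℚ X (A + t) -ℚ X (A + (B + t))) -ℚ σ *ℚ (2ℚ *ℚ X (B + (B + t)) -ℚ X (B + t)))) →
    A ≡ B × s ≡ 1ℤ × d ≡ 2
  two-rational zeros nonzero rec = TwoNecessary.two-necessary d 2≤d s sgn A B n₀ A≡ 1≤B Y
      (record { zeros = λ n n< → zero-multiple D (DX n) (zeros n n<)
              ; rec = λ t → clear d D (rec t) (lin (A + (B + (B + t))) (A + (B + t)) t (B + t))
                                (lin (A + t) (A + (B + t)) (B + (B + t)) (B + t)) })
      (nonzero-multiple 1≤D (DX (n₀ + (B + B))) nonzero)
    where
    lin₁ : ∀ a b → ζ (ℤ.+ 2 ℤ.* Y a ℤ.- Y b) ≡ 2ℚ *ℚ ζ (Y a) -ℚ ζ (Y b)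
    lin₁ a b = trans (ζ-- (ℤ.+ 2 ℤ.* Y a) (Y b)) (cong (_-ℚ ζ (Y b)) (ζ-* (ℤ.+ 2) (Y a)))
    lin : ∀ a b c e → ι D *ℚ ((2ℚ *ℚ X a -ℚ X b) -ℚ σ *ℚ (2ℚ *ℚ X c -ℚ X e))
                      ≡ ζ ((ℤ.+ 2 ℤ.* Y a ℤ.- Y b) ℤ.- s ℤ.* (ℤ.+ 2 ℤ.* Y c ℤ.- Y e))
    lin a b c e = begin
      ι D *ℚ ((2ℚ *ℚ X a -ℚ X b) -ℚ σ *ℚ (2ℚ *ℚ X c -ℚ X e))
        ≡⟨ RS.solve 6 (λ D s a b c e → D RS.:* ((RS.con 2ℚ RS.:* a RS.:- b) RS.:- s RS.:*
          (RS.con 2ℚ RS.:* c RS.:- e))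
             RS.:= (RS.con 2ℚ RS.:* (D RS.:* a) RS.:- D RS.:* b) RS.:- s RS.:*
               (RS.con 2ℚ RS.:* (D RS.:* c) RS.:- D RS.:* e))
             refl (ι D) σ (X a) (X b) (X c) (X e) ⟩
      (2ℚ *ℚ (ι D *ℚ X a) -ℚ ι D *ℚ X b) -ℚ σ *ℚ (2ℚ *ℚ (ι D *ℚ X c) -ℚ ι D *ℚ X e)
        ≡⟨ cong₂ (λ p q → p -ℚ σ *ℚ q) (cong₂ (λ p q → 2ℚ *ℚ p -ℚ q) (DX a) (DX b))
          (cong₂ (λ p q → 2ℚ *ℚ p -ℚ q) (DX c) (DX e)) ⟩
      (2ℚ *ℚ ζ (Y a) -ℚ ζ (Y b)) -ℚ ζ s *ℚ (2ℚ *ℚ ζ (Y c) -ℚ ζ (Y e))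
        ≡⟨ cong₂ (λ p q → p -ℚ ζ s *ℚ q) (sym (lin₁ a b)) (sym (lin₁ c e)) ⟩
      ζ (ℤ.+ 2 ℤ.* Y a ℤ.- Y b) -ℚ ζ s *ℚ ζ (ℤ.+ 2 ℤ.* Y c ℤ.- Y e)
        ≡⟨ cong (ζ (ℤ.+ 2 ℤ.* Y a ℤ.- Y b) -ℚ_) (sym (ζ-* s (ℤ.+ 2 ℤ.* Y c ℤ.- Y e))) ⟩
      ζ (ℤ.+ 2 ℤ.* Y a ℤ.- Y b) -ℚ ζ (s ℤ.* (ℤ.+ 2 ℤ.* Y c ℤ.- Y e))
        ≡⟨ sym (ζ-- (ℤ.+ 2 ℤ.* Y a ℤ.- Y b) (s ℤ.* (ℤ.+ 2 ℤ.* Y c ℤ.- Y e))) ⟩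
      ζ ((ℤ.+ 2 ℤ.* Y a ℤ.- Y b) ℤ.- s ℤ.* (ℤ.+ 2 ℤ.* Y c ℤ.- Y e)) ∎
      where open ≡-Reasoning

-- Signals on a line

-- The waves α and β arrive at a vertex of weight c = 2 / degree from above and from below,
-- and return after A and B steps.
module OneScalar (c σ : ℚ) (α β : ℕ → ℚ) (A B n₀ : ℕ) (A≡ : A ≡ suc n₀)
  (above : ∀ t → α (A + t) ≡ σ *ℚ ((2ℚ -ℚ c) *ℚ β t -ℚ (1ℚ -ℚ c) *ℚ α t))
  (below : ∀ t → β (B + t) ≡ c *ℚ α t +ℚ (1ℚ -ℚ c) *ℚ β t)
  (α-zero : ∀ t → t < n₀ → α t ≡ 0ℚ) (β-zero : ∀ t → t < B → β t ≡ 0ℚ) where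
  open RS

  -- Elimination of α. It succeeds in this form because the scattering matrix of the vertex has
  -- determinant -(1 - c)² - c(2 - c) = -1.
  rec : ∀ t → β (A + (B + t)) -ℚ σ *ℚ β t ≡ (1ℚ -ℚ c) *ℚ (β (A + t) -ℚ σ *ℚ β (B + t))
  rec t = begin
    β (A + (B + t)) -ℚ σ *ℚ β t
      ≡⟨ cong (λ n → β n -ℚ σ *ℚ β t) (NS.solve 3 (λ a b t → a NS.:+ (b NS.:+ t) NS.:= b NS.:+ (a NS.:+ t)) refl
          A B t) ⟩
    β (B + (A + t)) -ℚ σ *ℚ β t
      ≡⟨ cong (_-ℚ σ *ℚ β t) (trans (below (A + t)) (cong (λ z → c *ℚ z +ℚ (1ℚ -ℚ c) *ℚ β (A + t)) (above t))) ⟩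
    c *ℚ (σ *ℚ ((2ℚ -ℚ c) *ℚ β t -ℚ (1ℚ -ℚ c) *ℚ α t)) +ℚ (1ℚ -ℚ c) *ℚ β (A + t) -ℚ σ *ℚ β t
      ≡⟨ solve 5 (λ c σ a b b′ → c :* (σ :* ((con 2ℚ :- c) :* b :- (con 1ℚ :- c) :* a)) :+
        (con 1ℚ :- c) :* b′ :- σ :* b
           := (con 1ℚ :- c) :* (b′ :- σ :* (c :* a :+ (con 1ℚ :- c) :* b))) refl c σ (α t) (β t) (β (A + t)) ⟩
    (1ℚ -ℚ c) *ℚ (β (A + t) -ℚ σ *ℚ (c *ℚ α t +ℚ (1ℚ -ℚ c) *ℚ β t))
      ≡⟨ cong (λ z → (1ℚ -ℚ c) *ℚ (β (A + t) -ℚ σ *ℚ z)) (sym (below t)) ⟩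
    (1ℚ -ℚ c) *ℚ (β (A + t) -ℚ σ *ℚ β (B + t)) ∎
    where open ≡-Reasoning

  module _ (1≤B : 1 ≤ B) where
    zeros : ∀ t → t < n₀ + B → β t ≡ 0ℚ
    zeros = <-rec (λ t → t < n₀ + B → β t ≡ 0ℚ) λ t ih t< → case t <? B of λ where
      (yes t<B) → β-zero t t<B
      (no t≮B)  → let u = t ∸ B; t≡ = ℕ.m+[n∸m]≡n (ℕ.≮⇒≥ t≮B)
                      u<n₀ = ℕ.+-cancelˡ-< B u n₀ (subst₂ _<_ (sym t≡) (ℕ.+-comm n₀ B) t<)
                      u<t = subst (u <_) t≡ (ℕ.m<n+m u 1≤B) in
        trans (cong β (sym t≡)) (trans (below u)
          (trans (cong₂ (λ a b → c *ℚ a +ℚ (1ℚ -ℚ c) *ℚ b) (α-zero u u<n₀)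
            (ih u<t (ℕ.<-≤-trans u<n₀ (ℕ.m≤m+n n₀ B))))
            (solve 1 (λ c → c :* con 0ℚ :+ (con 1ℚ :- c) :* con 0ℚ := con 0ℚ) refl c)))

    first : β (n₀ + B) ≡ c *ℚ α n₀
    first = trans (cong β (ℕ.+-comm n₀ B)) (trans (below n₀)
      (trans (cong (λ b → c *ℚ α n₀ +ℚ (1ℚ -ℚ c) *ℚ b) (zeros n₀ (ℕ.m<m+n n₀ 1≤B)))
        (solve 2 (λ c a → c :* a :+ (con 1ℚ :- c) :* con 0ℚ := c :* a) refl c (α n₀))))

-- Below the first vertex there is, at distance b, a vertex with three children and, at distance
-- 2b, the leaves; γ and δ arrive at the second vertex from above and from below.
module TwoScalar (c σ : ℚ) (α β γ δ : ℕ → ℚ) (A b n₀ : ℕ) (A≡ : A ≡ suc n₀) (1≤b : 1 ≤ b)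
  (above : ∀ t → α (A + t) ≡ σ *ℚ ((2ℚ -ℚ c) *ℚ β t -ℚ (1ℚ -ℚ c) *ℚ α t))
  (γ-law : ∀ t → γ (b + t) ≡ c *ℚ α t +ℚ (1ℚ -ℚ c) *ℚ β t)
  (β-law : ∀ t → β (b + t) ≡ (2ℚ -ℚ ½) *ℚ δ t -ℚ (1ℚ -ℚ ½) *ℚ γ t)
  (δ-law : ∀ t → δ (b + (b + t)) ≡ ½ *ℚ γ t +ℚ (1ℚ -ℚ ½) *ℚ δ t)
  (α-zero : ∀ t → t < n₀ → α t ≡ 0ℚ) (β-zero : ∀ t → t < b → β t ≡ 0ℚ)
  (γ-zero : ∀ t → t < b → γ t ≡ 0ℚ) (δ-zero : ∀ t → t < b + b → δ t ≡ 0ℚ) where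
  open RS

  private
    shift< : ∀ {t u} k → k + u ≡ t → t < n₀ + k → u < n₀
    shift< {u = u} k refl t< = ℕ.+-cancelˡ-< k u n₀ (subst (k + u <_) (ℕ.+-comm n₀ k) t<)

    smaller : ∀ {t u} k → 1 ≤ k → k + u ≡ t → u < t
    smaller {u = u} k 1≤k refl = ℕ.m<n+m u 1≤k

    record Quiet (t : ℕ) : Set where
      field
        γ0 : t < n₀ + b → γ t ≡ 0ℚ
        β0 : t < n₀ + (b + b) → β t ≡ 0ℚ
        δ0 : t < n₀ + (b + (b + b)) → δ t ≡ 0ℚ

    lin-zero : ∀ x y {p q : ℚ} → p ≡ 0ℚ → q ≡ 0ℚ → x *ℚ p +ℚ y *ℚ q ≡ 0ℚ
    lin-zero x y refl refl = solve 2 (λ x y → x :* con 0ℚ :+ y :* con 0ℚ := con 0ℚ) refl x y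

    drop : ∀ {t u} k l → k + u ≡ t → t < n₀ + (k + l) → u < n₀ + l
    drop {u = u} k l refl t< = ℕ.+-cancelˡ-< k u (n₀ + l)
      (subst (k + u <_) (NS.solve 3 (λ n k l → n NS.:+ (k NS.:+ l) NS.:= k NS.:+ (n NS.:+ l)) refl n₀ k l) t<)

  -- The wave front meets the first vertex no earlier than n₀ and the second one b steps later. From
  -- there it needs b steps to come back to the first vertex and 2b steps to come back from the
  -- leaves. The three bounds feed each other and are proved together.
  quiet : ∀ t → Quiet t
  quiet = <-rec Quiet λ t ih → record
    { γ0 = λ t< → case t <? b of λ where
        (yes t<b) → γ-zero t t<b
        (no t≮b) → let t≡ = ℕ.m+[n∸m]≡n (ℕ.≮⇒≥ t≮b); u<n₀ = shift< b t≡ t< in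
          trans (cong γ (sym t≡)) (trans (γ-law (t ∸ b)) (lin-zero c (1ℚ -ℚ c) (α-zero _ u<n₀)
            (Quiet.β0 (ih (smaller b 1≤b t≡)) (ℕ.<-≤-trans u<n₀ (ℕ.m≤m+n n₀ (b + b))))))
    ; β0 = λ t< → case t <? b of λ where
        (yes t<b) → β-zero t t<b
        (no t≮b) → let t≡ = ℕ.m+[n∸m]≡n (ℕ.≮⇒≥ t≮b); q = ih (smaller b 1≤b t≡); u< = drop b b t≡ t< in
          trans (cong β (sym t≡)) (trans (β-law (t ∸ b)) (cong₂ (λ x y → (2ℚ -ℚ ½) *ℚ x -ℚ (1ℚ -ℚ ½) *ℚ y)
            (Quiet.δ0 q (ℕ.<-≤-trans u< (ℕ.+-monoʳ-≤ n₀ (ℕ.m≤m+n b (b + b))))) (Quiet.γ0 q u<)))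
    ; δ0 = λ t< → case t <? b + b of λ where
        (yes t<bb) → δ-zero t t<bb
        (no t≮bb) → let t≡ = ℕ.m+[n∸m]≡n (ℕ.≮⇒≥ t≮bb); q = ih (smaller (b + b) (ℕ.≤-trans 1≤b (ℕ.m≤m+n b b)) t≡)
                        u< = drop (b + b) b t≡ (subst (λ n → t < n₀ + n) (sym (ℕ.+-assoc b b b)) t<) in
          trans (cong δ (trans (sym t≡) (ℕ.+-assoc b b (t ∸ (b + b))))) (trans (δ-law (t ∸ (b + b)))
            (lin-zero ½ (1ℚ -ℚ ½) (Quiet.γ0 q u<) (Quiet.δ0 q
              (ℕ.<-≤-trans u< (ℕ.+-monoʳ-≤ n₀ (ℕ.m≤m+n b (b + b)))))))
    }

  -- δ delayed by b, so that the recurrence below holds from the start.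
  X : ℕ → ℚ
  X t = if t <ᵇ b then 0ℚ else δ (t ∸ b)

  X-shift : ∀ t → X (b + t) ≡ δ t
  X-shift t rewrite <ᵇ-false {b + t} {b} (ℕ.m≤m+n b t) | ℕ.m+n∸m≡n b t = refl

  delayed-bounded : BoundedDenominators δ → BoundedDenominators X
  delayed-bounded (D , 1≤D , Y , h) = D , 1≤D , Z , Z-multiple
    where
    Z : ℕ → ℤ
    Z t = if t <ᵇ b then 0ℤ else Y (t ∸ b)
    Z-multiple : ∀ t → ι D *ℚ X t ≡ ζ (Z t)
    Z-multiple t with t <ᵇ b
    ... | true  = ℚ.*-zeroʳ (ι D)
    ... | false = h (t ∸ b)

  private
    H = b + b

    -- The weight ½ of the vertex with three children makes `δ-law` read γ(t) = 2δ(2b+t) - δ(t);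
    -- inserted in `β-law` this gives β(b+t) = 2δ(t) - δ(2b+t). Before time b all terms vanish,
    -- thanks to the delay. This is the origin of the combinations 2X - X in `TwoInterfaces`.
    β≡ : ∀ t → β t ≡ 2ℚ *ℚ X t -ℚ X (H + t)
    β≡ t with t <? b
    ... | yes t<b = trans (β-zero t t<b) (sym (cong₂ (λ x y → 2ℚ *ℚ x -ℚ y) X0
            (trans (cong X (ℕ.+-assoc b b t)) (trans (X-shift (b + t)) (δ-zero (b + t) (ℕ.+-monoʳ-< b t<b))))))
      where
      X0 : X t ≡ 0ℚ
      X0 rewrite <ᵇ-true t<b = refl
    ... | no t≮b = subst (λ t → β t ≡ 2ℚ *ℚ X t -ℚ X (H + t)) (ℕ.m+[n∸m]≡n (ℕ.≮⇒≥ t≮b)) (late (t ∸ b))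
      where
      late : ∀ u → β (b + u) ≡ 2ℚ *ℚ X (b + u) -ℚ X (H + (b + u))
      late u = trans (β-law u) (sym (trans (cong₂ (λ x y → 2ℚ *ℚ x -ℚ y) (X-shift u)
          (trans (cong X (ℕ.+-assoc b b (b + u))) (trans (X-shift (b + (b + u))) (δ-law u))))
        (solve 2 (λ d g → con 2ℚ :* d :- (con ½ :* g :+ (con 1ℚ :- con ½) :* d)
              := (con 2ℚ :- con ½) :* d :- (con 1ℚ :- con ½) :* g)
          refl (δ u) (γ u))))

    γ≡ : ∀ t → γ (b + t) ≡ 2ℚ *ℚ X (H + (H + t)) -ℚ X (H + t)
    γ≡ t = sym (trans (cong₂ (λ x y → 2ℚ *ℚ x -ℚ y)
        (trans (cong X (trans (ℕ.+-assoc b b (H + t)) (cong (λ n → b + (b + n)) (ℕ.+-assoc b b t))))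
          (trans (X-shift (b + (b + (b + t)))) (δ-law (b + t))))
        (trans (cong X (ℕ.+-assoc b b t)) (X-shift (b + t))))
      (solve 2 (λ d g → con 2ℚ :* (con ½ :* g :+ (con 1ℚ :- con ½) :* d) :- d := g) refl
          (δ (b + t)) (γ (b + t))))

    -- The same elimination of α as for one vertex: what leaves the first vertex downwards now
    -- arrives as γ(b+t) instead of returning as β(B+t).
    rec-γβ : ∀ t → γ (b + (A + t)) -ℚ σ *ℚ β t ≡ (1ℚ -ℚ c) *ℚ (β (A + t) -ℚ σ *ℚ γ (b + t))
    rec-γβ t = trans (cong (_-ℚ σ *ℚ β t) (trans (γ-law (A + t))
      (cong (λ z → c *ℚ z +ℚ (1ℚ -ℚ c) *ℚ β (A + t)) (above t))))
      (trans (solve 5 (λ c σ a b b′ → c :* (σ :* ((con 2ℚ :- c) :* b :- (con 1ℚ :- c) :* a)) :+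
        (con 1ℚ :- c) :* b′ :- σ :* b
           := (con 1ℚ :- c) :* (b′ :- σ :* (c :* a :+ (con 1ℚ :- c) :* b))) refl c σ (α t) (β t) (β (A + t)))
        (cong (λ z → (1ℚ -ℚ c) *ℚ (β (A + t) -ℚ σ *ℚ z)) (sym (γ-law t))))

  rec : ∀ t → (2ℚ *ℚ X (A + (H + (H + t))) -ℚ X (A + (H + t))) -ℚ σ *ℚ (2ℚ *ℚ X t -ℚ X (H + t)) ≡
    (1ℚ -ℚ c) *ℚ ((2ℚ *ℚ X (A + t) -ℚ X (A + (H + t))) -ℚ σ *ℚ (2ℚ *ℚ X (H + (H + t)) -ℚ X (H + t)))
  rec t = trans (cong₂ (λ x y → x -ℚ σ *ℚ y)
      (trans (cong₂ (λ m n → 2ℚ *ℚ X m -ℚ X n)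
        (NS.solve 3 (λ a b t → a NS.:+ (b NS.:+ (b NS.:+ t)) NS.:= b NS.:+ (b NS.:+ (a NS.:+ t))) refl
            A H t) swap) (sym (γ≡ (A + t))))
      (sym (β≡ t)))
    (trans (rec-γβ t) (cong₂ (λ x y → (1ℚ -ℚ c) *ℚ (x -ℚ σ *ℚ y))
      (trans (β≡ (A + t)) (cong (λ n → 2ℚ *ℚ X (A + t) -ℚ X n) (sym swap))) (γ≡ t)))
    where
    swap : A + (H + t) ≡ H + (A + t)
    swap = NS.solve 3 (λ a b t → a NS.:+ (b NS.:+ t) NS.:= b NS.:+ (a NS.:+ t)) refl A H t

  zeros : ∀ t → t < n₀ + (H + H) → X t ≡ 0ℚ
  zeros t t< with t <? b
  ... | yes t<b rewrite <ᵇ-true t<b = refl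
  ... | no t≮b rewrite <ᵇ-false {t} {b} (ℕ.≮⇒≥ t≮b) =
    Quiet.δ0 (quiet (t ∸ b)) (drop b (b + (b + b)) (ℕ.m+[n∸m]≡n (ℕ.≮⇒≥ t≮b))
      (subst (λ n → t < n₀ + n) (ℕ.+-assoc b b (b + b)) t<))

  first : X (n₀ + (H + H)) ≡ ½ *ℚ (c *ℚ α n₀)
  first = begin
    X (n₀ + (H + H))
      ≡⟨ cong X (NS.solve 2 (λ n b → n NS.:+ ((b NS.:+ b) NS.:+ (b NS.:+ b))
            NS.:= b NS.:+ (b NS.:+ (b NS.:+ (b NS.:+ n)))) refl n₀ b) ⟩
    X (b + (b + (b + (b + n₀))))
      ≡⟨ trans (X-shift (b + (b + (b + n₀)))) (δ-law (b + n₀)) ⟩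
    ½ *ℚ γ (b + n₀) +ℚ (1ℚ -ℚ ½) *ℚ δ (b + n₀)
      ≡⟨ cong₂ (λ x y → ½ *ℚ x +ℚ (1ℚ -ℚ ½) *ℚ y)
           (trans (γ-law n₀) (cong (λ z → c *ℚ α n₀ +ℚ (1ℚ -ℚ c) *ℚ z)
             (Quiet.β0 (quiet n₀) (ℕ.m<m+n n₀ (ℕ.≤-trans 1≤b (ℕ.m≤m+n b b))))))
           (Quiet.δ0 (quiet (b + n₀)) (subst (_< n₀ + (b + (b + b))) (ℕ.+-comm n₀ b)
             (ℕ.+-monoʳ-< n₀ (ℕ.m<m+n b (ℕ.≤-trans 1≤b (ℕ.m≤m+n b b)))))) ⟩
    ½ *ℚ (c *ℚ α n₀ +ℚ (1ℚ -ℚ c) *ℚ 0ℚ) +ℚ (1ℚ -ℚ ½) *ℚ 0ℚ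
      ≡⟨ solve 2 (λ c a → con ½ :* (c :* a :+ (con 1ℚ :- c) :* con 0ℚ) :+ (con 1ℚ :- con ½) :* con 0ℚ
            := con ½ :* (c :* a)) refl c (α n₀) ⟩
    ½ *ℚ (c *ℚ α n₀) ∎
    where open ≡-Reasoning

module LineDelay (σ : ℚ) (w : ℕ → ℕ) (D₀ U₀ : ℕ → ℚ) where
  open Line σ w D₀ U₀
  open RS

  through : ∀ t m → w (suc m) ≡ 1 → out t (suc m) ≡ U t (suc (suc m)) +ℚ D t (suc m)
  through t m w≡1 = trans (cong (λ n → 2/ (suc n) *ℚ (ι n *ℚ U t (suc (suc m)) +ℚ D t (suc m))) w≡1)
    (solve 2 (λ u d → con (2/ 2) :* (con (ι 1) :* u :+ d) := u :+ d) refl (U t (suc (suc m))) (D t (suc m)))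

  run-D : ∀ n a m → m ≡ n + a → (∀ i → i < n → w (suc i + a) ≡ 1) → ∀ t → D (n + t) (suc m) ≡ D t (suc a)
  run-D zero    a m refl ones t = refl
  run-D (suc n) a m refl ones t = trans
    (trans (cong (_-ℚ U (n + t) (suc (suc (n + a)))) (through (n + t) (n + a) (ones n ℕ.≤-refl)))
      (solve 2 (λ u d → u :+ d :- u := d) refl (U (n + t) (suc (suc (n + a)))) (D (n + t) (suc (n + a)))))
    (run-D n a (n + a) refl (λ i i<n → ones i (ℕ.m<n⇒m<1+n i<n)) t)

  run-U : ∀ n a m → m ≡ n + a → (∀ i → i < n → w (suc i + a) ≡ 1) → ∀ t → U (n + t) (suc a) ≡ U t (suc m)
  run-U zero    a m refl ones t = refl
  run-U (suc n) a m refl ones t = trans (cong (λ s → U s (suc a)) (sym (ℕ.+-suc n t)))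
    (trans (run-U n a (n + a) refl (λ i i<n → ones i (ℕ.m<n⇒m<1+n i<n)) (suc t))
      (trans (cong (_-ℚ D t (suc (n + a))) (through t (n + a) (ones n ℕ.≤-refl)))
        (solve 2 (λ u d → u :+ d :- d := u) refl (U t (suc (suc (n + a)))) (D t (suc (n + a))))))

  leaf : ∀ t m → w (suc m) ≡ 0 → U (suc t) (suc m) ≡ D t (suc m)
  leaf t m w≡0 = trans (cong (λ n → 2/ (suc n) *ℚ (ι n *ℚ U t (suc (suc m)) +ℚ D t (suc m)) -ℚ D t (suc m)) w≡0)
    (solve 2 (λ u d → con 2ℚ :* (con 0ℚ :* u :+ d) :- d := d) refl (U t (suc (suc m))) (D t (suc m)))

  module _ (m e : ℕ) (w≡ : w (suc m) ≡ e) where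
    private
      c = 2/ (suc e)
      out≡ : ∀ t → out t (suc m) ≡ (2ℚ -ℚ c) *ℚ U t (suc (suc m)) +ℚ c *ℚ D t (suc m)
      out≡ t = begin
        out t (suc m)
          ≡⟨ cong (λ n → 2/ (suc n) *ℚ (ι n *ℚ U t (suc (suc m)) +ℚ D t (suc m))) w≡ ⟩
        c *ℚ (ι e *ℚ U t (suc (suc m)) +ℚ D t (suc m))
          ≡⟨ solve 4 (λ c i u d → c :* (i :* u :+ d) := (c :* (con 1ℚ :+ i) :- c) :* u :+ c :* d) refl
              c (ι e) (U t (suc (suc m))) (D t (suc m)) ⟩
        (c *ℚ ι (suc e) -ℚ c) *ℚ U t (suc (suc m)) +ℚ c *ℚ D t (suc m)
          ≡⟨ cong (λ z → (z -ℚ c) *ℚ U t (suc (suc m)) +ℚ c *ℚ D t (suc m)) (2/-inverse e) ⟩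
        (2ℚ -ℚ c) *ℚ U t (suc (suc m)) +ℚ c *ℚ D t (suc m) ∎
        where open ≡-Reasoning

    scatter-U : ∀ t → U (suc t) (suc m) ≡ (2ℚ -ℚ c) *ℚ U t (suc (suc m)) -ℚ (1ℚ -ℚ c) *ℚ D t (suc m)
    scatter-U t = trans (cong (_-ℚ D t (suc m)) (out≡ t))
      (solve 3 (λ c u d → (con 2ℚ :- c) :* u :+ c :* d :- d := (con 2ℚ :- c) :* u :- (con 1ℚ :- c) :* d) refl
          c (U t (suc (suc m))) (D t (suc m)))

    scatter-D : ∀ t → D (suc t) (suc (suc m)) ≡ c *ℚ D t (suc m) +ℚ (1ℚ -ℚ c) *ℚ U t (suc (suc m))
    scatter-D t = trans (cong (_-ℚ U t (suc (suc m))) (out≡ t))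
      (solve 3 (λ c u d → (con 2ℚ :- c) :* u :+ c :* d :- u := c :* d :+ (con 1ℚ :- c) :* u) refl
          c (U t (suc (suc m))) (D t (suc m)))

-- Read from the inside: one step of scattering, a steps of transit, one step of reflection, a steps
-- of transit back.
round-trip : ∀ a t → (suc a + suc a) + t ≡ a + suc (a + suc t)
round-trip a t = trans (cong (λ n → suc (n + t)) (ℕ.+-suc a a))
  (trans (cong (λ n → suc (suc n)) (ℕ.+-assoc a a t))
  (sym (trans (cong (λ n → a + suc n) (ℕ.+-suc a t))
    (trans (ℕ.+-suc a (suc (a + t))) (cong suc (ℕ.+-suc a (a + t)))))))

half-< : ∀ {t b} → t < suc b + suc b → ¬ (t ≤ b) → Σ ℕ λ j → j ≤ b × t ≡ b + suc j
half-< {t} {b} t< t≰b = t ∸ suc b , ℕ.≤-pred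
  (ℕ.+-cancelˡ-< (suc b) (t ∸ suc b) (suc b) (subst (_< suc b + suc b) (sym t≡) t<)) ,
  trans (sym t≡) (sym (ℕ.+-suc b (t ∸ suc b)))
  where
  t≡ : suc b + (t ∸ suc b) ≡ t
  t≡ = ℕ.m+[n∸m]≡n (ℕ.≰⇒> t≰b)

-- The line with a first vertex of e children at level suc a, started from a single wave
-- leaving that vertex upwards.
module Impulse (σ : ℚ) (w : ℕ → ℕ) (a e : ℕ) (w-top : ∀ i → i < a → w (suc i) ≡ 1) (w≡e : w (suc a) ≡ e) where
  U₀ : ℕ → ℚ
  U₀ m = if m ≡ᵇ suc a then 1ℚ else 0ℚ
  open Line σ w (λ _ → 0ℚ) U₀ public
  open LineDelay σ w (λ _ → 0ℚ) U₀ public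

  c : ℚ
  c = 2/ (suc e)
  A n₀ : ℕ
  n₀ = a + suc a
  A  = suc a + suc a

  α β : ℕ → ℚ
  α t = D t (suc a)
  β t = U t (suc (suc a))

  U₀-off : ∀ {m} → m ≢ suc a → U₀ m ≡ 0ℚ
  U₀-off {m} ne rewrite ≡ᵇ-false ne = refl

  private
    w-top′ : ∀ i → i < a → w (suc i + 0) ≡ 1
    w-top′ i i<a = trans (cong w (ℕ.+-identityʳ (suc i))) (w-top i i<a)

    reflect : ∀ t → D (a + suc t) (suc a) ≡ σ *ℚ U t 1
    reflect t = run-D a 0 a (sym (ℕ.+-identityʳ a)) w-top′ (suc t)

  above : ∀ t → α (A + t) ≡ σ *ℚ ((2ℚ -ℚ c) *ℚ β t -ℚ (1ℚ -ℚ c) *ℚ α t)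
  above t = trans (cong α (round-trip a t)) (trans (reflect (a + suc t))
    (cong (σ *ℚ_) (trans (run-U a 0 a (sym (ℕ.+-identityʳ a)) w-top′ (suc t)) (scatter-U a e w≡e t))))

  private
    U-early : ∀ j → j ≤ a → U j 1 ≡ U₀ (suc j)
    U-early j j≤a = trans (cong (λ s → U s 1) (sym (ℕ.+-identityʳ j)))
      (run-U j 0 j (sym (ℕ.+-identityʳ j)) (λ i i<j → w-top′ i (ℕ.<-≤-trans i<j j≤a)) 0)

  -- During the first a steps only the zero initial values of D arrive; afterwards come reflected
  -- entries of `U₀`, and the impulse is the last of these, at time n₀.
  α-zero : ∀ t → t < n₀ → α t ≡ 0ℚ
  α-zero t t< with t ≤? a
  ... | yes t≤a = trans (cong (λ s → D s (suc a)) (sym (ℕ.+-identityʳ t)))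
      (run-D t (a ∸ t) a (sym (ℕ.m+[n∸m]≡n t≤a)) (λ i i<t → w-top (i + (a ∸ t))
        (ℕ.<-≤-trans (ℕ.+-monoˡ-< (a ∸ t) i<t) (ℕ.≤-reflexive (ℕ.m+[n∸m]≡n t≤a)))) 0)
  ... | no t≰a with half-< (ℕ.m<n⇒m<1+n t<) t≰a
  ...   | j , j≤a , refl = trans (reflect j)
    (trans (cong (σ *ℚ_) (trans (U-early j j≤a) (U₀-off (ℕ.<⇒≢ (ℕ.+-cancelˡ-< a (suc j) (suc a) t<)))))
                             (ℚ.*-zeroʳ σ))

  α-first : α n₀ ≡ σ
  α-first = trans (reflect a) (trans (cong (σ *ℚ_) (trans (U-early a ℕ.≤-refl) impulse)) (ℚ.*-identityʳ σ))
    where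
    impulse : U₀ (suc a) ≡ 1ℚ
    impulse rewrite ≡ᵇ-true {a} refl = refl

  -- A path of length suc b hanging below the vertex of level suc m, m ≥ a.
  module Leg (m b : ℕ) (a≤m : a ≤ m) (w-leg : ∀ i → i < b → w (suc i + suc m) ≡ 1)
    (w-leaf : w (suc b + suc m) ≡ 0) where
    leg-return : ∀ t → U (b + suc (b + t)) (suc (suc m)) ≡ D t (suc (suc m))
    leg-return t = trans (run-U b (suc m) (b + suc m) refl w-leg (suc (b + t)))
      (trans (leaf (b + t) (b + suc m) w-leaf) (run-D b (suc m) (b + suc m) refl w-leg t))

    leg-zero : ∀ t → t < suc b + suc b → U t (suc (suc m)) ≡ 0ℚ
    leg-zero t t< with t ≤? b
    ... | yes t≤b = trans (cong (λ s → U s (suc (suc m))) (sym (ℕ.+-identityʳ t)))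
        (trans (run-U t (suc m) (t + suc m) refl (λ i i<t → w-leg i (ℕ.<-≤-trans i<t t≤b)) 0)
          (U₀-off (ℕ.<⇒≢ (s≤s (ℕ.≤-trans (s≤s a≤m) (ℕ.m≤n+m (suc m) t))) ∘ sym)))
    ... | no t≰b with half-< t< t≰b
    ...   | j , j≤b , refl = trans (run-U b (suc m) (b + suc m) refl w-leg (suc j))
        (trans (leaf j (b + suc m) w-leaf) (trans (cong (λ s → D s (suc (b + suc m))) (sym (ℕ.+-identityʳ j)))
          (run-D j (b ∸ j + suc m) (b + suc m) (trans (cong (_+ suc m) (sym (ℕ.m+[n∸m]≡n j≤b)))
            (ℕ.+-assoc j (b ∸ j) (suc m)))
            (λ i i<j → trans (cong w (cong suc (sym (ℕ.+-assoc i (b ∸ j) (suc m)))))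
              (w-leg (i + (b ∸ j)) (ℕ.<-≤-trans (ℕ.+-monoˡ-< (b ∸ j) i<j)
                (ℕ.≤-reflexive (ℕ.m+[n∸m]≡n j≤b))))) 0)))

  c≢0 : c ≢ 0ℚ
  c≢0 eq = contradiction (trans (sym (2/-inverse e))
    (trans (cong (_*ℚ ι (suc e)) eq) (ℚ.*-zeroˡ (ι (suc e))))) λ ()

unit-cancel : ∀ {s} → Sign s → ∀ c → c *ℚ ζ s ≡ 0ℚ → c ≡ 0ℚ
unit-cancel plus  c eq = trans (sym (ℚ.*-identityʳ c)) eq
unit-cancel minus c eq = trans (RS.solve 1 (λ c → c RS.:= RS.con (⊖ 1ℚ) RS.:* (c RS.:* RS.con (⊖ 1ℚ))) refl
    c) (cong (⊖ 1ℚ *ℚ_) eq)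

module OneVertexLine (s : ℤ) (sgn : Sign s) (w : ℕ → ℕ) (a b e : ℕ) (2≤e : 2 ≤ e)
  (w-top : ∀ i → i < a → w (suc i) ≡ 1) (w≡e : w (suc a) ≡ e)
  (w-leg : ∀ i → i < b → w (suc i + suc a) ≡ 1) (w-leaf : w (suc b + suc a) ≡ 0) where
  open Impulse (ζ s) w a e w-top w≡e
  open Leg a b ℕ.≤-refl w-leg w-leaf
  private
    Bℓ = suc b + suc b
    below : ∀ t → β (Bℓ + t) ≡ c *ℚ α t +ℚ (1ℚ -ℚ c) *ℚ β t
    below t = trans (cong β (round-trip b t)) (trans (leg-return (suc t)) (scatter-D a e w≡e t))
    open OneScalar c (ζ s) α β A Bℓ n₀ refl above below α-zero leg-zero

  one-line : ∀ T → (∀ t → U (suc T + t) (suc (suc a)) ≡ U t (suc (suc a))) →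
    suc a + suc a ≡ Bℓ × (s ≡ -1ℤ → e ≡ 3)
  one-line T period = one-rational e 2≤e s sgn A Bℓ n₀ refl z<s β (periodic⇒bounded T β period) (zeros z<s)
    (λ eq → c≢0 (unit-cancel sgn c (trans (sym (trans (first z<s) (cong (c *ℚ_) α-first))) eq))) rec

module TwoVertexLine (s : ℤ) (sgn : Sign s) (w : ℕ → ℕ) (a b e : ℕ) (2≤e : 2 ≤ e)
  (w-top : ∀ i → i < a → w (suc i) ≡ 1) (w≡e : w (suc a) ≡ e)
  (w-mid : ∀ i → i < b → w (suc i + suc a) ≡ 1) (w≡3 : w (suc (b + suc a)) ≡ 3)
  (w-leg : ∀ i → i < b → w (suc i + suc (b + suc a)) ≡ 1) (w-leaf : w (suc b + suc (b + suc a)) ≡ 0) where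
  open Impulse (ζ s) w a e w-top w≡e
  private
    m = b + suc a
    a≤m : a ≤ m
    a≤m = ℕ.≤-trans (ℕ.n≤1+n a) (ℕ.m≤n+m (suc a) b)
    open Leg m b a≤m w-leg w-leaf
    γ δ : ℕ → ℚ
    γ t = D t (suc m)
    δ t = U t (suc (suc m))
    γ-law : ∀ t → γ (suc b + t) ≡ c *ℚ α t +ℚ (1ℚ -ℚ c) *ℚ β t
    γ-law t = trans (cong γ (sym (ℕ.+-suc b t)))
      (trans (run-D b (suc a) m refl w-mid (suc t)) (scatter-D a e w≡e t))
    β-law : ∀ t → β (suc b + t) ≡ (2ℚ -ℚ ½) *ℚ δ t -ℚ (1ℚ -ℚ ½) *ℚ γ t
    β-law t = trans (cong β (sym (ℕ.+-suc b t)))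
      (trans (run-U b (suc a) m refl w-mid (suc t)) (scatter-U m 3 w≡3 t))
    δ-law : ∀ t → δ (suc b + (suc b + t)) ≡ ½ *ℚ γ t +ℚ (1ℚ -ℚ ½) *ℚ δ t
    δ-law t = trans (cong δ (trans (sym (ℕ.+-assoc (suc b) (suc b) t)) (round-trip b t)))
      (trans (leg-return (suc t)) (scatter-D m 3 w≡3 t))
    β-zero : ∀ t → t < suc b → β t ≡ 0ℚ
    β-zero t t<b = trans (cong (λ s → U s (suc (suc a))) (sym (ℕ.+-identityʳ t)))
      (trans (run-U t (suc a) (t + suc a) refl (λ i i<t → w-mid i (ℕ.<-≤-trans i<t (ℕ.≤-pred t<b))) 0)
        (U₀-off (ℕ.<⇒≢ (s≤s (ℕ.m≤n+m (suc a) t)) ∘ sym)))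
    γ-zero : ∀ t → t < suc b → γ t ≡ 0ℚ
    γ-zero t (s≤s t≤b) = trans (cong (λ s → D s (suc m)) (sym (ℕ.+-identityʳ t)))
      (run-D t (b ∸ t + suc a) m (trans (cong (_+ suc a) (sym (ℕ.m+[n∸m]≡n t≤b))) (ℕ.+-assoc t (b ∸ t) (suc a)))
        (λ i i<t → trans (cong w (cong suc (sym (ℕ.+-assoc i (b ∸ t) (suc a)))))
          (w-mid (i + (b ∸ t)) (ℕ.<-≤-trans (ℕ.+-monoˡ-< (b ∸ t) i<t) (ℕ.≤-reflexive (ℕ.m+[n∸m]≡n t≤b))))) 0)
    open TwoScalar c (ζ s) α β γ δ A (suc b) n₀ refl z<s above γ-law β-law δ-law α-zero β-zero γ-zero leg-zero

  two-line : ∀ T → (∀ t → U (suc T + t) (suc (suc m)) ≡ U t (suc (suc m))) →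
    suc a + suc a ≡ suc b + suc b × s ≡ 1ℤ × e ≡ 2
  two-line T period = two-rational e 2≤e s sgn A (suc b + suc b) n₀ refl z<s X
    (delayed-bounded (periodic⇒bounded T δ period)) zeros
    (λ eq → c≢0 (unit-cancel sgn c (trans (double (c *ℚ ζ s))
      (cong (2ℚ *ℚ_) (trans (sym (trans first (cong (λ z → ½ *ℚ (c *ℚ z)) α-first))) eq))))) rec
    where
    double : ∀ x → x ≡ 2ℚ *ℚ (½ *ℚ x)
    double = RS.solve 1 (λ x → x RS.:= RS.con 2ℚ RS.:* (RS.con ½ RS.:* x)) refl

-- Classification

nth-++ : ∀ xs ys i → nth (xs ++ ys) (i + length xs) ≡ nth ys i
nth-++ []       ys i = cong (nth ys) (ℕ.+-identityʳ i)
nth-++ (x ∷ xs) ys i = trans (cong (nth (x ∷ xs ++ ys)) (ℕ.+-suc i (length xs))) (nth-++ xs ys i)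

after-ones : ∀ a xs i → nth (replicate a 1 ++ xs) (i + a) ≡ nth xs i
after-ones a xs i = trans (cong (nth (replicate a 1 ++ xs)) (ℕ.+-comm i a)) (nth-replicate-++ a i xs)

after-branch : ∀ a x xs i → nth (replicate a 1 ++ x ∷ xs) (i + suc a) ≡ nth xs i
after-branch a x xs i = trans (cong (nth (replicate a 1 ++ x ∷ xs)) (ℕ.+-suc i a))
  (after-ones a (x ∷ xs) (suc i))

nth-ones : ∀ b i → i < b → nth (replicate b 1) i ≡ 1
nth-ones (suc b) zero    _         = refl
nth-ones (suc b) (suc i) (s≤s i<b) = nth-ones b i i<b

nth-ones-end : ∀ b → nth (replicate b 1) b ≡ 0
nth-ones-end zero    = refl
nth-ones-end (suc b) = nth-ones-end b

-- Records, so that conversion compares the lists and never unfolds the graphs (likewise for Form below).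
record Returns (T : ℕ) (d : List ℕ) : Set where
  constructor returns
  field returning : UpowIsId (B d) (suc T)
open Returns

module _ (pre : List ℕ) (y : ℕ) {s : ℤ} (sgn : Sign s) (a b x : ℕ) (2≤x : 2 ≤ x) (T : ℕ) where
  private
    i = length pre

    below : ∀ ys j n → j < n → length ys ≡ suc n → suc j + i < length (pre ++ ys)
    below ys j n j<n len = subst (suc j + i <_)
      (trans (ℕ.+-comm (suc n) i) (trans (cong (i +_) (sym len)) (sym (List.length-++ pre))))
      (ℕ.+-monoˡ-< i (s≤s j<n))

  -- The level of `y` becomes the reflecting level 0 of the line. It is used with the root and sign
  -- 1, or with a branching level and sign -1.
  one-branching : let ds = pre ++ y ∷ replicate a 1 ++ x ∷ replicate b 1 in
    All (1 ≤_) ds → Profile (nth ds) i (ζ s) → Returns T ds →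
    suc a + suc a ≡ suc b + suc b × (s ≡ -1ℤ → x ≡ 3)
  one-branching ps P h = one-line T λ t →
    proj₂ (line-periodic ds ps P (suc T) (returning h) (λ _ → 0ℚ) _ t (suc a)
      (below (y ∷ replicate a 1 ++ x ∷ replicate b 1) a
      (suc (a + b)) (s≤s (ℕ.m≤m+n a b)) (cong suc len)))
    where
    ds = pre ++ y ∷ replicate a 1 ++ x ∷ replicate b 1
    w : ℕ → ℕ
    w m = nth ds (m + i)
    w-suc : ∀ j → w (suc j) ≡ nth (replicate a 1 ++ x ∷ replicate b 1) j
    w-suc j = nth-++ pre (y ∷ replicate a 1 ++ x ∷ replicate b 1) (suc j)
    len : length (replicate a 1 ++ x ∷ replicate b 1) ≡ suc (a + b)
    len = trans (List.length-++ (replicate a 1))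
      (trans (cong₂ (λ m n → m + suc n) (List.length-replicate a) (List.length-replicate b)) (ℕ.+-suc a b))
    open OneVertexLine s sgn w a b x 2≤x
      (λ j j<a → trans (w-suc j) (nth-replicate a j _ j<a))
      (trans (w-suc a) (after-ones a _ 0))
      (λ j j<b → trans (w-suc (j + suc a)) (trans (after-branch a x _ j) (nth-ones b j j<b)))
      (trans (w-suc (b + suc a)) (trans (after-branch a x _ b) (nth-ones-end b)))

  two-branching : let ds = pre ++ y ∷ replicate a 1 ++ x ∷ replicate b 1 ++ 3 ∷ replicate b 1 in
    All (1 ≤_) ds → Profile (nth ds) i (ζ s) → Returns T ds →
    suc a + suc a ≡ suc b + suc b × s ≡ 1ℤ × x ≡ 2
  two-branching ps P h = two-line T λ t →
    proj₂ (line-periodic ds ps P (suc T) (returning h) (λ _ → 0ℚ) _ t (suc (b + suc a))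
      (below (y ∷ replicate a 1 ++ x ∷ lower)
      (b + suc a) (a + suc (b + suc b)) bound (cong suc len)))
    where
    lower = replicate b 1 ++ 3 ∷ replicate b 1
    ds = pre ++ y ∷ replicate a 1 ++ x ∷ lower
    w : ℕ → ℕ
    w m = nth ds (m + i)
    w-suc : ∀ j → w (suc j) ≡ nth (replicate a 1 ++ x ∷ lower) j
    w-suc j = nth-++ pre (y ∷ replicate a 1 ++ x ∷ lower) (suc j)
    len : length (replicate a 1 ++ x ∷ lower) ≡ a + suc (b + suc b)
    len = trans (List.length-++ (replicate a 1)) (cong₂ (λ m n → m + suc n) (List.length-replicate a)
      (trans (List.length-++ (replicate b 1)) (cong₂ (λ m n → m + suc n) (List.length-replicate b)
        (List.length-replicate b))))
    bound : b + suc a < a + suc (b + suc b)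
    bound = subst (_< a + suc (b + suc b)) (trans (ℕ.+-suc a b)
      (trans (cong suc (ℕ.+-comm a b)) (sym (ℕ.+-suc b a))))
      (ℕ.+-monoʳ-< a (s≤s (ℕ.m<m+n b z<s)))
    deep : ∀ j → w (suc j + suc (b + suc a)) ≡ nth (replicate b 1) j
    deep j = trans (w-suc (j + suc (b + suc a)))
      (trans (cong (nth (replicate a 1 ++ x ∷ lower)) (sym (ℕ.+-assoc j (suc b) (suc a))))
        (trans (after-branch a x lower (j + suc b)) (after-branch b 3 _ j)))
    open TwoVertexLine s sgn w a b x 2≤x
      (λ j j<a → trans (w-suc j) (nth-replicate a j _ j<a))
      (trans (w-suc a) (after-ones a _ 0))
      (λ j j<b → trans (w-suc (j + suc a)) (trans (after-branch a x _ j) (nth-replicate b j _ j<b)))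
      (trans (w-suc (b + suc a)) (trans (after-branch a x _ b) (after-ones b _ 0)))
      (λ j j<b → trans (deep j) (nth-ones b j j<b))
      (trans (deep b) (nth-ones-end b))

-- Splitting at the last entry ≥ 2 leaves only paths below it. Applied again to the prefix, it
-- uncovers the branching levels from the bottom upwards.
data LastBranching : List ℕ → Set where
  none : ∀ n → LastBranching (replicate n 1)
  last : ∀ pre c b → All (1 ≤_) pre → LastBranching (pre ++ 2 + c ∷ replicate b 1)

lastBranching : ∀ d → All (1 ≤_) d → LastBranching d
lastBranching []       []       = none 0
lastBranching (x ∷ xs) (p ∷ ps) with lastBranching xs ps
lastBranching (suc zero    ∷ _) (p ∷ ps) | none n = none (suc n)
lastBranching (suc (suc c) ∷ _) (p ∷ ps) | none n = last [] c n []
lastBranching (x ∷ _) (p ∷ ps) | last pre c b qs = last (x ∷ pre) c b (p ∷ qs)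

Classified : Graph → Set
Classified G =
    (Σ ℕ λ n → (1 ≤ n) × (G ≅ P (suc n)))
  ⊎ (Σ ℕ λ k → Σ ℕ λ l → (1 ≤ k) × (3 ≤ l) × (G ≅ S[ k ]ST l))
  ⊎ (Σ ℕ λ k → (1 ≤ k) × (G ≅ S[ k ]B123))
  ⊎ (Σ ℕ λ k → Σ ℕ λ s → (1 ≤ k) × (2 ≤ s) × (G ≅ S[ k ]Bs3 s))

record Form (d : List ℕ) : Set where
  constructor form
  field forms : Classified (B d)

star-classified : ∀ k c → Form (2 + c ∷ replicate k 1)
star-classified k c = form (inj₂ (inj₁ (suc k , 3 + c , z<s , s≤s (s≤s z<s) ,
  subst (λ xs → B (2 + c ∷ xs) ≅ S[ suc k ]ST (3 + c)) (List.++-identityʳ (replicate k 1))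
    (≅-trans {B (expand k e)} {graph (subdivT (suc k) (betheT e))} {S[ suc k ]ST (3 + c)}
      (Subdivided.expand-≅ k e (z<s ∷ [])) (star-≅ k (suc c))))))
  where e = 2 + c ∷ []

rerooted-classified : ∀ k c → Form (replicate (suc k) 1 ++ 2 + c ∷ replicate k 1)
rerooted-classified k c = form (inj₂ (inj₁ (suc k , 4 + c , z<s , s≤s (s≤s z<s) ,
  subst (λ xs → B (replicate (suc k) 1 ++ 2 + c ∷ xs) ≅ S[ suc k ]ST (4 + c))
    (List.++-identityʳ (replicate k 1))
    (Rerooted.rerooted-≅ k (2 + c) z<s))))

Bs3-classified : ∀ k c → Form (2 + c ∷ replicate k 1 ++ 3 ∷ replicate k 1)
Bs3-classified k c = form (inj₂ (inj₂ (inj₂ (suc k , 2 + c , z<s , s≤s z<s ,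
  subst (λ xs → B (2 + c ∷ replicate k 1 ++ 3 ∷ xs) ≅ S[ suc k ]Bs3 (2 + c)) (List.++-identityʳ (replicate k 1))
    (Subdivided.expand-≅ k (2 + c ∷ 3 ∷ []) (z<s ∷ z<s ∷ []))))))

B123-classified : ∀ k → Form (1 ∷ replicate k 1 ++ 2 ∷ replicate k 1 ++ 3 ∷ replicate k 1)
B123-classified k = form (inj₂ (inj₂ (inj₁ (suc k , z<s ,
  subst (λ xs → B (1 ∷ replicate k 1 ++ 2 ∷ replicate k 1 ++ 3 ∷ xs) ≅ S[ suc k ]B123)
    (List.++-identityʳ (replicate k 1))
    (Subdivided.expand-≅ k (1 ∷ 2 ∷ 3 ∷ []) (z<s ∷ z<s ∷ z<s ∷ []))))))

double-injective : ∀ {a b} → suc a + suc a ≡ suc b + suc b → a ≡ b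
double-injective {a} {b} eq with ℕ.<-cmp a b
... | tri< a<b _ _ = contradiction eq (ℕ.<⇒≢ (ℕ.+-mono-< (s≤s a<b) (s≤s a<b)))
... | tri≈ _ a≡b _ = a≡b
... | tri> _ _ b<a = contradiction (sym eq) (ℕ.<⇒≢ (ℕ.+-mono-< (s≤s b<a) (s≤s b<a)))

dirichlet-at : ∀ pre c ys → Profile (nth (pre ++ 2 + c ∷ ys)) (length pre) (ζ -1ℤ)
dirichlet-at pre c ys = dirichlet (nth (pre ++ 2 + c ∷ ys)) (length pre)
  (subst (2 ≤_) (sym (nth-++ pre (2 + c ∷ ys) 0)) (s≤s z<s))

opposite-signs : ∀ {X Y : Set} → X × -1ℤ ≡ 1ℤ × Y → ⊥
opposite-signs (_ , () , _)

rooted-star : ∀ a b c → suc a + suc a ≡ suc b + suc b → Form (1 ∷ replicate a 1 ++ 2 + c ∷ replicate b 1)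
rooted-star a b c A≡B with double-injective {a} {b} A≡B
... | refl = rerooted-classified a c

rooted-B123 : ∀ n a c {Z : Set} → suc n + suc n ≡ suc a + suc a × Z × 2 + c ≡ 2 →
  Form (1 ∷ replicate n 1 ++ 2 + c ∷ replicate a 1 ++ 3 ∷ replicate a 1)
rooted-B123 n a c (A≡B , _ , refl) with double-injective {n} {a} A≡B
... | refl = B123-classified a

module _ (T : ℕ) where
  three-levels : ∀ pre a c₂ → All (1 ≤_) pre → let ds = pre ++ 2 + c₂ ∷ replicate a 1 ++ 3 ∷ replicate a 1 in
    All (1 ≤_) ds → Returns T ds → Form ds
  three-levels pre a c₂ qs ps h with lastBranching pre qs
  ... | none zero    = Bs3-classified a c₂
  ... | none (suc n) = rooted-B123 n a c₂ (two-branching [] 1 plus n a (2 + c₂) (s≤s z<s) T ps (neumann _) h)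
  -- The branching at c₃ provides a line whose top reflects with sign -1, whereas two vertices below
  -- it require sign 1.
  ... | last pre c₃ a₃ _ = ⊥-elim (opposite-signs (two-branching pre (2 + c₃) minus a₃ a (2 + c₂) (s≤s z<s) T
      (subst (All (1 ≤_)) assoc ps) (dirichlet-at pre c₃ (replicate a₃ 1 ++ lower))
        (subst (Returns T) assoc h)))
    where
    lower = 2 + c₂ ∷ replicate a 1 ++ 3 ∷ replicate a 1
    assoc : (pre ++ 2 + c₃ ∷ replicate a₃ 1) ++ lower ≡ pre ++ 2 + c₃ ∷ replicate a₃ 1 ++ lower
    assoc = List.++-assoc pre (2 + c₃ ∷ replicate a₃ 1) lower

  two-levels : ∀ pre a c₂ b c → All (1 ≤_) pre → let ds = pre ++ 2 + c₂ ∷ replicate a 1 ++ 2 + c ∷ replicate b 1 in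
    suc a + suc a ≡ suc b + suc b × (-1ℤ ≡ -1ℤ → 2 + c ≡ 3) →
    All (1 ≤_) ds → Returns T ds → Form ds
  two-levels pre a c₂ b c qs (A≡B , three) ps h with double-injective {a} {b} A≡B | three refl
  ... | refl | refl = three-levels pre a c₂ qs ps h

  levels : ∀ d → 1 ≤ length d → All (1 ≤_) d → Returns T d → Form d
  levels d 1≤n ps h with lastBranching d ps
  ... | none zero    = contradiction 1≤n λ ()
  ... | none (suc n) = form (inj₁ (suc n , z<s , path-≅ (suc n)))
  ... | last pre c b qs with lastBranching pre qs
  ...   | none zero    = star-classified b c
  -- Only a stem lies above, so the sign is 1 and A = B is all that follows: the tree is a star seen
  -- from one of its leaves, with any number of other legs.
  ...   | none (suc a) = rooted-star a b c
          (proj₁ (one-branching [] 1 plus a b (2 + c) (s≤s z<s) T ps (neumann _) h))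
  ...   | last pre c₂ a qs = subst Form (sym assoc) (two-levels pre a c₂ b c qs
          (one-branching pre (2 + c₂) minus a b (2 + c) (s≤s z<s) T ps′
            (dirichlet-at pre c₂ (replicate a 1 ++ lower)) h′) ps′ h′)
    where
    lower = 2 + c ∷ replicate b 1
    assoc : (pre ++ 2 + c₂ ∷ replicate a 1) ++ lower ≡ pre ++ 2 + c₂ ∷ replicate a 1 ++ lower
    assoc = List.++-assoc pre (2 + c₂ ∷ replicate a 1) lower
    ps′ = subst (All (1 ≤_)) assoc ps
    h′ = subst (Returns T) assoc h

classify : ∀ d → 1 ≤ length d → All (1 ≤_) d → Periodic (B d) → Classified (B d)
classify d 1≤n ps (suc T , _ , h) = Form.forms (levels T d 1≤n ps (returns h))

-- Periods of the listed graphs and the equivalence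

path-period : ∀ n → 1 ≤ n → HasPeriod (P (suc n)) (2 * n)
path-period (suc k) _ = HasPeriod-≅ {B (replicate (suc k) 1)} {P (2 + k)} (2 * suc k) (path-≅ (suc k))
  (subst (λ xs → HasPeriod (B (1 ∷ xs)) (2 * suc k)) (List.++-identityʳ (replicate k 1)) (ones-HasPeriod k))

star-subdivision-period : ∀ k l → 1 ≤ k → 3 ≤ l → HasPeriod (S[ k ]ST l) (4 * k)
star-subdivision-period (suc k) (suc (suc (suc m))) _ _ =
  HasPeriod-≅ {B (expand k e)} {S[ suc k ]ST (3 + m)} (4 * suc k)
    (≅-trans {B (expand k e)} {graph (subdivT (suc k) (betheT e))} {S[ suc k ]ST (3 + m)}
      (Subdivided.expand-≅ k e (z<s ∷ [])) (star-≅ k (suc m)))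
    (star-HasPeriod k m)
  where e = 2 + m ∷ []
star-subdivision-period (suc k) (suc (suc zero)) _ (s≤s (s≤s ()))
star-subdivision-period (suc k) (suc zero)       _ (s≤s ())

B123-subdivision-period : ∀ k → 1 ≤ k → HasPeriod (S[ k ]B123) (12 * k)
B123-subdivision-period (suc k) _ = HasPeriod-≅ {B (expand k e)} {S[ suc k ]B123} (12 * suc k)
  (Subdivided.expand-≅ k e (z<s ∷ z<s ∷ z<s ∷ [])) (B123-HasPeriod k)
  where e = 1 ∷ 2 ∷ 3 ∷ []

Bs3-subdivision-period : ∀ k s → 1 ≤ k → 2 ≤ s → HasPeriod (S[ k ]Bs3 s) (12 * k)
Bs3-subdivision-period (suc k) (suc (suc m)) _ _ = HasPeriod-≅ {B (expand k e)} {S[ suc k ]Bs3 (2 + m)}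
  (12 * suc k)
  (Subdivided.expand-≅ k e (z<s ∷ z<s ∷ [])) (Bs3-HasPeriod k m)
  where e = 2 + m ∷ 3 ∷ []
Bs3-subdivision-period (suc k) (suc zero) _ (s≤s ())

HasPeriod⇒Periodic : ∀ {G} p → HasPeriod G p → Periodic G
HasPeriod⇒Periodic p (1≤p , h , _) = p , 1≤p , h

classified⇒Periodic : ∀ G → Classified G → Periodic G
classified⇒Periodic G (inj₁ (n , 1≤n , i)) =
  Periodic-≅ {G} {P (suc n)} i (HasPeriod⇒Periodic {P (suc n)} (2 * n) (path-period n 1≤n))
classified⇒Periodic G (inj₂ (inj₁ (k , l , 1≤k , 3≤l , i))) =
  Periodic-≅ {G} {S[ k ]ST l} i (HasPeriod⇒Periodic {S[ k ]ST l} (4 * k) (star-subdivision-period k l 1≤k 3≤l))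
classified⇒Periodic G (inj₂ (inj₂ (inj₁ (k , 1≤k , i)))) =
  Periodic-≅ {G} {S[ k ]B123} i (HasPeriod⇒Periodic {S[ k ]B123} (12 * k) (B123-subdivision-period k 1≤k))
classified⇒Periodic G (inj₂ (inj₂ (inj₂ (k , s , 1≤k , 2≤s , i)))) =
  Periodic-≅ {G} {S[ k ]Bs3 s} i (HasPeriod⇒Periodic {S[ k ]Bs3 s} (12 * k)
    (Bs3-subdivision-period k s 1≤k 2≤s))

theorem1p1 : ((d : List ℕ) → 1 ≤ length d → All (1 ≤_) d →
    (Periodic (B d) ⇔
    ((Σ ℕ λ n → (1 ≤ n) × (B d ≅ P (suc n)))
    ⊎ (Σ ℕ λ k → Σ ℕ λ l → (1 ≤ k) × (3 ≤ l) × (B d ≅ S[ k ]ST l))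
    ⊎ (Σ ℕ λ k → (1 ≤ k) × (B d ≅ S[ k ]B123))
    ⊎ (Σ ℕ λ k → Σ ℕ λ s → (1 ≤ k) × (2 ≤ s) × (B d ≅ S[ k ]Bs3 s)))))
    × (∀ n → 1 ≤ n → HasPeriod (P (suc n)) (2 * n))
    × (∀ k l → 1 ≤ k → 3 ≤ l → HasPeriod (S[ k ]ST l) (4 * k))
    × (∀ k → 1 ≤ k → HasPeriod (S[ k ]B123) (12 * k))
    × (∀ k s → 1 ≤ k → 2 ≤ s → HasPeriod (S[ k ]Bs3 s) (12 * k))
theorem1p1 =
  (λ d 1≤n ps → mk⇔ (classify d 1≤n ps) (classified⇒Periodic (B d))) ,
  path-period , star-subdivision-period , B123-subdivision-period , Bs3-subdivision-period
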